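{- Let $\mathcal{H}\subseteq E^{[\infty]}$ be a strategic $(p^+)$-family of block sequences and let $\mathbb{A}\subseteq \mathbb{R}\times E^{[\infty]}$ be analytic. Then there are a nonempty perfect set $P\subseteq\mathbb{R}$ and an $X\in\mathcal{H}$ such that either (i) player I has a strategy $\sigma$ in $F[X]$ such that $P\times[\sigma]\subseteq(\mathbb{R}\times E^{[\infty]})\setminus\mathbb{A}$, or (ii) for every $t\in P$, player II has a strategy in $G[X]$ for playing into $\mathbb{A}_t=\{Y\in E^{[\infty]}:(t,Y)\in\mathbb{A}\}$.
   Context: $F$ is a countable (possibly finite) field and $E$ a countably infinite-dimensional $F$-vector space with fixed basis $(e_n)$. $\mathrm{supp}(v)$ is the set of indices of nonzero coefficients of $v\neq0$. A block sequence is a sequence $(x_n)$ of nonzero vectors with $\max\mathrm{supp}(x_n)<\min\mathrm{supp}(x_{n+1})$. $E^{[\infty]}$ is the Polish space of infinite block sequences (subspace of $E^\omega$, $E$ discrete). $\langle X\rangle$ is the span; $Y\preceq X$ iff $\langle Y\rangle\subseteq\langle X\rangle$; $X/n$ is the tail of $X$ of vectors with support above $n$; $Y\preceq^*X$ iff $Y/n\preceq X$ for some $n$. A family is a nonempty $\mathcal{H}\subseteq E^{[\infty]}$ upward closed under $\preceq^*$; $\mathcal{H}\restriction X=\{Y\in\mathcal{H}:Y\preceq X\}$. $D\subseteq E$ is $\mathcal{H}$-dense below $X\in\mathcal{H}$ if for all $Y\in\mathcal{H}\restriction X$ there is $Z\in E^{[\infty]}$ with $Z\preceq Y$ and $\langle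 Z\rangle\subseteq D$. $\mathcal{H}$ is full if whenever $D$ is $\mathcal{H}$-dense below some $X\in\mathcal{H}$ there is $Z\in\mathcal{H}\restriction X$ with $\langle Z\rangle\subseteq D$. $\mathcal{H}$ is a $(p)$-family if every $\preceq$-decreasing sequence $(X_n)$ in $\mathcal{H}$ has some $X\in\mathcal{H}$ with $X\preceq^*X_n$ for all $n$; a $(p^+)$-family is a full $(p)$-family. $\mathcal{H}$ is strategic if whenever $X\in\mathcal{H}$ and $\alpha$ is a strategy for II in $G[X]$, some outcome of $\alpha$ lies in $\mathcal{H}$. Games: in $F[X]$, I plays $n_k\in\omega$ and II plays nonzero $y_k\in\langle X\rangle$ with $n_k<\min\mathrm{supp}(y_k)$; in $G[X]$, I plays $Y_k\preceq X$ in $E^{[\infty]}$ and II plays nonzero $y_k\in\langle Y_k\rangle$; in both II's moves must form a block sequence, which is the outcome. Strategies are functions from finite sequences of the opponent's moves to moves; "playing into (out of)" a set means all outcomes lie in (outside) it; $[\sigma]$ is the set of outcomes of plays where I follows $\sigma$. -}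

module Defs where

open import Algebra.Bundles using (CommutativeRing)
open import Algebra.Module.Bundles using (Module)
import Algebra.Properties.Monoid.Sum as MonoidSum
open import Data.Fin.Base using (Fin; toℕ)
open import Data.Nat.Base as ℕ using (ℕ; suc)
open import Data.Product.Base using (Σ-syntax; ∃; ∃-syntax; _×_; _,_; proj₁; proj₂)
open import Data.Product.Relation.Binary.Pointwise.NonDependent using (×-setoid)
open import Data.Rational.Base as ℚ using (ℚ)
open import Data.Sum.Base using (_⊎_)
open import Data.Vec.Base using (Vec; tabulate)
open import Data.Vec.Relation.Binary.Pointwise.Inductive using (Pointwise)
open import Function.Bundles using (Surjection; _⇔_)
open import Level using (Level; 0ℓ; _⊔_) renaming (suc to lsuc)
open import Relation.Binary.Bundles using (Setoid)
import Relation.Binary.Construct.On as On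
import Relation.Binary.PropositionalEquality as ≡
open import Relation.Nullary.Negation using (¬_)
open import Relation.Unary using (Pred; _∈_; _⊆_; _≐_; Empty; Satisfiable)
open import Relation.Unary.Relation.Binary.Equality using (≐-setoid)

private
  variable
    a b c d i j ℓ ℓ′ p q : Level

-- A topology is presented by a base of open sets: an index set Basic
-- together with the membership relation of points in basic open sets.
record Space (c ℓ b i : Level) : Set (lsuc (c ⊔ ℓ ⊔ b ⊔ i)) where
  field
    points : Setoid c ℓ
    Basic  : Set b
    _∈ᵇ_   : Setoid.Carrier points → Basic → Set i

  open Setoid points public using (_≈_; _≉_) renaming (Carrier to Point)

  Closed : Pred Point p → Set _
  Closed P = ∀ x → (∀ U → x ∈ᵇ U → ∃[ y ] y ∈ᵇ U × y ∈ P) → x ∈ P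

  NoIsolatedPoints : Pred Point p → Set _
  NoIsolatedPoints P =
    ∀ x → x ∈ P → ∀ U → x ∈ᵇ U → ∃[ y ] y ∈ᵇ U × y ∈ P × y ≉ x

  Perfect : Pred Point p → Set _
  Perfect P = Closed P × NoIsolatedPoints P

Continuous : (S : Space c ℓ b i) (T : Space d ℓ′ a j) →
             (Space.Point S → Space.Point T) → Set _
Continuous S T f =
  ∀ x V → f x T.∈ᵇ V → ∃[ U ] x S.∈ᵇ U × (∀ y → y S.∈ᵇ U → f y T.∈ᵇ V)
  where
  module S = Space S
  module T = Space T

_×ˢ_ : Space c ℓ b i → Space d ℓ′ a j → Space (c ⊔ d) (ℓ ⊔ ℓ′) (b ⊔ a) (i ⊔ j)
S ×ˢ T = record
  { points = ×-setoid S.points T.points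
  ; Basic  = S.Basic × T.Basic
  ; _∈ᵇ_   = λ (x , y) (U , V) → x S.∈ᵇ U × y T.∈ᵇ V
  }
  where
  module S = Space S
  module T = Space T

subspace : {B : Set d} (S : Space c ℓ b i) → (B → Space.Point S) → Space d ℓ b i
subspace S f = record
  { points = On.setoid (Space.points S) f
  ; Basic  = Space.Basic S
  ; _∈ᵇ_   = λ x U → Space._∈ᵇ_ S (f x) U
  }

sequenceSetoid : Setoid c ℓ → Setoid c ℓ
sequenceSetoid S = record
  { Carrier       = ℕ → S.Carrier
  ; _≈_           = λ x y → ∀ n → x n S.≈ y n
  ; isEquivalence = record
    { refl  = λ n → S.refl
    ; sym   = λ x≈y n → S.sym (x≈y n)
    ; trans = λ x≈y y≈z n → S.trans (x≈y n) (y≈z n)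
    }
  }
  where module S = Setoid S

-- S^ω for S discrete; the basic open set (z , n) consists of the
-- sequences that agree with z at all positions below n.
_^ω : Setoid c ℓ → Space c ℓ c ℓ
S ^ω = record
  { points = sequenceSetoid S
  ; Basic  = (ℕ → S.Carrier) × ℕ
  ; _∈ᵇ_   = λ x (z , n) → ∀ k → k ℕ.< n → x k S.≈ z k
  }
  where module S = Setoid S

Baire : Space 0ℓ 0ℓ 0ℓ 0ℓ
Baire = ≡.setoid ℕ ^ω

Analytic : (S : Space c ℓ b i) → Pred (Space.Point S) p → Set _
Analytic S A =
  Empty A ⊎
  (∃[ f ] Continuous Baire S f × A ≐ (λ x → ∃[ z ] f z ≈ x))
  where open Space S

-- Two-sided Dedekind cuts: L x stands for x < t, and U x for t < x.
record ℝ : Set₁ where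
  field
    L U         : Pred ℚ 0ℓ
    L-inhabited : ∃ L
    U-inhabited : ∃ U
    L-rounded   : ∀ x → L x ⇔ (∃[ y ] x ℚ.< y × L y)
    U-rounded   : ∀ x → U x ⇔ (∃[ y ] y ℚ.< x × U y)
    disjoint    : ∀ x → ¬ (L x × U x)
    located     : ∀ {x y} → x ℚ.< y → L x ⊎ U y

ℝ-setoid : Setoid (lsuc 0ℓ) 0ℓ
ℝ-setoid = On.setoid (×-setoid (≐-setoid ℚ 0ℓ) (≐-setoid ℚ 0ℓ))
                     (λ (t : ℝ) → ℝ.L t , ℝ.U t)

-- The basic open set (x , y) is the open interval from x to y.
ℝˢ : Space (lsuc 0ℓ) 0ℓ 0ℓ 0ℓ
ℝˢ = record
  { points = ℝ-setoid
  ; Basic  = ℚ × ℚ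
  ; _∈ᵇ_   = λ t (x , y) → ℝ.L t x × ℝ.U t y
  }

IsField : CommutativeRing c ℓ → Set _
IsField F = ¬ (1# ≈ 0#) × (∀ x → ¬ (x ≈ 0#) → ∃[ y ] x * y ≈ 1#)
  where open CommutativeRing F

-- Finite sets are included, as the enumeration may repeat elements.
Countable : Setoid c ℓ → Set _
Countable S = Surjection (≡.setoid ℕ) S

module LinearAlgebra {c ℓ m ℓm} (F : CommutativeRing c ℓ) (E : Module F m ℓm) where

  private module F = CommutativeRing F
  open Module E

  combination : ∀ {k} → (Fin k → F.Carrier) → (Fin k → Carrierᴹ) → Carrierᴹ
  combination x u = MonoidSum.sum +ᴹ-monoid (λ n → x n *ₗ u n)

  Span : Pred Carrierᴹ p → Pred Carrierᴹ _
  Span S v = ∃[ k ] Σ[ x ∈ (Fin k → F.Carrier) ] Σ[ u ∈ (Fin k → Carrierᴹ) ]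
             (∀ n → u n ∈ S) × v ≈ᴹ combination x u

  Range : (ℕ → Carrierᴹ) → Pred Carrierᴹ _
  Range X v = ∃[ n ] v ≈ᴹ X n

  record IsBasis (e : ℕ → Carrierᴹ) : Set (c ⊔ ℓ ⊔ m ⊔ ℓm) where
    field
      spanning    : ∀ v → v ∈ Span (Range e)
      independent : ∀ k (x : Fin k → F.Carrier) →
                    combination x (λ n → e (toℕ n)) ≈ᴹ 0ᴹ → ∀ n → x n F.≈ F.0#

module BlockSequences {c ℓ m ℓm} (F : CommutativeRing c ℓ) (E : Module F m ℓm)
                      (e : ℕ → Module.Carrierᴹ E) where

  private module F = CommutativeRing F
  open Module E using (Carrierᴹ; _≈ᴹ_; _≉ᴹ_; 0ᴹ; ≈ᴹ-setoid)
  open LinearAlgebra F E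

  -- supp v n: in some expansion of v over an initial segment of e, the
  -- coefficient of e n is nonzero.  For e a basis, expansions are unique
  -- up to trailing zeros.
  supp : Carrierᴹ → Pred ℕ _
  supp v n = ∃[ k ] Σ[ x ∈ (Fin k → F.Carrier) ]
             v ≈ᴹ combination x (λ i → e (toℕ i)) ×
             (∃[ i ] toℕ i ≡.≡ n × ¬ (x i F.≈ F.0#))

  -- n < min (supp v), for v nonzero
  _<supp_ : ℕ → Carrierᴹ → Set _
  n <supp v = ∀ j → j ∈ supp v → n ℕ.< j

  -- max (supp v) < min (supp w), for v and w nonzero
  _≪_ : Carrierᴹ → Carrierᴹ → Set _
  v ≪ w = ∀ i → i ∈ supp v → i <supp w

  record E∞ : Set (c ⊔ ℓ ⊔ m ⊔ ℓm) where
    field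
      vec     : ℕ → Carrierᴹ
      nonzero : ∀ n → vec n ≉ᴹ 0ᴹ
      block   : ∀ n → vec n ≪ vec (suc n)

  open E∞ public using (vec)

  E∞ˢ : Space (c ⊔ ℓ ⊔ m ⊔ ℓm) ℓm m ℓm
  E∞ˢ = subspace (≈ᴹ-setoid ^ω) vec

  open Space E∞ˢ public using () renaming (_≈_ to _≈∞_)

  ⟨_⟩ : E∞ → Pred Carrierᴹ _
  ⟨ X ⟩ = Span (Range (vec X))

  infix 4 _≼_ _≼*_

  _≼_ : E∞ → E∞ → Set _
  Y ≼ X = ⟨ Y ⟩ ⊆ ⟨ X ⟩

  -- The set of terms of the tail X/n
  _/_ : E∞ → ℕ → Pred Carrierᴹ _
  (X / n) v = v ∈ Range (vec X) × n <supp v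

  _≼*_ : E∞ → E∞ → Set _
  Y ≼* X = ∃[ n ] Span (Y / n) ⊆ ⟨ X ⟩

  -- Strategies are functions on E∞ and E as sets, so they are
  -- required to respect the equalities ≈∞ and ≈ᴹ.

  _↾_ : {A : Set a} → (ℕ → A) → ∀ k → Vec A k
  f ↾ k = tabulate (λ i → f (toℕ i))

  -- Strategies for I in F[X].  As every natural number is a legal move
  -- for I, the move may be specified after all sequences of vectors; only
  -- those consisting of legal moves of II in F[X] matter for outcomes.
  record StrategyI : Set (c ⊔ ℓ ⊔ m ⊔ ℓm) where
    field
      move : ∀ {k} → Vec Carrierᴹ k → ℕ
      cong : ∀ {k} {u v : Vec Carrierᴹ k} →
             Pointwise _≈ᴹ_ u v → move u ≡.≡ move v

  -- The set [σ]; the quantification over I's moves is absorbed, since they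
  -- are determined by σ and the vectors played so far.
  OutcomeF : E∞ → StrategyI → Pred E∞ _
  OutcomeF X σ Y =
    ∀ k → vec Y k ∈ ⟨ X ⟩ × StrategyI.move σ (vec Y ↾ k) <supp vec Y k

  Below : E∞ → Set _
  Below X = Σ[ Y ∈ E∞ ] Y ≼ X

  -- Strategies for II in G[X]: II answers after each nonempty sequence of
  -- moves of I, and all answers are legal.
  record StrategyII (X : E∞) : Set (c ⊔ ℓ ⊔ m ⊔ ℓm) where
    field
      move : ∀ {k} → Vec (Below X) (suc k) → Carrierᴹ
      cong : ∀ {k} {u v : Vec (Below X) (suc k)} →
             Pointwise (λ Y Z → proj₁ Y ≈∞ proj₁ Z) u v → move u ≈ᴹ move v

    answer : (ℕ → Below X) → ℕ → Carrierᴹ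
    answer Y k = move (Y ↾ suc k)

    field
      inSpan  : ∀ Y k → answer Y k ∈ ⟨ proj₁ (Y k) ⟩
      nonzero : ∀ Y k → answer Y k ≉ᴹ 0ᴹ
      block   : ∀ Y k → answer Y k ≪ answer Y (suc k)

    outcome : (ℕ → Below X) → E∞
    outcome Y = record { vec = answer Y ; nonzero = nonzero Y ; block = block Y }

  module _ {h} (H : Pred E∞ h) where

    IsFamily : Set _
    IsFamily = Satisfiable H × (∀ {X Y} → X ∈ H → X ≼* Y → Y ∈ H)

    DenseBelow : Pred Carrierᴹ p → E∞ → Set _
    DenseBelow D X = ∀ Y → Y ∈ H → Y ≼ X → ∃[ Z ] Z ≼ Y × ⟨ Z ⟩ ⊆ D

    -- Under excluded middle every subset of E is equivalent to one with
    -- values in Set, so D at the lowest level covers all subsets.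
    IsFull : Set _
    IsFull = ∀ (D : Pred Carrierᴹ 0ℓ) X → X ∈ H → DenseBelow D X →
             ∃[ Z ] Z ∈ H × Z ≼ X × ⟨ Z ⟩ ⊆ D

    HasPProperty : Set _
    HasPProperty = ∀ (X : ℕ → E∞) → (∀ n → X n ∈ H) → (∀ n → X (suc n) ≼ X n) →
                   ∃[ Y ] Y ∈ H × (∀ n → Y ≼* X n)

    IsPPlusFamily : Set _
    IsPPlusFamily = IsFamily × IsFull × HasPProperty

    IsStrategic : Set _
    IsStrategic = ∀ X → X ∈ H → (α : StrategyII X) →
                  ∃[ Y ] StrategyII.outcome α Y ∈ H

{-# OPTIONS --safe #-}
-- Conditions (T , X), with T a perfect set and X ∈ H, can be fused by the
-- (p)-property: countably many properties of conditions are decided at all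
-- nodes of T of sufficiently high level.
--
-- The key is a pigeonhole principle with parameters.  Let D_t be a set of
-- vectors that is open in t ∈ T.  Then (T , X) can be shrunk so that either
-- ⟨X⟩ misses all D_t, or for all t every ⟨Z⟩ with Z ≼ X meets D_t.  If the
-- second alternative fails below (T , X), call a finite set W bad at a node p
-- if it spans, together with any Z ≼ X, an element of D_t for each t ∈ T_p.
-- Then ∅ is never bad; if W is never bad below p, then by fullness almost all
-- y ∈ ⟨X⟩ are such that W ∪ {y} is never bad below some extension of p.  So
-- II can choose vectors y_k in G[X] and a perfect tree of nodes with
-- {y_0 , … , y_k} never bad at level k; an outcome in H avoids all D_t.
--
-- Now let A = f[ℕ^ℕ] and A_s = f[N_s].  Suppose that I can nowhere avoid A
-- uniformly in the parameter, and call (t , x , s) safe if I can nowhere below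
-- t avoid A_s from the finite position x.  If II could not force, from a safe
-- (t , x , s), a safe (t , x ⌢ y , s ⌢ n), then the pigeonhole principle would
-- let I prevent this uniformly in t, and I would avoid every A_{s ⌢ n} by
-- following, from a late enough stage on, the strategies for the finitely many
-- relevant nodes, a contradiction.  So II moves from safe positions to safe
-- positions for longer and longer s, and by continuity of f the outcome is in
-- A_t.

module Submission where

open import Defs
open import Algebra.Bundles using (CommutativeMonoid; CommutativeRing)
open import Algebra.Module.Bundles using (Module)
import Algebra.Properties.CommutativeSemigroup as CommutativeSemigroupProperties
import Algebra.Properties.Monoid.Sum as MonoidSum
open import Axiom.ExcludedMiddle using (ExcludedMiddle)
open import Data.Bool.Base using (Bool; true; false; T; not)
open import Data.Empty using (⊥-elim)
open import Data.Fin.Base as Fin using (Fin; toℕ; fromℕ; fromℕ<; inject₁)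
import Data.Fin.Properties as Finₚ
open import Data.Integer.Base as ℤ using (+_; +[1+_]; -[1+_])
open import Data.List.Base using (List; []; _∷_; _++_; length; map; replicate)
import Data.List.Properties as Listₚ
open import Data.List.Relation.Unary.Any using (Any; here; there)
open import Data.Nat.Base as ℕ using (ℕ; zero; suc; _+_; _∸_; _⊔_; _≤_; _<_; z≤n; s≤s)
open import Data.Nat.Induction using (<-rec)
import Data.Nat.Properties as ℕₚ
open import Data.Product.Base using (Σ-syntax; ∃; ∃-syntax; _×_; _,_; proj₁; proj₂)
open import Data.Rational.Base as ℚ using (ℚ; mkℚ; toℚᵘ; 0ℚ; 1ℚ)
import Data.Rational.Properties as ℚₚ
open import Data.Rational.Unnormalised.Base as ℚᵘ using (mkℚᵘ)
import Data.Rational.Unnormalised.Properties as ℚᵘₚ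
open import Data.Sum.Base using (_⊎_; inj₁; inj₂)
open import Data.Unit.Base using (tt)
open import Data.Vec.Base as Vec using (Vec; tabulate)
open import Data.Vec.Relation.Binary.Pointwise.Inductive using (Pointwise; []; _∷_)
open import Function.Base using (_∘_; id)
open import Function.Bundles using (Surjection; module Equivalence; mk⇔)
open import Level using (Level; 0ℓ) renaming (suc to lsuc; _⊔_ to _⊔ℓ_)
open import Relation.Binary.Definitions using (tri<; tri≈; tri>)
open import Relation.Binary.PropositionalEquality using (_≡_; _≢_; refl; sym; trans; cong; cong₂; subst; module ≡-Reasoning)
import Relation.Binary.Reasoning.Setoid as SetoidReasoning
open import Relation.Nullary using (¬_; Dec; yes; no; does)
open import Relation.Unary using (Pred; _∈_; _⊆_; Satisfiable)

private
  variable
    a b i p q t : Level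


-- Excluded middle and enumerations

Least : (ℕ → Set a) → ℕ → Set a
Least P n = P n × (∀ {m} → m < n → ¬ P m)

-- Minimality depends only on the extension of a predicate. Codes and the answers of II are least
-- witnesses, and this is why they respect `≈ᴹ` and `≈∞`.
Least-unique : {P : ℕ → Set a} {Q : ℕ → Set b} →
               (∀ {n} → P n → Q n) → (∀ {n} → Q n → P n) →
               ∀ {m n} → Least P m → Least Q n → m ≡ n
Least-unique f g {m} {n} (p , ¬p) (q , ¬q) with ℕₚ.<-cmp m n
... | tri< m<n _ _ = ⊥-elim (¬q m<n (f p))
... | tri≈ _ eq _  = eq
... | tri> _ _ n<m = ⊥-elim (¬p n<m (g q))

module Classical (em : ∀ {u} → ExcludedMiddle u) where

  dne : {A : Set a} → ¬ ¬ A → A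
  dne {A = A} nn with em {P = A}
  ... | yes x = x
  ... | no ¬x = ⊥-elim (nn ¬x)

  least : (P : ℕ → Set a) → ∃ P → ∃ (Least P)
  least P (n , p) = go n p
    where
    go : ∀ n → P n → ∃ (Least P)
    go = <-rec _ λ n rec p → case n rec p (em {P = ∃[ m ] m < n × P m})
      where
      case : ∀ n → (∀ {m} → m < n → P m → ∃ (Least P)) → P n →
             Dec (∃[ m ] m < n × P m) → ∃ (Least P)
      case n rec p (yes (m , m<n , q)) = rec m<n q
      case n rec p (no ¬q)             = n , p , λ m<n q → ¬q (_ , m<n , q)

nextPair : ℕ × ℕ → ℕ × ℕ
nextPair (zero  , b) = suc b , 0
nextPair (suc a , b) = a , suc b

unpair : ℕ → ℕ × ℕ
unpair zero    = 0 , 0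
unpair (suc n) = nextPair (unpair n)

unpair-surjective : ∀ a b → ∃[ n ] unpair n ≡ (a , b)
unpair-surjective a b = onDiagonal (a + b) a b refl
  where
  onDiagonal : ∀ s a b → a + b ≡ s → ∃[ n ] unpair n ≡ (a , b)
  onDiagonal zero    zero    zero    eq = 0 , refl
  -- The predecessor of (a , suc b) is (suc a , b) on the same antidiagonal; that of (suc a , 0) is
  -- (0 , a) on the previous one.
  onDiagonal (suc s) a       (suc b) eq =
    let n , e = onDiagonal (suc s) (suc a) b (trans (sym (ℕₚ.+-suc a b)) eq)
    in suc n , cong nextPair e
  onDiagonal (suc s) (suc a) zero    eq =
    let n , e = onDiagonal s zero a (ℕₚ.suc-injective (trans (sym (cong suc (ℕₚ.+-identityʳ a))) eq))
    in suc n , cong nextPair e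

unlist : ℕ → ℕ → List ℕ
unlist zero    n = []
unlist (suc k) n = proj₁ (unpair n) ∷ unlist k (proj₂ (unpair n))

enumList : ℕ → List ℕ
enumList n = unlist (proj₁ (unpair n)) (proj₂ (unpair n))

enumList-surjective : ∀ l → ∃[ n ] enumList n ≡ l
enumList-surjective l =
  let m , e = onLength l
      n , d = unpair-surjective (length l) m
  in n , trans (cong (λ u → unlist (proj₁ u) (proj₂ u)) d) e
  where
  onLength : ∀ l → ∃[ n ] unlist (length l) n ≡ l
  onLength []      = 0 , refl
  onLength (x ∷ l) =
    let m , e = onLength l
        n , d = unpair-surjective x m
    in n , trans (cong (λ u → proj₁ u ∷ unlist (length l) (proj₂ u)) d) (cong (x ∷_) e)

enumPair : ℕ → List ℕ × List ℕ
enumPair n = enumList (proj₁ (unpair n)) , enumList (proj₂ (unpair n))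

enumPair-surjective : ∀ x s → ∃[ n ] enumPair n ≡ (x , s)
enumPair-surjective x s =
  let i , d = enumList-surjective x
      j , e = enumList-surjective s
      n , c = unpair-surjective i j
  in n , trans (cong (λ u → enumList (proj₁ u) , enumList (proj₂ u)) c) (cong₂ _,_ d e)

-- Coordinates and spans

module Coordinates {c ℓ m ℓm} (F : CommutativeRing c ℓ) (E : Module F m ℓm)
                   (e : ℕ → Module.Carrierᴹ E) (basis : LinearAlgebra.IsBasis F E e) where

  module F = CommutativeRing F
  open Module E
  open LinearAlgebra F E
  open IsBasis basis
  open MonoidSum +ᴹ-monoid using (sum; sum-init-last; sum-cong-≋)
  open CommutativeSemigroupProperties (CommutativeMonoid.commutativeSemigroup +ᴹ-commutativeMonoid)
    using (interchange)
  module ≈ᴹ-Reasoning = SetoidReasoning ≈ᴹ-setoid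

  partialSum : ℕ → (ℕ → F.Carrier) → Carrierᴹ
  partialSum zero    a = 0ᴹ
  partialSum (suc K) a = partialSum K a +ᴹ a K *ₗ e K

  partialSum-cong : ∀ K {a b} → (∀ i → a i F.≈ b i) → partialSum K a ≈ᴹ partialSum K b
  partialSum-cong zero    eq = ≈ᴹ-refl
  partialSum-cong (suc K) eq = +ᴹ-cong (partialSum-cong K eq) (*ₗ-cong (eq K) ≈ᴹ-refl)

  combination≈partialSum : ∀ K (x : Fin K → F.Carrier) a → (∀ i → x i F.≈ a (toℕ i)) →
                           combination x (λ i → e (toℕ i)) ≈ᴹ partialSum K a
  combination≈partialSum zero    x a eq = ≈ᴹ-refl
  combination≈partialSum (suc K) x a eq = begin
    sum term                          ≈⟨ sum-init-last term ⟩
    sum (λ i → term (inject₁ i)) +ᴹ term (fromℕ K)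
      ≈⟨ +ᴹ-cong (≈ᴹ-trans
           (sum-cong-≋ {K} {λ i → term (inject₁ i)} {λ i → x (inject₁ i) *ₗ e (toℕ i)} λ i → *ₗ-cong F.refl (≈ᴹ-reflexive (cong e (Finₚ.toℕ-inject₁ i))))
           (combination≈partialSum K (λ i → x (inject₁ i)) a
             λ i → F.trans (eq (inject₁ i)) (F.reflexive (cong a (Finₚ.toℕ-inject₁ i)))))
           (*ₗ-cong (F.trans (eq (fromℕ K)) (F.reflexive (cong a (Finₚ.toℕ-fromℕ K))))
                    (≈ᴹ-reflexive (cong e (Finₚ.toℕ-fromℕ K)))) ⟩
    partialSum (suc K) a           ∎
    where
    open ≈ᴹ-Reasoning
    term : Fin (suc K) → Carrierᴹ
    term i = x i *ₗ e (toℕ i)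

  VanishesFrom : ℕ → (ℕ → F.Carrier) → Set _
  VanishesFrom K a = ∀ i → K ≤ i → a i F.≈ F.0#

  partialSum-extend : ∀ K d {a} → VanishesFrom K a → partialSum (d + K) a ≈ᴹ partialSum K a
  partialSum-extend K zero    z = ≈ᴹ-refl
  partialSum-extend K (suc d) {a} z = begin
    partialSum (d + K) a +ᴹ a (d + K) *ₗ e (d + K)
      ≈⟨ +ᴹ-cong (partialSum-extend K d z) (*ₗ-cong (z (d + K) (ℕₚ.m≤n+m K d)) ≈ᴹ-refl) ⟩
    partialSum K a +ᴹ F.0# *ₗ e (d + K)  ≈⟨ +ᴹ-cong ≈ᴹ-refl (*ₗ-zeroˡ _) ⟩
    partialSum K a +ᴹ 0ᴹ                 ≈⟨ +ᴹ-identityʳ _ ⟩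
    partialSum K a                       ∎
    where open ≈ᴹ-Reasoning

  partialSum-≤ : ∀ {K L a} → K ≤ L → VanishesFrom K a → partialSum L a ≈ᴹ partialSum K a
  partialSum-≤ {K} {L} {a} K≤L z =
    subst (λ L → partialSum L a ≈ᴹ partialSum K a) (ℕₚ.m∸n+n≡m K≤L) (partialSum-extend K (L ℕ.∸ K) z)

  partialSum-zero : ∀ K {a} → (∀ i → i < K → a i F.≈ F.0#) → partialSum K a ≈ᴹ 0ᴹ
  partialSum-zero zero    z = ≈ᴹ-refl
  partialSum-zero (suc K) z = ≈ᴹ-trans
    (+ᴹ-cong (partialSum-zero K λ i i<K → z i (ℕₚ.m≤n⇒m≤1+n i<K))
             (≈ᴹ-trans (*ₗ-cong (z K ℕₚ.≤-refl) ≈ᴹ-refl) (*ₗ-zeroˡ _)))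
    (+ᴹ-identityʳ _)

  partialSum-+ : ∀ K a b → partialSum K (λ i → a i F.+ b i) ≈ᴹ partialSum K a +ᴹ partialSum K b
  partialSum-+ zero    a b = ≈ᴹ-sym (+ᴹ-identityʳ _)
  partialSum-+ (suc K) a b = ≈ᴹ-trans
    (+ᴹ-cong (partialSum-+ K a b) (*ₗ-distribʳ _ _ _)) (interchange _ _ _ _)

  partialSum-* : ∀ K y a → partialSum K (λ i → y F.* a i) ≈ᴹ y *ₗ partialSum K a
  partialSum-* zero    y a = ≈ᴹ-sym (*ₗ-zeroʳ y)
  partialSum-* (suc K) y a = ≈ᴹ-trans
    (+ᴹ-cong (partialSum-* K y a) (*ₗ-assoc _ _ _)) (≈ᴹ-sym (*ₗ-distribˡ _ _ _))

  -- Coefficients are indexed by all of ℕ, so that expansions of different lengths can be added and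
  -- compared without reindexing.
  Expansion : Carrierᴹ → (ℕ → F.Carrier) → Set _
  Expansion v a = ∃[ K ] VanishesFrom K a × v ≈ᴹ partialSum K a

  Expansion-resp : ∀ {v w a} → v ≈ᴹ w → Expansion v a → Expansion w a
  Expansion-resp eq (K , z , v≈) = K , z , ≈ᴹ-trans (≈ᴹ-sym eq) v≈

  Expansion-widen : ∀ {v a K} (x : Expansion v a) → proj₁ x ≤ K → v ≈ᴹ partialSum K a
  Expansion-widen (_ , z , v≈) K≤L = ≈ᴹ-trans v≈ (≈ᴹ-sym (partialSum-≤ K≤L z))

  Expansion-0 : ∀ {v} → v ≈ᴹ 0ᴹ → Expansion v (λ _ → F.0#)
  Expansion-0 v≈0 = 0 , (λ _ _ → F.refl) , v≈0

  Expansion-+ : ∀ {v w a b} → Expansion v a → Expansion w b → Expansion (v +ᴹ w) (λ i → a i F.+ b i)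
  Expansion-+ {a = a} {b} x@(K , z , _) y@(L , z′ , _) =
    K ⊔ L ,
    (λ i le → F.trans (F.+-cong (z i (ℕₚ.≤-trans (ℕₚ.m≤m⊔n K L) le))
                                (z′ i (ℕₚ.≤-trans (ℕₚ.m≤n⊔m K L) le)))
                      (F.+-identityʳ _)) ,
    ≈ᴹ-trans (+ᴹ-cong (Expansion-widen x (ℕₚ.m≤m⊔n K L)) (Expansion-widen y (ℕₚ.m≤n⊔m K L)))
             (≈ᴹ-sym (partialSum-+ (K ⊔ L) a b))

  Expansion-* : ∀ {v a} y → Expansion v a → Expansion (y *ₗ v) (λ i → y F.* a i)
  Expansion-* {a = a} y (K , z , v≈) =
    K , (λ i le → F.trans (F.*-cong F.refl (z i le)) (F.zeroʳ y)) ,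
    ≈ᴹ-trans (*ₗ-cong F.refl v≈) (≈ᴹ-sym (partialSum-* K y a))

  unit : ℕ → ℕ → F.Carrier
  unit j i with i ℕₚ.≟ j
  ... | yes _ = F.1#
  ... | no  _ = F.0#

  unit-≢ : ∀ {j i} → i ≢ j → unit j i F.≈ F.0#
  unit-≢ {j} {i} ne with i ℕₚ.≟ j
  ... | yes eq = ⊥-elim (ne eq)
  ... | no  _  = F.refl

  unit-≡ : ∀ j → unit j j F.≈ F.1#
  unit-≡ j with j ℕₚ.≟ j
  ... | yes _ = F.refl
  ... | no ne = ⊥-elim (ne refl)

  Expansion-e : ∀ j → Expansion (e j) (unit j)
  Expansion-e j =
    suc j , (λ i le → unit-≢ λ eq → ℕₚ.<-irrefl (sym eq) le) ,
    ≈ᴹ-sym (≈ᴹ-trans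
      (+ᴹ-cong (partialSum-zero j λ i i<j → unit-≢ λ eq → ℕₚ.<-irrefl eq i<j)
               (≈ᴹ-trans (*ₗ-cong (unit-≡ j) ≈ᴹ-refl) (*ₗ-identityˡ _)))
      (+ᴹ-identityˡ _))

  Expansion-zero : ∀ {v a} → Expansion v a → v ≈ᴹ 0ᴹ → ∀ i → a i F.≈ F.0#
  Expansion-zero {v} {a} x@(K , z , v≈) v≈0 i with i ℕₚ.<? K
  ... | no  i≮K = z i (ℕₚ.≮⇒≥ i≮K)
  ... | yes i<K = subst (λ j → a j F.≈ F.0#) (Finₚ.toℕ-fromℕ< i<K)
    (independent K (λ j → a (toℕ j))
      (≈ᴹ-trans (combination≈partialSum K _ a (λ _ → F.refl)) (≈ᴹ-trans (≈ᴹ-sym v≈) v≈0))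
      (fromℕ< i<K))

  -- Subtraction is written with the scalar -1, so that the rules for sums and multiples expand the
  -- difference; it is zero, and independence makes its coefficients vanish.
  Expansion-unique : ∀ {v w a b} → Expansion v a → Expansion w b → v ≈ᴹ w → ∀ i → a i F.≈ b i
  Expansion-unique {v} {w} {a} {b} x y v≈w i = begin
    a i                                   ≈⟨ F.+-identityʳ _ ⟨
    a i F.+ F.0#                          ≈⟨ F.+-congˡ (F.trans (F.sym (F.zeroˡ _)) (F.*-congʳ (F.sym (F.-‿inverseˡ F.1#)))) ⟩
    a i F.+ (F.- F.1# F.+ F.1#) F.* b i   ≈⟨ F.+-congˡ (F.distribʳ _ _ _) ⟩
    a i F.+ (F.- F.1# F.* b i F.+ F.1# F.* b i)  ≈⟨ F.+-assoc _ _ _ ⟨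
    a i F.+ F.- F.1# F.* b i F.+ F.1# F.* b i
      ≈⟨ F.+-cong (Expansion-zero (Expansion-+ x (Expansion-* (F.- F.1#) y)) v-w≈0 i) (F.*-identityˡ _) ⟩
    F.0# F.+ b i                          ≈⟨ F.+-identityˡ _ ⟩
    b i                                   ∎
    where
    open SetoidReasoning F.setoid
    v-w≈0 : v +ᴹ F.- F.1# *ₗ w ≈ᴹ 0ᴹ
    v-w≈0 = ≈ᴹ-trans (+ᴹ-cong (≈ᴹ-trans v≈w (≈ᴹ-sym (*ₗ-identityˡ w))) ≈ᴹ-refl)
      (≈ᴹ-trans (≈ᴹ-sym (*ₗ-distribʳ w _ _)) (≈ᴹ-trans (*ₗ-cong (F.-‿inverseʳ F.1#) ≈ᴹ-refl) (*ₗ-zeroˡ w)))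

  infixr 5 _∷⟨_⟩_

  -- An inductive presentation of `Span`, for induction on the number of summands.
  data Lin {p} (S : Pred Carrierᴹ p) : Carrierᴹ → Set (c ⊔ℓ m ⊔ℓ ℓm ⊔ℓ p) where
    null   : ∀ {v} → v ≈ᴹ 0ᴹ → Lin S v
    _∷⟨_⟩_ : ∀ {v u w} → u ∈ S → (∃[ x ] v ≈ᴹ x *ₗ u +ᴹ w) → Lin S w → Lin S v

  combination-Lin : {S : Pred Carrierᴹ p} → ∀ k (x : Fin k → F.Carrier) u →
                    (∀ i → u i ∈ S) → Lin S (combination x u)
  combination-Lin zero    x u u∈ = null ≈ᴹ-refl
  combination-Lin (suc k) x u u∈ =
    u∈ Fin.zero ∷⟨ x Fin.zero , ≈ᴹ-refl ⟩
    combination-Lin k (λ i → x (Fin.suc i)) (λ i → u (Fin.suc i)) (λ i → u∈ (Fin.suc i))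

  Lin⇒Span : {S : Pred Carrierᴹ p} → Lin S ⊆ Span S
  Lin⇒Span (null v≈0) = 0 , (λ ()) , (λ ()) , (λ ()) , v≈0
  Lin⇒Span (_∷⟨_⟩_ {u = u} u∈ (x , v≈) w) with Lin⇒Span w
  ... | k , y , t , t∈ , w≈ =
    suc k , (λ { Fin.zero → x ; (Fin.suc i) → y i }) , (λ { Fin.zero → u ; (Fin.suc i) → t i }) ,
    (λ { Fin.zero → u∈ ; (Fin.suc i) → t∈ i }) , ≈ᴹ-trans v≈ (+ᴹ-cong ≈ᴹ-refl w≈)

  Lin-resp : {S : Pred Carrierᴹ p} → ∀ {v w} → v ≈ᴹ w → Lin S v → Lin S w
  Lin-resp eq (null z) = null (≈ᴹ-trans (≈ᴹ-sym eq) z)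
  Lin-resp eq (u∈ ∷⟨ x , v≈ ⟩ w) = u∈ ∷⟨ x , ≈ᴹ-trans (≈ᴹ-sym eq) v≈ ⟩ w

  Span⇒Lin : {S : Pred Carrierᴹ p} → Span S ⊆ Lin S
  Span⇒Lin (k , x , u , u∈ , v≈) = Lin-resp (≈ᴹ-sym v≈) (combination-Lin k x u u∈)

  Lin-+ : {S : Pred Carrierᴹ p} → ∀ {v w} → Lin S v → Lin S w → Lin S (v +ᴹ w)
  Lin-+ (null z) w = Lin-resp (≈ᴹ-sym (≈ᴹ-trans (+ᴹ-cong z ≈ᴹ-refl) (+ᴹ-identityˡ _))) w
  Lin-+ (u∈ ∷⟨ x , v≈ ⟩ v) w =
    u∈ ∷⟨ x , ≈ᴹ-trans (+ᴹ-cong v≈ ≈ᴹ-refl) (+ᴹ-assoc _ _ _) ⟩ Lin-+ v w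

  Lin-* : {S : Pred Carrierᴹ p} → ∀ y {v} → Lin S v → Lin S (y *ₗ v)
  Lin-* y (null z) = null (≈ᴹ-trans (*ₗ-cong F.refl z) (*ₗ-zeroʳ y))
  Lin-* y (u∈ ∷⟨ x , v≈ ⟩ v) =
    u∈ ∷⟨ y F.* x , ≈ᴹ-trans (*ₗ-cong F.refl v≈)
      (≈ᴹ-trans (*ₗ-distribˡ y _ _) (+ᴹ-cong (≈ᴹ-sym (*ₗ-assoc _ _ _)) ≈ᴹ-refl)) ⟩ Lin-* y v

  Lin-gen : {S : Pred Carrierᴹ p} → S ⊆ Lin S
  Lin-gen u∈ = u∈ ∷⟨ F.1# , ≈ᴹ-sym (≈ᴹ-trans (+ᴹ-identityʳ _) (*ₗ-identityˡ _)) ⟩ null ≈ᴹ-refl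

  Lin-least : {S : Pred Carrierᴹ p} {T : Pred Carrierᴹ q} → S ⊆ Lin T → Lin S ⊆ Lin T
  Lin-least f (null z) = null z
  Lin-least f (u∈ ∷⟨ x , v≈ ⟩ v) = Lin-resp (≈ᴹ-sym v≈) (Lin-+ (Lin-* x (f u∈)) (Lin-least f v))

  Lin-mono : {S : Pred Carrierᴹ p} {T : Pred Carrierᴹ q} → S ⊆ T → Lin S ⊆ Lin T
  Lin-mono f = Lin-least λ u∈ → Lin-gen (f u∈)

  Span-mono : {S : Pred Carrierᴹ p} {T : Pred Carrierᴹ q} → S ⊆ T → Span S ⊆ Span T
  Span-mono f (k , x , u , u∈ , v≈) = k , x , u , (λ i → f (u∈ i)) , v≈

  Lin-expansion : ∀ {v} → Lin (Range e) v → ∃ (Expansion v)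
  Lin-expansion (null z) = _ , Expansion-0 z
  Lin-expansion ((j , u≈) ∷⟨ x , v≈ ⟩ w) =
    _ , Expansion-resp (≈ᴹ-sym (≈ᴹ-trans v≈ (+ᴹ-cong (*ₗ-cong F.refl u≈) ≈ᴹ-refl)))
          (Expansion-+ (Expansion-* x (Expansion-e j)) (proj₂ (Lin-expansion w)))

  -- The expansion is whichever one the basis supplies; by `Expansion-unique` the values still
  -- respect `≈ᴹ`.
  coord : Carrierᴹ → ℕ → F.Carrier
  coord v = proj₁ (Lin-expansion (Span⇒Lin (spanning v)))

  coord-expansion : ∀ v → Expansion v (coord v)
  coord-expansion v = proj₂ (Lin-expansion (Span⇒Lin (spanning v)))

  coord-combine : ∀ {v u w} x → v ≈ᴹ x *ₗ u +ᴹ w → ∀ i → coord v i F.≈ x F.* coord u i F.+ coord w i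
  coord-combine x eq = Expansion-unique (coord-expansion _)
    (Expansion-+ (Expansion-* x (coord-expansion _)) (coord-expansion _)) eq

  coord-0 : ∀ {v} → v ≈ᴹ 0ᴹ → ∀ i → coord v i F.≈ F.0#
  coord-0 z = Expansion-unique (coord-expansion _) (Expansion-0 z) ≈ᴹ-refl

  coord-bound : Carrierᴹ → ℕ
  coord-bound v = proj₁ (coord-expansion v)

  coord-vanishes : ∀ v → VanishesFrom (coord-bound v) (coord v)
  coord-vanishes v = proj₁ (proj₂ (coord-expansion v))

  padded : ∀ {k} → (Fin k → F.Carrier) → ℕ → F.Carrier
  padded {zero}  x i       = F.0#
  padded {suc k} x zero    = x Fin.zero
  padded {suc k} x (suc i) = padded (λ j → x (Fin.suc j)) i

  padded-toℕ : ∀ {k} (x : Fin k → F.Carrier) i → padded x (toℕ i) ≡ x i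
  padded-toℕ x Fin.zero    = refl
  padded-toℕ x (Fin.suc i) = padded-toℕ (λ j → x (Fin.suc j)) i

  padded-vanishes : ∀ {k} (x : Fin k → F.Carrier) → VanishesFrom k (padded x)
  padded-vanishes {zero}  x i       le       = F.refl
  padded-vanishes {suc k} x (suc i) (s≤s le) = padded-vanishes (λ j → x (Fin.suc j)) i le

  Expansion-padded : ∀ {v k} (x : Fin k → F.Carrier) →
                     v ≈ᴹ combination x (λ i → e (toℕ i)) → Expansion v (padded x)
  Expansion-padded {k = k} x v≈ = k , padded-vanishes x ,
    ≈ᴹ-trans v≈ (combination≈partialSum k x (padded x) λ i → F.reflexive (sym (padded-toℕ x i)))

  open BlockSequences F E e using (supp)

  supp⇒coord : ∀ {v j} → j ∈ supp v → ¬ coord v j F.≈ F.0#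
  supp⇒coord {v} (k , x , v≈ , i , refl , xi≉0) z = xi≉0
    (F.trans (F.reflexive (sym (padded-toℕ x i)))
             (F.trans (F.sym (Expansion-unique (coord-expansion v) (Expansion-padded x v≈) ≈ᴹ-refl _)) z))

  coord⇒supp : ∀ {v j} → ¬ coord v j F.≈ F.0# → j ∈ supp v
  coord⇒supp {v} {j} nz with j ℕₚ.<? coord-bound v
  ... | no  j≮ = ⊥-elim (nz (coord-vanishes v j (ℕₚ.≮⇒≥ j≮)))
  ... | yes j< =
    coord-bound v , (λ i → coord v (toℕ i)) ,
    ≈ᴹ-trans (proj₂ (proj₂ (coord-expansion v)))
             (≈ᴹ-sym (combination≈partialSum (coord-bound v) _ (coord v) λ _ → F.refl)) ,
    fromℕ< j< , Finₚ.toℕ-fromℕ< j< ,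
    λ z → nz (F.trans (F.reflexive (cong (coord v) (sym (Finₚ.toℕ-fromℕ< j<)))) z)

  coord-all-zero : ∀ {v} → (∀ i → coord v i F.≈ F.0#) → v ≈ᴹ 0ᴹ
  coord-all-zero {v} z = ≈ᴹ-trans (proj₂ (proj₂ (coord-expansion v))) (partialSum-zero (coord-bound v) λ i _ → z i)

-- Block sequences

module Blocks (em : ∀ {u} → ExcludedMiddle u) {c ℓ m ℓm}
              (F : CommutativeRing c ℓ) (isField : IsField F)
              (countable : Countable (CommutativeRing.setoid F))
              (E : Module F m ℓm) (e : ℕ → Module.Carrierᴹ E)
              (basis : LinearAlgebra.IsBasis F E e) where

  open Classical em
  open Module E hiding (_≉ᴹ_)
  open LinearAlgebra F E
  open BlockSequences F E e
  open Coordinates F E e basis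

  supp-resp : ∀ {v w j} → v ≈ᴹ w → j ∈ supp v → j ∈ supp w
  supp-resp eq (k , x , v≈ , nz) = k , x , ≈ᴹ-trans (≈ᴹ-sym eq) v≈ , nz

  <supp-resp : ∀ {n v w} → v ≈ᴹ w → n <supp v → n <supp w
  <supp-resp eq n<v j j∈ = n<v j (supp-resp (≈ᴹ-sym eq) j∈)

  <supp-weaken : ∀ {n n′ v} → n ≤ n′ → n′ <supp v → n <supp v
  <supp-weaken le n′<v j j∈ = ℕₚ.≤-<-trans le (n′<v j j∈)

  supp-nonempty : ∀ {v} → ¬ v ≈ᴹ 0ᴹ → ∃[ j ] j ∈ supp v
  supp-nonempty {v} v≉0 with em {P = ∃[ j ] j ∈ supp v}
  ... | yes found = found
  ... | no ¬found = ⊥-elim (v≉0 (coord-all-zero λ i → dne λ nz → ¬found (i , coord⇒supp nz)))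

  supp<bound : ∀ {v j} → j ∈ supp v → j < coord-bound v
  supp<bound {v} {j} j∈ with j ℕₚ.<? coord-bound v
  ... | yes j< = j<
  ... | no  j≮ = ⊥-elim (supp⇒coord {v} j∈ (coord-vanishes v j (ℕₚ.≮⇒≥ j≮)))

  ≪-bound : ∀ {v w} → coord-bound v <supp w → v ≪ w
  ≪-bound {v} b<w i i∈ j j∈ = ℕₚ.<-trans (supp<bound {v} i∈) (b<w j j∈)

  <supp⇒coord : ∀ {n v} → n <supp v → coord v n F.≈ F.0#
  <supp⇒coord n<v = dne λ nz → ℕₚ.<-irrefl refl (n<v _ (coord⇒supp nz))

  -- If j lies outside the support of the first generator, this generator contributes nothing to
  -- coordinate j, so j lies in the support of the remaining sum.
  supp-Lin : ∀ {p} {S : Pred Carrierᴹ p} {v j} → Lin S v → j ∈ supp v → ∃[ u ] u ∈ S × j ∈ supp u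
  supp-Lin {v = v} {j} (null z) j∈ = ⊥-elim (supp⇒coord {v} j∈ (coord-0 z j))
  supp-Lin {v = v} {j} (_∷⟨_⟩_ {u = u} {w = w} u∈ (x , v≈) ws) j∈ with em {P = j ∈ supp u}
  ... | yes j∈u = u , u∈ , j∈u
  ... | no  j∉u = supp-Lin ws (coord⇒supp λ z → supp⇒coord {v} j∈
        (F.trans (coord-combine x v≈ j)
          (F.trans (F.+-cong (F.trans (F.*-congˡ (dne λ nz → j∉u (coord⇒supp nz))) (F.zeroʳ x)) z)
                   (F.+-identityʳ _))))

  ⟨⟩⇒Lin : ∀ X → ⟨ X ⟩ ⊆ Lin (Range (vec X))
  ⟨⟩⇒Lin X = Span⇒Lin {S = Range (vec X)}

  infixl 7 _↓_

  _↓_ : E∞ → ℕ → E∞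
  X ↓ d = record
    { vec     = λ k → vec X (k + d)
    ; nonzero = λ k → E∞.nonzero X (k + d)
    ; block   = λ k → E∞.block X (k + d)
    }

  ↓-≼ : ∀ X d → X ↓ d ≼ X
  ↓-≼ X d = Span-mono {S = Range (vec (X ↓ d))} {Range (vec X)} λ (n , v≈) → n + d , v≈

  ≼-refl : ∀ X → X ≼ X
  ≼-refl X v∈ = v∈

  ⟨⟩-resp : ∀ X {v w} → v ≈ᴹ w → v ∈ ⟨ X ⟩ → w ∈ ⟨ X ⟩
  ⟨⟩-resp X eq (k , x , u , u∈ , v≈) = k , x , u , u∈ , ≈ᴹ-trans (≈ᴹ-sym eq) v≈

  vec∈⟨⟩ : ∀ X n → vec X n ∈ ⟨ X ⟩
  vec∈⟨⟩ X n = Lin⇒Span (Lin-gen {S = Range (vec X)} (n , ≈ᴹ-refl))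

  ⟨⟩-resp-≈∞ : ∀ {X Y} → X ≈∞ Y → ⟨ X ⟩ ⊆ ⟨ Y ⟩
  ⟨⟩-resp-≈∞ {X} {Y} eq = Span-mono {S = Range (vec X)} {Range (vec Y)} λ (n , v≈) → n , ≈ᴹ-trans v≈ (eq n)

  vec≪ : ∀ X k d → vec X k ≪ vec X (suc d + k)
  vec≪ X k zero    = E∞.block X k
  vec≪ X k (suc d) i i∈ j j∈ =
    let i′ , i′∈ = supp-nonempty (E∞.nonzero X (suc d + k))
    in ℕₚ.<-trans (vec≪ X k d i i∈ i′ i′∈) (E∞.block X (suc d + k) i′ i′∈ j j∈)

  vec≪-< : ∀ X {k l} → k < l → vec X k ≪ vec X l
  vec≪-< X {k} {l} k<l = subst (λ l → vec X k ≪ vec X l)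
    (trans (sym (ℕₚ.+-suc (l ℕ.∸ suc k) k)) (ℕₚ.m∸n+n≡m k<l)) (vec≪ X k (l ℕ.∸ suc k))

  -- The vectors are nonzero, so their supports move up by at least one at each step.
  index≤supp : ∀ X k {j} → j ∈ supp (vec X k) → k ≤ j
  index≤supp X zero    j∈ = z≤n
  index≤supp X (suc k) j∈ =
    let i , i∈ = supp-nonempty (E∞.nonzero X k)
    in ℕₚ.≤-<-trans (index≤supp X k i∈) (E∞.block X k i i∈ _ j∈)

  ↓-<supp : ∀ X n {v} → v ∈ ⟨ X ↓ suc n ⟩ → n <supp v
  ↓-<supp X n v∈ j j∈ with supp-Lin (⟨⟩⇒Lin (X ↓ suc n) v∈) j∈
  ... | u , (k , u≈) , j∈u =
    ℕₚ.≤-trans (ℕₚ.m≤n+m (suc n) k) (index≤supp X (k + suc n) (supp-resp u≈ j∈u))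

  ⟨⟩-nonzero : ∀ X n → ∃[ v ] v ∈ ⟨ X ⟩ × ¬ v ≈ᴹ 0ᴹ × n <supp v
  ⟨⟩-nonzero X n = vec X (suc n) , vec∈⟨⟩ X (suc n) , E∞.nonzero X (suc n) ,
                   λ j j∈ → index≤supp X (suc n) j∈

  zero-product : ∀ {x y} → x F.* y F.≈ F.0# → ¬ y F.≈ F.0# → x F.≈ F.0#
  zero-product {x} {y} xy≈0 y≉0 =
    let y′ , yy′≈1 = proj₂ isField y y≉0
    in F.trans (F.sym (F.*-identityʳ x)) (F.trans (F.*-congˡ (F.sym yy′≈1))
         (F.trans (F.sym (F.*-assoc x y y′)) (F.trans (F.*-congʳ xy≈0) (F.zeroˡ y′))))

  -- A combination in `Lin` may use a generator repeatedly, so all occurrences of `vec X d` have to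
  -- be collected into one coefficient.
  peel : ∀ X d {v} → Lin (Range (vec (X ↓ d))) v →
         ∃[ x ] ∃[ w ] v ≈ᴹ x *ₗ vec X d +ᴹ w × Lin (Range (vec (X ↓ suc d))) w
  peel X d (null z) = F.0# , 0ᴹ ,
    ≈ᴹ-trans z (≈ᴹ-sym (≈ᴹ-trans (+ᴹ-identityʳ _) (*ₗ-zeroˡ _))) , null ≈ᴹ-refl
  peel X d (_∷⟨_⟩_ {u = u} (zero , u≈) (x , v≈) ws) with peel X d ws
  ... | y , w , w≈ , w∈ = x F.+ y , w ,
    ≈ᴹ-trans v≈ (≈ᴹ-trans (+ᴹ-cong (*ₗ-cong F.refl u≈) w≈)
      (≈ᴹ-trans (≈ᴹ-sym (+ᴹ-assoc _ _ _)) (+ᴹ-cong (≈ᴹ-sym (*ₗ-distribʳ _ x y)) ≈ᴹ-refl))) , w∈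
  peel X d (_∷⟨_⟩_ {u = u} (suc k , u≈) (x , v≈) ws) with peel X d ws
  ... | y , w , w≈ , w∈ = y , x *ₗ u +ᴹ w ,
    ≈ᴹ-trans v≈ (≈ᴹ-trans (+ᴹ-cong ≈ᴹ-refl w≈) (≈ᴹ-trans (≈ᴹ-sym (+ᴹ-assoc _ _ _))
      (≈ᴹ-trans (+ᴹ-cong (+ᴹ-comm _ _) ≈ᴹ-refl) (+ᴹ-assoc _ _ _)))) ,
    (k , ≈ᴹ-trans u≈ (≈ᴹ-reflexive (cong (vec X) (sym (ℕₚ.+-suc k d))))) ∷⟨ x , ≈ᴹ-refl ⟩ w∈

  -- Lets I force II into a tail of X by playing a large number; the vectors of X are removed one at
  -- a time.
  ⟨⟩-tail : ∀ X d → ∃[ n ] (∀ {v} → v ∈ ⟨ X ⟩ → n <supp v → v ∈ ⟨ X ↓ d ⟩)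
  ⟨⟩-tail X zero    = 0 , λ v∈ _ → Span-mono {S = Range (vec X)} {Range (vec (X ↓ 0))} (λ (k , v≈) →
    k , ≈ᴹ-trans v≈ (≈ᴹ-reflexive (cong (vec X) (sym (ℕₚ.+-identityʳ k))))) v∈
  ⟨⟩-tail X (suc d) =
    let n , tail = ⟨⟩-tail X d
        i , i∈   = supp-nonempty (E∞.nonzero X d)
    in n ⊔ i , λ {v} v∈ lt →
      let x , w , v≈ , w∈ = peel X d (⟨⟩⇒Lin (X ↓ d) (tail v∈ (<supp-weaken (ℕₚ.m≤m⊔n n i) lt)))
          i<w : i <supp w
          i<w j j∈ = let u , (k , u≈) , j∈u = supp-Lin w∈ j∈ in
            vec≪-< X {d} {k + suc d} (ℕₚ.m≤n+m (suc d) k) i i∈ j (supp-resp u≈ j∈u)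
          -- At i, in the support of `vec X d`, both v and w have coordinate 0; hence x times a
          -- nonzero scalar is 0, and F is a field.
          x≈0 : x F.≈ F.0#
          x≈0 = zero-product
            (F.trans (F.sym (F.trans (coord-combine x v≈ i)
                                     (F.trans (F.+-congˡ (<supp⇒coord i<w)) (F.+-identityʳ _))))
                     (<supp⇒coord (<supp-weaken (ℕₚ.m≤n⊔m n i) lt)))
            (supp⇒coord {vec X d} i∈)
          v≈w : v ≈ᴹ w
          v≈w = ≈ᴹ-trans v≈ (≈ᴹ-trans (+ᴹ-cong (≈ᴹ-trans (*ₗ-cong x≈0 ≈ᴹ-refl) (*ₗ-zeroˡ _)) ≈ᴹ-refl)
                                      (+ᴹ-identityˡ _))
      in ⟨⟩-resp (X ↓ suc d) (≈ᴹ-sym v≈w) (Lin⇒Span w∈)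

  ≼-tail : ∀ {X Y} → Y ≼ X → ∀ d → ∃[ d′ ] Y ↓ d′ ≼ X ↓ d
  ≼-tail {X} {Y} Y≼X d =
    let n , tail = ⟨⟩-tail X d
    in suc n , λ v∈ → tail (Y≼X (↓-≼ Y (suc n) v∈)) (↓-<supp Y n v∈)

  ≼*⇒≼ : ∀ {X Y} → Y ≼* X → ∃[ d ] Y ↓ d ≼ X
  ≼*⇒≼ {X} {Y} (n , Y/n⊆) = suc n , λ v∈ → Y/n⊆ (Span-mono {S = Range (vec (Y ↓ suc n))} {Y / n} beyond v∈)
    where
    beyond : Range (vec (Y ↓ suc n)) ⊆ (Y / n)
    beyond (k , v≈) = (k + suc n , v≈) ,
      <supp-resp (≈ᴹ-sym v≈) λ j j∈ →
        ℕₚ.≤-trans (ℕₚ.m≤n+m (suc n) k) (index≤supp Y (k + suc n) j∈)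

  bound-vecs : E∞ → ℕ → ℕ
  bound-vecs X zero    = 0
  bound-vecs X (suc d) = bound-vecs X d ⊔ coord-bound (vec X d)

  bound-vecs-≤ : ∀ X {d k} → k < d → coord-bound (vec X k) ≤ bound-vecs X d
  bound-vecs-≤ X {suc d} {k} (s≤s k≤d) with ℕₚ.m≤n⇒m<n∨m≡n k≤d
  ... | inj₁ k<d  = ℕₚ.≤-trans (bound-vecs-≤ X k<d) (ℕₚ.m≤m⊔n _ _)
  ... | inj₂ refl = ℕₚ.m≤n⊔m (bound-vecs X d) _

  -- A term supported above the coordinate bounds of the first d terms is none of them. It follows
  -- that H is closed under tails.
  ≼*-↓ : ∀ X d → X ≼* X ↓ d
  ≼*-↓ X d = bound-vecs X d , Span-mono {S = X / bound-vecs X d} {Range (vec (X ↓ d))} shift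
    where
    shift : (X / bound-vecs X d) ⊆ Range (vec (X ↓ d))
    shift ((k , v≈) , b<v) with d ℕₚ.≤? k
    ... | yes d≤k = k ℕ.∸ d , ≈ᴹ-trans v≈ (≈ᴹ-reflexive (cong (vec X) (sym (ℕₚ.m∸n+n≡m d≤k))))
    ... | no  d≰k =
      let j , j∈ = supp-nonempty (E∞.nonzero X k)
          b<j    = b<v j (supp-resp (≈ᴹ-sym v≈) j∈)
      in ⊥-elim (ℕₚ.<-asym (ℕₚ.≤-<-trans (bound-vecs-≤ X (ℕₚ.≰⇒> d≰k)) b<j) (supp<bound {vec X k} j∈))

  module _ where
    open Surjection countable using (strictlySurjective) renaming (to to enumF)

    decodeFrom : ℕ → List ℕ → Carrierᴹ
    decodeFrom j []      = 0ᴹ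
    decodeFrom j (a ∷ l) = enumF a *ₗ e j +ᴹ decodeFrom (suc j) l

    decodeFrom-surjective : ∀ k j (x : Fin k → F.Carrier) (u : Fin k → Carrierᴹ) →
      (∀ i → u i ≈ᴹ e (j + toℕ i)) → ∃[ l ] decodeFrom j l ≈ᴹ combination x u
    decodeFrom-surjective zero    j x u u≈ = [] , ≈ᴹ-refl
    decodeFrom-surjective (suc k) j x u u≈ =
      let l , l≈ = decodeFrom-surjective k (suc j) (λ i → x (Fin.suc i)) (λ i → u (Fin.suc i))
                     (λ i → ≈ᴹ-trans (u≈ (Fin.suc i)) (≈ᴹ-reflexive (cong e (ℕₚ.+-suc j (toℕ i)))))
          a , a≈ = strictlySurjective (x Fin.zero)
      in a ∷ l , +ᴹ-cong (*ₗ-cong a≈ (≈ᴹ-sym (≈ᴹ-trans (u≈ Fin.zero)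
                   (≈ᴹ-reflexive (cong e (ℕₚ.+-identityʳ j)))))) l≈

    abstract
      decode : ℕ → Carrierᴹ
      decode n = decodeFrom 0 (enumList n)

      decode-surjective : ∀ v → ∃[ n ] decode n ≈ᴹ v
      decode-surjective v =
        let l , l≈ = decodeFrom-surjective (coord-bound v) 0 (λ i → coord v (toℕ i)) (λ i → e (toℕ i))
                       (λ _ → ≈ᴹ-refl)
            n , n≡ = enumList-surjective l
        in n , ≈ᴹ-trans (≈ᴹ-reflexive (cong (decodeFrom 0) n≡))
                 (≈ᴹ-trans l≈ (≈ᴹ-trans (combination≈partialSum (coord-bound v) _ (coord v) λ _ → F.refl)
                                        (≈ᴹ-sym (proj₂ (proj₂ (coord-expansion v))))))

  abstract
    -- Taking the least code makes equal vectors have identical codes, so positions of the games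
    -- become lists of numbers.
    code : Carrierᴹ → ℕ
    code v = proj₁ (least (λ n → decode n ≈ᴹ v) (decode-surjective v))

    decode-code : ∀ v → decode (code v) ≈ᴹ v
    decode-code v = proj₁ (proj₂ (least (λ n → decode n ≈ᴹ v) (decode-surjective v)))

    code-cong : ∀ {v w} → v ≈ᴹ w → code v ≡ code w
    code-cong {v} {w} v≈w = Least-unique (λ d → ≈ᴹ-trans d v≈w) (λ d → ≈ᴹ-trans d (≈ᴹ-sym v≈w))
      (proj₂ (least _ (decode-surjective v))) (proj₂ (least _ (decode-surjective w)))

  code-injective : ∀ {v w} → code v ≡ code w → v ≈ᴹ w
  code-injective {v} {w} eq =
    ≈ᴹ-trans (≈ᴹ-sym (decode-code v)) (≈ᴹ-trans (≈ᴹ-reflexive (cong decode eq)) (decode-code w))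

-- Perfect trees and fusion

-- Nodes of the binary tree; the head of the list is the last bit.
Node : Set
Node = List Bool

-- Bits are added at the head, so the images of the two children of p extend the two different
-- children of `Θ p`: the image of Θ generates a perfect subtree.
IsEmb : (Node → Node) → Set
IsEmb Θ = ∀ b p → ∃[ r ] Θ (b ∷ p) ≡ r ++ b ∷ Θ p

IsEmb-id : IsEmb id
IsEmb-id b p = [] , refl

IsEmb-++ : ∀ q → IsEmb (_++ q)
IsEmb-++ q b p = [] , refl

IsEmb-extend : ∀ {Θ} → IsEmb Θ → ∀ r b p → ∃[ s ] Θ (r ++ b ∷ p) ≡ s ++ b ∷ Θ p
IsEmb-extend emb []      b p = emb b p
IsEmb-extend {Θ} emb (a ∷ r) b p =
  let s , eq  = IsEmb-extend emb r b p
      u , eq′ = emb a (r ++ b ∷ p)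
  in u ++ a ∷ s , trans eq′ (trans (cong (λ x → u ++ a ∷ x) eq) (sym (Listₚ.++-assoc u (a ∷ s) _)))

IsEmb-extend-weak : ∀ {Θ} → IsEmb Θ → ∀ r p → ∃[ s ] Θ (r ++ p) ≡ s ++ Θ p
IsEmb-extend-weak emb []      p = [] , refl
IsEmb-extend-weak {Θ} emb (a ∷ r) p =
  let s , eq  = IsEmb-extend-weak emb r p
      u , eq′ = emb a (r ++ p)
  in u ++ a ∷ s , trans eq′ (trans (cong (λ x → u ++ a ∷ x) eq) (sym (Listₚ.++-assoc u (a ∷ s) _)))

IsEmb-∘ : ∀ {Θ Ψ} → IsEmb Θ → IsEmb Ψ → IsEmb (Θ ∘ Ψ)
IsEmb-∘ {Θ} {Ψ} embΘ embΨ b p =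
  let r , eq = embΨ b p
      s , eq′ = IsEmb-extend embΘ r b (Ψ p)
  in s , trans (cong Θ eq) eq′

IsEmb-resp : ∀ {Θ Θ′} → (∀ p → Θ′ p ≡ Θ p) → IsEmb Θ → IsEmb Θ′
IsEmb-resp eq emb b p =
  let r , eq′ = emb b p
  in r , trans (eq (b ∷ p)) (trans eq′ (cong (λ q → r ++ b ∷ q) (sym (eq p))))

IsEmb-length : ∀ {Θ} → IsEmb Θ → ∀ p → length p ≤ length (Θ p)
IsEmb-length emb []      = z≤n
IsEmb-length {Θ} emb (b ∷ p) =
  let r , eq = emb b p
  in subst (λ x → suc (length p) ≤ length x) (sym eq)
       (subst (suc (length p) ≤_) (sym (Listₚ.length-++ r))
         (ℕₚ.≤-trans (s≤s (IsEmb-length emb p)) (ℕₚ.m≤n+m (suc (length (Θ p))) (length r))))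

splitNode : ∀ {A : Set} n (p : List A) → n ≤ length p → ∃[ r ] ∃[ q ] p ≡ r ++ q × length q ≡ n
splitNode zero    []      n≤ = [] , [] , refl , refl
splitNode n       (b ∷ p) n≤ with ℕₚ.m≤n⇒m<n∨m≡n n≤
... | inj₂ refl = [] , b ∷ p , refl , refl
... | inj₁ (s≤s n≤p) = let r , q , eq , len = splitNode n p n≤p in b ∷ r , q , cong (b ∷_) eq , len

infix 4 _⊑_

_⊑_ : (Node → Node) → (Node → Node) → Set
Θ′ ⊑ Θ = Σ[ Ψ ∈ (Node → Node) ] IsEmb Ψ × (∀ r → Θ′ r ≡ Θ (Ψ r))

-- A Cantor scheme. Disjointness is demanded of siblings and passes to whole levels by `sameLevel`.
record IsScheme {T : Set t} (J : Node → Pred T i) : Set (t ⊔ℓ i) where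
  field
    shrink   : ∀ {b p x} → x ∈ J (b ∷ p) → x ∈ J p
    disjoint : ∀ {b b′ p x} → x ∈ J (b ∷ p) → x ∈ J (b′ ∷ p) → b ≡ b′

  shrink* : ∀ r {p x} → x ∈ J (r ++ p) → x ∈ J p
  shrink* []      x∈ = x∈
  shrink* (b ∷ r) x∈ = shrink* r (shrink x∈)

  sameLevel : ∀ p q {x} → length p ≡ length q → x ∈ J p → x ∈ J q → p ≡ q
  sameLevel []      []      eq x∈ x∈′ = refl
  sameLevel (b ∷ p) (d ∷ q) eq x∈ x∈′ with sameLevel p q (ℕₚ.suc-injective eq) (shrink x∈) (shrink x∈′)
  ... | refl = cong (_∷ p) (disjoint x∈ x∈′)

  comparable : ∀ p q {x} → length p ≤ length q → x ∈ J p → x ∈ J q → ∃[ r ] q ≡ r ++ p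
  comparable p q le x∈p x∈q with splitNode (length p) q le
  ... | r , q′ , refl , eq = r , cong (r ++_) (sameLevel q′ p eq (shrink* r x∈q) x∈p)

IsScheme-∘ : {T : Set t} {J : Node → Pred T i} → IsScheme J → ∀ {Θ} → IsEmb Θ → IsScheme (J ∘ Θ)
IsScheme-∘ {J = J} S {Θ} emb = record
  { shrink   = λ {b} {p} x∈ → let r , eq = emb b p in
      shrink {b} (shrink* r (subst (λ q → _ ∈ J q) eq x∈))
  ; disjoint = λ {b} {b′} {p} x∈ x∈′ → let r , eq = emb b p ; r′ , eq′ = emb b′ p in
      disjoint (shrink* r (subst (λ q → _ ∈ J q) eq x∈)) (shrink* r′ (subst (λ q → _ ∈ J q) eq′ x∈′))
  }
  where open IsScheme S

-- For a scheme the node at each level is unique, so these are the points that lie on a branch.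
Body : {T : Set t} → (Node → Pred T i) → Pred T i
Body J x = ∀ n → ∃[ p ] length p ≡ n × x ∈ J p

module _ {T : Set t} {J : Node → Pred T i} (S : IsScheme J) where
  open IsScheme S

  Body-restrict : ∀ {p x} → x ∈ Body J → x ∈ J p → x ∈ Body (λ q → J (q ++ p))
  Body-restrict {p} x∈ x∈p n with x∈ (n + length p)
  ... | q , len , x∈q with splitNode (length p) q (subst (length p ≤_) (sym len) (ℕₚ.m≤n+m (length p) n))
  ... | r , q′ , refl , eq with sameLevel q′ p eq (shrink* r x∈q) x∈p
  ... | refl = r , ℕₚ.+-cancelʳ-≡ (length p) (length r) n (trans (sym (Listₚ.length-++ r)) len) , x∈q

  Body-thin : ∀ {Ψ x} → IsEmb Ψ → x ∈ Body (J ∘ Ψ) → x ∈ Body J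
  Body-thin {Ψ} emb x∈ n with x∈ n
  ... | p , refl , x∈p with splitNode (length p) (Ψ p) (IsEmb-length emb p)
  ... | r , q , eq , len = q , len , shrink* r (subst (λ p → _ ∈ J p) eq x∈p)

-- Above p all values of Ψ extend q, and stripping q from them leaves an embedding.
⊑-restrict : ∀ {Ψ} → IsEmb Ψ → ∀ p r q → Ψ p ≡ r ++ q → Ψ ∘ (_++ p) ⊑ _++ q
⊑-restrict {Ψ} emb p r q eq = Ξ , Ξ-emb , Ξ-eq
  where
  Ξ : Node → Node
  Ξ a = proj₁ (IsEmb-extend-weak emb a p) ++ r
  Ξ-eq : ∀ a → Ψ (a ++ p) ≡ Ξ a ++ q
  Ξ-eq a = let s , eq′ = IsEmb-extend-weak emb a p
           in trans eq′ (trans (cong (s ++_) eq) (sym (Listₚ.++-assoc s r q)))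
  Ξ-emb : IsEmb Ξ
  Ξ-emb b a = let u , eq′ = emb b (a ++ p)
    in u , Listₚ.++-cancelʳ q (Ξ (b ∷ a)) (u ++ b ∷ Ξ a)
             (trans (sym (Ξ-eq (b ∷ a))) (trans eq′
               (trans (cong (λ c → u ++ b ∷ c) (Ξ-eq a)) (sym (Listₚ.++-assoc u (b ∷ Ξ a) q)))))

module Fusion (em : ∀ {u} → ExcludedMiddle u) {c ℓ m ℓm}
              (F : CommutativeRing c ℓ) (isField : IsField F)
              (countable : Countable (CommutativeRing.setoid F))
              (E : Module F m ℓm) (e : ℕ → Module.Carrierᴹ E)
              (basis : LinearAlgebra.IsBasis F E e)
              {h} (H : Pred (BlockSequences.E∞ F E e) h)
              (isFamily : BlockSequences.IsFamily F E e H)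
              (hasP : BlockSequences.HasPProperty F E e H) where

  open Classical em
  open BlockSequences F E e
  open Blocks em F isField countable E e basis

  H-↓ : ∀ {X} → X ∈ H → ∀ d → X ↓ d ∈ H
  H-↓ {X} X∈ d = proj₂ isFamily X∈ (≼*-↓ X d)

  -- These closure properties carry a property from the stages of a fusion to its limit. `untail` is
  -- needed because the (p)-property yields only `≼*`.
  record IsRobust {r} (R : (Node → Node) → E∞ → Set r) : Set (c ⊔ℓ ℓ ⊔ℓ m ⊔ℓ ℓm ⊔ℓ r) where
    field
      thin   : ∀ {Θ Θ′ X} → IsEmb Θ → Θ′ ⊑ Θ → R Θ X → R Θ′ X
      below  : ∀ {Θ X Y} → Y ≼ X → R Θ X → R Θ Y
      untail : ∀ {Θ X} d → R Θ (X ↓ d) → R Θ X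

  DenseUnder : ∀ {r} → E∞ → ((Node → Node) → E∞ → Set r) → Set _
  DenseUnder X₀ R = ∀ {Θ X} → IsEmb Θ → X ∈ H → X ≼ X₀ →
    Σ[ Ψ ∈ (Node → Node) ] ∃[ Y ] IsEmb Ψ × Y ∈ H × Y ≼ X × R (Θ ∘ Ψ) Y

  -- Forcing of the negation of R by the condition (Θ , X).
  Never : ∀ {r} → ((Node → Node) → E∞ → Set r) → (Node → Node) → E∞ → Set _
  Never R Θ X = ∀ {Ψ Y} → IsEmb Ψ → Y ∈ H → Y ≼ X → ¬ R (Θ ∘ Ψ) Y

  module _ {r} {R : (Node → Node) → E∞ → Set r} (robust : IsRobust R) where
    open IsRobust robust

    Never-robust : IsRobust (Never R)
    Never-robust = record
      { thin   = λ { embΘ (Ξ , embΞ , eq) never {Ψ} embΨ Y∈ Y≼X RΘ →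
          never (IsEmb-∘ embΞ embΨ) Y∈ Y≼X
            (thin (IsEmb-∘ (IsEmb-resp eq (IsEmb-∘ embΘ embΞ)) embΨ) (id , IsEmb-id , λ q → sym (eq (Ψ q))) RΘ) }
      ; below  = λ Y≼X never embΨ Z∈ Z≼Y → never embΨ Z∈ λ v∈ → Y≼X (Z≼Y v∈)
      -- A counterexample Y below X has a tail below `X ↓ d`; the tail is in H and inherits R.
      ; untail = λ {Θ} {X} d never {Ψ} {Y} embΨ Y∈ Y≼X RY →
          let d′ , Y↓≼ = ≼-tail {X} {Y} Y≼X d
          in never embΨ (H-↓ Y∈ d′) Y↓≼ (below (↓-≼ Y d′) RY)
      }

    -- A node of Θ ∘ Ψ through x need not extend the node p of Θ, but some node
    -- above both does.
    Never-local : ∀ {t i} {T : Set t} {J : Node → Pred T i} → IsScheme J →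
      ∀ {Θ Ψ} → IsEmb Θ → IsEmb Ψ → ∀ {x p q X Y} →
      x ∈ Body (J ∘ Θ ∘ Ψ) → x ∈ J (Θ p) → x ∈ J (Θ (Ψ q)) →
      Never R (Θ ∘ (_++ p)) X → Y ∈ H → Y ≼ X → ¬ R (Θ ∘ Ψ ∘ (_++ q)) Y
    Never-local {J = J} S {Θ} {Ψ} embΘ embΨ {x} {p} {q} {X} {Y} x∈ x∈p x∈q never Y∈ Y≼X RY =
      let n = length p ⊔ length q
          a , len , x∈a = x∈ n
          SΘ = IsScheme-∘ S embΘ
          r , a≡ = IsScheme.comparable (IsScheme-∘ SΘ embΨ) q a
                     (subst (length q ≤_) (sym len) (ℕₚ.m≤n⊔m (length p) (length q))) x∈q x∈a
          s , Ψa≡ = IsScheme.comparable SΘ p (Ψ a)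
                     (ℕₚ.≤-trans (subst (length p ≤_) (sym len) (ℕₚ.m≤m⊔n (length p) (length q)))
                       (IsEmb-length embΨ a)) x∈p x∈a
          Ξ , embΞ , eq = ⊑-restrict embΨ a s p Ψa≡
      in never embΞ Y∈ Y≼X (thin (IsEmb-∘ (IsEmb-∘ embΘ embΨ) (IsEmb-++ q))
           (_++ r , IsEmb-++ r , λ b → trans (cong Θ (sym (eq b)))
             (cong (Θ ∘ Ψ) (trans (cong (b ++_) a≡) (sym (Listₚ.++-assoc b r q))))) RY)

    Decided-robust : IsRobust (λ Θ X → R Θ X ⊎ Never R Θ X)
    Decided-robust = record
      { thin   = λ { {Θ} {Θ′} {X} emb le (inj₁ x) → inj₁ (thin emb le x)
                   ; {Θ} {Θ′} {X} emb le (inj₂ x) → inj₂ (N.thin {Θ} {Θ′} {X} emb le x) }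
      ; below  = λ { {Θ} {X} {Y} le (inj₁ x) → inj₁ (below {Θ} {X} {Y} le x)
                   ; {Θ} {X} {Y} le (inj₂ x) → inj₂ (N.below {Θ} {X} {Y} le x) }
      ; untail = λ { {Θ} {X} d (inj₁ x) → inj₁ (untail d x)
                   ; {Θ} {X} d (inj₂ x) → inj₂ (N.untail {Θ} {X} d x) }
      }
      where module N = IsRobust Never-robust

    Decided-dense : ∀ X₀ → DenseUnder X₀ (λ Θ X → R Θ X ⊎ Never R Θ X)
    Decided-dense X₀ {Θ} {X} embΘ X∈ X≼
      with em {P = Σ[ Ψ ∈ (Node → Node) ] ∃[ Y ] IsEmb Ψ × Y ∈ H × Y ≼ X × R (Θ ∘ Ψ) Y}
    ... | yes (Ψ , Y , embΨ , Y∈ , Y≼ , x) = Ψ , Y , embΨ , Y∈ , Y≼ , inj₁ x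
    ... | no  ¬x = id , X , IsEmb-id , X∈ , ≼-refl X ,
                   inj₂ λ embΨ Y∈ Y≼ x → ¬x (_ , _ , embΨ , Y∈ , Y≼ , x)

  Emb : Set
  Emb = Σ[ Ψ ∈ (Node → Node) ] IsEmb Ψ

  -- Meets one dense set for each of the 2^k nodes of level k.
  level-dense : ∀ {r} (X₀ : E∞) k (R : Node → (Node → Node) → E∞ → Set r) →
    (∀ p → IsRobust (R p)) → (∀ p → length p ≡ k → DenseUnder X₀ (R p)) →
    (Ω : Node → Emb) → ∀ X → X ∈ H → X ≼ X₀ →
    Σ[ Ψ ∈ (Node → Emb) ] ∃[ Y ] Y ∈ H × Y ≼ X ×
      (∀ p → length p ≡ k → R p (proj₁ (Ω p) ∘ proj₁ (Ψ p)) Y)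
  level-dense X₀ zero R robust dense Ω X X∈ X≼ =
    let Ψ , Y , embΨ , Y∈ , Y≼ , x = dense [] refl (proj₂ (Ω [])) X∈ X≼
    in (λ _ → Ψ , embΨ) , Y , Y∈ , (λ v∈ → Y≼ v∈) , λ { [] _ → x }
  level-dense X₀ (suc k) R robust dense Ω X X∈ X≼ =
    let Ψ₀ , Y , Y∈ , Y≼ , x = level-dense X₀ k (R ∘ (false ∷_)) (robust ∘ (false ∷_))
          (λ p len → dense (false ∷ p) (cong suc len)) (Ω ∘ (false ∷_)) X X∈ X≼
        Ψ₁ , Z , Z∈ , Z≼ , y = level-dense X₀ k (R ∘ (true ∷_)) (robust ∘ (true ∷_))
          (λ p len → dense (true ∷ p) (cong suc len)) (Ω ∘ (true ∷_)) Y Y∈ (λ v∈ → X≼ (Y≼ v∈))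
    in (λ { [] → id , IsEmb-id ; (false ∷ p) → Ψ₀ p ; (true ∷ p) → Ψ₁ p }) , Z , Z∈ , (λ v∈ → Y≼ (Z≼ v∈)) ,
       λ { [] () ; (false ∷ p) len → IsRobust.below (robust (false ∷ p)) {X = Y} {Z} Z≼ (x p (ℕₚ.suc-injective len))
         ; (true ∷ p) len → y p (ℕₚ.suc-injective len) }

  module _ {r} (R : ℕ → (Node → Node) → E∞ → Set r) (robust : ∀ k → IsRobust (R k))
           {X₀ : E∞} (X₀∈ : X₀ ∈ H) (dense : ∀ k → DenseUnder X₀ (R k)) where

    private
      record Stage (k : ℕ) : Set (c ⊔ℓ ℓ ⊔ℓ m ⊔ℓ ℓm ⊔ℓ h) where
        field
          -- For p of level k, `Ω p` is the subtree still available at p.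
          Ω   : Node → Emb
          X   : E∞
          X∈  : X ∈ H
          X≼  : X ≼ X₀

      module Step {k} (s : Stage k) where
        open Stage s
        result = level-dense X₀ k (λ _ → R k) (λ _ → robust k) (λ _ _ → dense k) Ω X X∈ X≼
        Ψ   = proj₁ result
        Y   = proj₁ (proj₂ result)
        Y∈  = proj₁ (proj₂ (proj₂ result))
        Y≼X : Y ≼ X
        Y≼X = proj₁ (proj₂ (proj₂ (proj₂ result)))
        met = proj₂ (proj₂ (proj₂ (proj₂ result)))

        Ω′ : Node → Emb
        Ω′ p = proj₁ (Ω p) ∘ proj₁ (Ψ p) , IsEmb-∘ (proj₂ (Ω p)) (proj₂ (Ψ p))

        next : Stage (suc k)
        next = record
          -- The child `b ∷ p` inherits the part of `Ω′ p` above the node with single bit b; that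
          -- bit is at the end of the list, being the first.
          { Ω  = λ { [] → id , IsEmb-id
                   ; (b ∷ p) → proj₁ (Ω′ p) ∘ (_++ b ∷ []) , IsEmb-∘ (proj₂ (Ω′ p)) (IsEmb-++ (b ∷ [])) }
          ; X  = Y
          ; X∈ = Y∈
          ; X≼ = λ v∈ → X≼ (Y≼X v∈)
          }

      stage : ∀ k → Stage k
      stage zero    = record { Ω = λ _ → id , IsEmb-id ; X = X₀ ; X∈ = X₀∈ ; X≼ = ≼-refl X₀ }
      stage (suc k) = Step.next (stage k)

      chain : ℕ → E∞
      chain k = Stage.X (stage k)

      Ω⟨_⟩ : Node → Emb
      Ω⟨ p ⟩ = Step.Ω′ (stage (length p)) p

      Ψ⟨_⟩ : Node → Emb
      Ψ⟨ p ⟩ = Step.Ψ (stage (length p)) p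

      -- The position of p is the root of its subtree at the end of its stage; later stages only
      -- thin what lies above.
      Θ : Node → Node
      Θ p = proj₁ Ω⟨ p ⟩ []

      Θ-emb : IsEmb Θ
      Θ-emb b p = IsEmb-extend (proj₂ Ω⟨ p ⟩) (proj₁ Ψ⟨ b ∷ p ⟩ []) b []

      -- The thinning accumulated between the stages of p and `r ++ p`; it exhibits Θ above p as a
      -- subtree of `Ω⟨ p ⟩`.
      ξ : Node → Node → Emb
      ξ p []      = id , IsEmb-id
      ξ p (b ∷ r) =
        (λ q → proj₁ (ξ p r) (proj₁ Ψ⟨ b ∷ r ++ p ⟩ q ++ b ∷ [])) ,
        IsEmb-∘ (proj₂ (ξ p r)) (IsEmb-∘ (IsEmb-++ (b ∷ [])) (proj₂ Ψ⟨ b ∷ r ++ p ⟩))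

      Ω-ξ : ∀ p r q → proj₁ Ω⟨ r ++ p ⟩ q ≡ proj₁ Ω⟨ p ⟩ (proj₁ (ξ p r) q)
      Ω-ξ p []      q = refl
      Ω-ξ p (b ∷ r) q = Ω-ξ p r (proj₁ Ψ⟨ b ∷ r ++ p ⟩ q ++ b ∷ [])

      Θ-⊑ : ∀ p → Θ ∘ (_++ p) ⊑ proj₁ Ω⟨ p ⟩
      Θ-⊑ p = (λ r → proj₁ (ξ p r) []) ,
        (λ b r → IsEmb-extend (proj₂ (ξ p r)) (proj₁ Ψ⟨ b ∷ r ++ p ⟩ []) b []) ,
        λ r → Ω-ξ p r []

      diagonal : ∃[ Y ] Y ∈ H × (∀ k → Y ≼* chain k)
      diagonal = hasP chain (λ k → Stage.X∈ (stage k)) (λ k → Step.Y≼X (stage k))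

    abstract
      -- Stage k meets `R k` at all nodes of level k. The limit tree refines the subtree of that
      -- stage, and a tail of the limit sequence lies below `chain (suc k)`, so robustness transfers
      -- `R k`.
      fusion : Σ[ Ψ ∈ (Node → Node) ] ∃[ Y ] IsEmb Ψ × Y ∈ H × Y ≼ X₀ ×
               (∀ k p → k ≤ length p → R k (Ψ ∘ (_++ p)) Y)
      fusion =
        let Y , Y∈ , Y≼* = diagonal
            d , Y↓≼X₀    = ≼*⇒≼ {X₀} {Y} (Y≼* 0)
        in Θ , Y ↓ d , Θ-emb , H-↓ Y∈ d , Y↓≼X₀ , λ k p k≤ → meets Y Y≼* d k p k≤
        where
        meets : ∀ Y → (∀ k → Y ≼* chain k) → ∀ d k p → k ≤ length p → R k (Θ ∘ (_++ p)) (Y ↓ d)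
        meets Y Y≼* d k p k≤ with splitNode k p k≤
        -- Here q is the ancestor of p at level k, where `R k` was met.
        ... | s , q , refl , refl =
          let d₁ , Y↓≼ = ≼*⇒≼ {chain (suc k)} {Y} (Y≼* (suc k))
              d₂ , ≼Y↓ = ≼-tail {Y} {Y ↓ d} (↓-≼ Y d) d₁
          in thin (IsEmb-∘ Θ-emb (IsEmb-++ q)) (_++ s , IsEmb-++ s , λ r → cong Θ (sym (Listₚ.++-assoc r s q)))
               (untail {X = Y ↓ d} d₂
                 (below {X = chain (suc k)} {Y ↓ d ↓ d₂} (λ v∈ → Y↓≼ (≼Y↓ v∈))
                   (thin (proj₂ Ω⟨ q ⟩) (Θ-⊑ q) (Step.met (stage k) q refl))))
          where open IsRobust (robust k)

-- Strategies for II

module Machines (em : ∀ {u} → ExcludedMiddle u) {c ℓ m ℓm}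
              (F : CommutativeRing c ℓ) (isField : IsField F)
              (countable : Countable (CommutativeRing.setoid F))
              (E : Module F m ℓm) (e : ℕ → Module.Carrierᴹ E)
              (basis : LinearAlgebra.IsBasis F E e) where

  open Classical em
  open Module E hiding (_≉ᴹ_)
  open BlockSequences F E e
  open Blocks em F isField countable E e basis
  open LinearAlgebra F E using (Range)
  open Coordinates F E e basis using (Lin; Lin-mono; Lin-least; Lin-resp; Lin⇒Span; null; _∷⟨_⟩_)

  -- II may only play such codes, so that `hist` of the outcome is literally the list of numbers
  -- played.
  Canonical : ℕ → Set
  Canonical v = code (decode v) ≡ v

  code-canonical : ∀ y → Canonical (code y)
  code-canonical y = code-cong (decode-code y)

  -- Codes of the first k vectors, the last one first.
  hist : E∞ → ℕ → List ℕ
  hist Y zero    = []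
  hist Y (suc k) = code (vec Y k) ∷ hist Y k

  hist-length : ∀ Y k → length (hist Y k) ≡ k
  hist-length Y zero    = refl
  hist-length Y (suc k) = cong suc (hist-length Y k)

  Past : E∞ → ℕ → Pred Carrierᴹ _
  Past Y k u = Any (λ n → u ≈ᴹ decode n) (hist Y k)

  Past-mono : ∀ Y {k l} → k ≤ l → Past Y k ⊆ Past Y l
  Past-mono Y {k} {zero}  z≤n u∈ = u∈
  Past-mono Y {k} {suc l} le  u∈ with ℕₚ.m≤n⇒m<n∨m≡n le
  ... | inj₁ (s≤s le′) = there (Past-mono Y le′ u∈)
  ... | inj₂ refl      = u∈

  -- A combination involves finitely many terms, hence only a finite part of the play.
  Lin-Past : ∀ Y {v} → Lin (Range (vec Y)) v → ∃[ k ] Lin (Past Y k) v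
  Lin-Past Y (null z) = 0 , null z
  Lin-Past Y ((n , u≈) ∷⟨ x , v≈ ⟩ w) =
    let k , w∈ = Lin-Past Y w
    in suc n ⊔ k , Past-mono Y (ℕₚ.m≤m⊔n (suc n) k) (here (≈ᴹ-trans u≈ (≈ᴹ-sym (decode-code (vec Y n)))))
                   ∷⟨ x , v≈ ⟩ Lin-mono (Past-mono Y (ℕₚ.m≤n⊔m (suc n) k)) w∈

  -- A nondeterministic strategy for II with memory: any good answer is allowed, and `meet` finds
  -- one for each possible move of I.
  record Machine (X : E∞) (s g : Level) : Set (c ⊔ℓ ℓ ⊔ℓ m ⊔ℓ ℓm ⊔ℓ lsuc (s ⊔ℓ g)) where
    field
      State     : Set s
      start     : State
      Good      : State → ℕ → Set g
      next      : ∀ st v → Good st v → State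
      meet      : ∀ st Z → Z ≼ X → ∃[ v ] Good st v × decode v ∈ ⟨ Z ⟩
      canonical : ∀ {st v} → Good st v → Canonical v
      nonzero   : ∀ {st v} → Good st v → ¬ decode v ≈ᴹ 0ᴹ
      block     : ∀ {st v w} (good : Good st v) → Good (next st v good) w → decode v ≪ decode w

  -- II plays the vector with the least admissible code, so that the answer
  -- depends only on the spans of I's moves.
  module Run {X s g} (M : Machine X s g) where
    open Machine M

    Admissible : State → Below X → ℕ → Set _
    Admissible st Y v = Good st v × decode v ∈ ⟨ proj₁ Y ⟩

    choice : ∀ st Y → ∃ (Least (Admissible st Y))
    choice st (Y , Y≼X) = least _ (meet st Y λ {v} → Y≼X {v})

    choose : State → Below X → ℕ
    choose st Y = proj₁ (choice st Y)

    step : State → ℕ → State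
    step st v with em {P = Good st v}
    ... | yes good = next st v good
    -- The default makes `step` a function of the number alone, without a proof that it is good.
    ... | no  _    = st

    step-next : ∀ {st v} → Good st v → ∃[ good ] step st v ≡ next st v good
    step-next {st} {v} good′ with em {P = Good st v}
    ... | yes good = good , refl
    ... | no ¬good = ⊥-elim (¬good good′)

    moveFrom : ∀ {k} → State → Vec (Below X) (suc k) → ℕ
    moveFrom {zero}  st (Y Vec.∷ _) = choose st Y
    moveFrom {suc k} st (Y Vec.∷ u) = moveFrom (step st (choose st Y)) u

    choose-cong : ∀ st {Y Z : Below X} → proj₁ Y ≈∞ proj₁ Z → choose st Y ≡ choose st Z
    choose-cong st {Y} {Z} eq = Least-unique
      (λ (good , v∈) → good , ⟨⟩-resp-≈∞ {proj₁ Y} {proj₁ Z} eq v∈)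
      (λ (good , v∈) → good , ⟨⟩-resp-≈∞ {proj₁ Z} {proj₁ Y} (λ n → ≈ᴹ-sym (eq n)) v∈)
      (proj₂ (choice st Y)) (proj₂ (choice st Z))

    moveFrom-cong : ∀ {k} st {u w : Vec (Below X) (suc k)} →
                    Pointwise (λ Y Z → proj₁ Y ≈∞ proj₁ Z) u w → moveFrom st u ≡ moveFrom st w
    moveFrom-cong {zero}  st {Y Vec.∷ _} {Z Vec.∷ _} (eq ∷ _)   = choose-cong st {Y} {Z} eq
    moveFrom-cong {suc k} st {Y Vec.∷ u} {Z Vec.∷ w} (eq ∷ eqs) =
      trans (cong (λ v → moveFrom (step st v) u) (choose-cong st {Y} {Z} eq)) (moveFrom-cong _ eqs)

    stateFrom : State → (ℕ → Below X) → ℕ → State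
    stateFrom st Y zero    = st
    stateFrom st Y (suc k) = step (stateFrom st Y k) (choose (stateFrom st Y k) (Y k))

    stateFrom-shift : ∀ st Y k →
      stateFrom (step st (choose st (Y 0))) (Y ∘ suc) k ≡ stateFrom st Y (suc k)
    stateFrom-shift st Y zero    = refl
    stateFrom-shift st Y (suc k) =
      cong (λ st → step st (choose st (Y (suc k)))) (stateFrom-shift st Y k)

    moveFrom-tabulate : ∀ k st Y →
      moveFrom st (tabulate {n = suc k} (Y ∘ toℕ)) ≡ choose (stateFrom st Y k) (Y k)
    moveFrom-tabulate zero    st Y = refl
    moveFrom-tabulate (suc k) st Y =
      trans (moveFrom-tabulate k _ (Y ∘ suc)) (cong (λ st → choose st (Y (suc k))) (stateFrom-shift st Y k))

    abstract

      state : (ℕ → Below X) → ℕ → State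
      state = stateFrom start

      played : (ℕ → Below X) → ℕ → ℕ
      played Y k = choose (state Y k) (Y k)

      played-admissible : ∀ Y k → Admissible (state Y k) (Y k) (played Y k)
      played-admissible Y k = proj₁ (proj₂ (choice (state Y k) (Y k)))

      state-zero : ∀ Y → state Y 0 ≡ start
      state-zero Y = refl

      good : ∀ Y k → Good (state Y k) (played Y k)
      good Y k = proj₁ (step-next (proj₁ (played-admissible Y k)))

      state-suc : ∀ Y k → state Y (suc k) ≡ next (state Y k) (played Y k) (good Y k)
      state-suc Y k = proj₂ (step-next (proj₁ (played-admissible Y k)))

      answer≡ : ∀ Y k → decode (moveFrom start (Y ↾ suc k)) ≡ decode (played Y k)
      answer≡ Y k = cong decode (moveFrom-tabulate k start Y)

      strategy : StrategyII X
      strategy = record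
        { move    = λ u → decode (moveFrom start u)
        ; cong    = λ eqs → ≈ᴹ-reflexive (cong decode (moveFrom-cong start eqs))
        ; inSpan  = λ Y k → subst (_∈ ⟨ proj₁ (Y k) ⟩) (sym (answer≡ Y k)) (proj₂ (played-admissible Y k))
        ; nonzero = λ Y k → subst (λ v → ¬ v ≈ᴹ 0ᴹ) (sym (answer≡ Y k)) (nonzero (good Y k))
        ; block   = λ Y k → subst (_≪ decode (moveFrom start (Y ↾ suc (suc k)))) (sym (answer≡ Y k))
            (subst (decode (played Y k) ≪_) (sym (answer≡ Y (suc k)))
              (block (good Y k) (subst (λ st → Good st (played Y (suc k))) (state-suc Y k) (good Y (suc k)))))
        }

      code-outcome : ∀ Y k → code (vec (StrategyII.outcome strategy Y) k) ≡ played Y k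
      code-outcome Y k = trans (cong code (answer≡ Y k)) (canonical (good Y k))

    outcome : (ℕ → Below X) → E∞
    outcome = StrategyII.outcome strategy

    outcome-≼ : ∀ Y → outcome Y ≼ X
    outcome-≼ Y v∈ = Lin⇒Span (Lin-least {T = Range (vec X)} gen (⟨⟩⇒Lin (outcome Y) v∈))
      where
      gen : Range (vec (outcome Y)) ⊆ Lin (Range (vec X))
      gen (k , v≈) = Lin-resp (≈ᴹ-sym v≈) (⟨⟩⇒Lin X (proj₂ (Y k) (StrategyII.inSpan strategy Y k)))

-- A level is finite, so witnesses can be joined whenever P persists under `_∨_`. The joins used are
-- maxima of numbers, pointwise maxima of strategies and intersections of neighbourhoods.
levelBound : ∀ {a b} {A : Set b} (_∨_ : A → A → A) k (P : Node → A → Set a) →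
             (∀ {p x y} → P p x → P p (x ∨ y)) → (∀ {p x y} → P p y → P p (x ∨ y)) →
             (∀ p → length p ≡ k → ∃ (P p)) → ∃[ x ] (∀ p → length p ≡ k → P p x)
levelBound _∨_ zero    P left right f = let x , Px = f [] refl in x , λ { [] _ → Px }
levelBound _∨_ (suc k) P left right f =
  let x , Px = levelBound _∨_ k (P ∘ (false ∷_)) left right (λ p eq → f (false ∷ p) (cong suc eq))
      y , Py = levelBound _∨_ k (P ∘ (true ∷_)) left right (λ p eq → f (true ∷ p) (cong suc eq))
  in x ∨ y , λ { [] () ; (false ∷ p) eq → left (Px p (ℕₚ.suc-injective eq))
               ; (true ∷ p) eq → right (Py p (ℕₚ.suc-injective eq)) }

levelChoice : ∀ {a} {k} (P : Node → Node → Set a) → (∀ p → length p ≡ k → ∃ (P p)) →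
              Σ[ f ∈ (Node → Node) ] (∀ p → length p ≡ k → P p (f p))
levelChoice {k = k} P choose = (λ p → pick p (length p ℕₚ.≟ k)) , picked
  where
  pick : ∀ p → Dec (length p ≡ k) → Node
  pick p (yes eq) = proj₁ (choose p eq)
  pick p (no _)   = []
  picked : ∀ p → length p ≡ k → P p (pick p (length p ℕₚ.≟ k))
  picked p eq with length p ℕₚ.≟ k
  ... | yes eq′ = proj₂ (choose p eq′)
  ... | no ne   = ⊥-elim (ne eq)

-- The parametrized pigeonhole principle

bit : ℕ → Bool
bit zero    = false
bit (suc _) = true

-- Lets `enumPair` enumerate pairs of a position and a node.
toNode : List ℕ → Node
toNode = map bit

toNode-surjective : ∀ p → ∃[ l ] toNode l ≡ p
toNode-surjective []          = [] , refl
toNode-surjective (false ∷ p) = let l , eq = toNode-surjective p in 0 ∷ l , cong (false ∷_) eq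
toNode-surjective (true ∷ p)  = let l , eq = toNode-surjective p in 1 ∷ l , cong (true ∷_) eq

module Pigeonhole (em : ∀ {u} → ExcludedMiddle u) {c ℓ m ℓm}
              (F : CommutativeRing c ℓ) (isField : IsField F)
              (countable : Countable (CommutativeRing.setoid F))
              (E : Module F m ℓm) (e : ℕ → Module.Carrierᴹ E)
              (basis : LinearAlgebra.IsBasis F E e)
              {h} (H : Pred (BlockSequences.E∞ F E e) h)
              (isPPlus : BlockSequences.IsPPlusFamily F E e H)
              (isStrategic : BlockSequences.IsStrategic F E e H)
              {t i} {Pt : Set t} {I : Node → Pred Pt i} (scheme : IsScheme I) where

  open Classical em
  open Module E hiding (_≉ᴹ_)
  open LinearAlgebra F E using (Range)
  open BlockSequences F E e
  open Coordinates F E e basis using (Lin; Lin-mono; Lin-least; Lin-gen; Lin-resp; Lin⇒Span; null; _∷⟨_⟩_; coord-bound)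
  open Blocks em F isField countable E e basis
  open Machines em F isField countable E e basis
  private
    isFamily = proj₁ isPPlus
    isFull   = proj₁ (proj₂ isPPlus)
    hasP     = proj₂ (proj₂ isPPlus)
  open Fusion em F isField countable E e basis H isFamily hasP

  KeepsBeyond : ∀ {n} → (List ℕ → Node → Set n) → List ℕ → Node → E∞ → ℕ → Set _
  KeepsBeyond N l p X n = ∀ {y} → y ∈ ⟨ X ⟩ → ¬ y ≈ᴹ 0ᴹ → n <supp y → ∃[ r ] N (code y ∷ l) (r ++ p)

  -- N l p says that the position l is acceptable at the node p.  Playing y_k, II
  -- keeps the position acceptable at extensions of all 2^k nodes chosen so far;
  -- as H is strategic, some outcome in H comes with a perfect tree of such nodes.
  module Play {n} (N : List ℕ → Node → Set n) (begin : N [] [])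
              (extend : ∀ {l} r {p} → N l p → N l (r ++ p))
              {X₂} (X₂∈ : X₂ ∈ H) (keepsBeyond : ∀ l p → N l p → ∃ (KeepsBeyond N l p X₂)) where

    record State : Set n where
      field
        past  : List ℕ
        node  : Node → Node
        holds : ∀ p → length p ≡ length past → N past (node p)

    lastBound : List ℕ → ℕ
    lastBound []      = 0
    lastBound (v ∷ _) = coord-bound (decode v)

    record Good (st : State) (v : ℕ) : Set (c ⊔ℓ ℓ ⊔ℓ ℓm ⊔ℓ n) where
      open State st
      field
        canonical : Canonical v
        nonzero   : ¬ decode v ≈ᴹ 0ᴹ
        beyond    : lastBound past <supp decode v
        stem      : Node → Node
        keeps     : ∀ p → length p ≡ length past → N (v ∷ past) (stem p ++ node p)

    nextNode : (Node → Node) → Node → Node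
    nextNode f []      = []
    nextNode f (b ∷ p) = b ∷ f p

    next : ∀ st v → Good st v → State
    next st v good = record
      { past  = v ∷ past
      ; node  = nextNode (λ p → stem p ++ node p)
      ; holds = λ { [] () ; (b ∷ p) eq → extend (b ∷ []) (keeps p (ℕₚ.suc-injective eq)) }
      }
      where
      open State st
      open Good good

    machine : Machine X₂ _ _
    machine = record
      { State     = State
      ; start     = record { past = [] ; node = id ; holds = λ { [] _ → begin } }
      ; Good      = Good
      ; next      = next
      ; meet      = meet
      ; canonical = Good.canonical
      ; nonzero   = Good.nonzero
      ; block     = λ good good′ → ≪-bound (Good.beyond good′)
      }
      where
      meet : ∀ st Z → Z ≼ X₂ → ∃[ v ] Good st v × decode v ∈ ⟨ Z ⟩
      meet st Z Z≼X₂ =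
        let open State st
            -- One bound for the finitely many nodes in use; y is then taken beyond it and beyond
            -- the previous answer.
            n , far = levelBound _⊔_ (length past) (λ p → KeepsBeyond N past (node p) X₂)
              (λ {_} {a} {b} f y∈ y≉0 lt → f y∈ y≉0 (<supp-weaken (ℕₚ.m≤m⊔n a b) lt))
              (λ {_} {a} {b} f y∈ y≉0 lt → f y∈ y≉0 (<supp-weaken (ℕₚ.m≤n⊔m a b) lt))
              (λ p eq → keepsBeyond past (node p) (State.holds st p eq))
            y , y∈ , y≉0 , lt = ⟨⟩-nonzero Z (n ⊔ lastBound past)
            stem , keeps = levelChoice (λ p r → N (code y ∷ past) (r ++ node p))
              λ p eq → far p eq (Z≼X₂ y∈) y≉0 (<supp-weaken (ℕₚ.m≤m⊔n n _) lt)
        in code y ,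
           record
             { canonical = code-canonical y
             ; nonzero   = λ z → y≉0 (≈ᴹ-trans (≈ᴹ-sym (decode-code y)) z)
             ; beyond    = <supp-resp (≈ᴹ-sym (decode-code y)) (<supp-weaken (ℕₚ.m≤n⊔m n _) lt)
             ; stem      = stem
             ; keeps     = keeps
             } ,
           ⟨⟩-resp Z (≈ᴹ-sym (decode-code y)) y∈

    open Run machine

    module _ (moves : ℕ → Below X₂) where

      past-hist : ∀ k → State.past (state moves k) ≡ hist (outcome moves) k
      past-hist zero    = cong State.past (state-zero moves)
      past-hist (suc k) = trans (cong State.past (state-suc moves k))
        (cong₂ _∷_ (sym (code-outcome moves k)) (past-hist k))

      branch : Node → Node
      branch p = Good.stem (good moves (length p)) p ++ State.node (state moves (length p)) p

      branch-emb : IsEmb branch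
      branch-emb b p = Good.stem (good moves (suc (length p))) (b ∷ p) ,
        cong (λ st → Good.stem (good moves (suc (length p))) (b ∷ p) ++ State.node st (b ∷ p))
          (state-suc moves (length p))

      branch-holds : ∀ p → N (hist (outcome moves) (suc (length p))) (branch p)
      branch-holds p = subst (λ l → N l (branch p))
        (cong₂ _∷_ (sym (code-outcome moves (length p))) (past-hist (length p)))
        (Good.keeps (good moves (length p)) p
          (sym (trans (cong length (past-hist (length p))) (hist-length (outcome moves) (length p)))))

    play : ∃[ W ] Σ[ Φ ∈ (Node → Node) ] W ∈ H × W ≼ X₂ × IsEmb Φ × (∀ p → N (hist W (suc (length p))) (Φ p))
    play = let moves , W∈ = isStrategic X₂ X₂∈ strategy
           in outcome moves , branch moves , W∈ , outcome-≼ moves , branch-emb moves , branch-holds moves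

  -- IsFull quantifies over predicates with values in Set only.
  Squash : ∀ {a} → Set a → Set
  Squash A = T (does (em {P = A}))

  squash : ∀ {a} {A : Set a} → A → Squash A
  squash {A = A} x with em {P = A}
  ... | yes _ = tt
  ... | no ¬x = ⊥-elim (¬x x)

  unsquash : ∀ {a} {A : Set a} → Squash A → A
  unsquash {A = A} x with em {P = A}
  ... | yes y = y

  -- The parametrized pigeonhole principle, for sets D x of vectors that are
  -- open in the parameter x.
  module _ {β} (B : ℕ → Node → Set β) where

    -- `B v` selects the nodes whose cells make up the open set of parameters x with `D x v`.
    D : Pt → ℕ → Set (i ⊔ℓ β)
    D x v = ∃[ q ] x ∈ I q × B v q

    D-open : ∀ {q v x y} r → B v q → x ∈ I q → x ∈ I r → y ∈ I r → length q ≤ length r → D y v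
    D-open {q} {v} {x} {y} r b x∈q x∈r y∈r le with IsScheme.comparable scheme q r le x∈q x∈r
    ... | s , refl = q , IsScheme.shrink* scheme s y∈r , b

    Avoids Meets : (Node → Node) → E∞ → Set _
    Avoids Θ X = ∀ {x} → x ∈ Body (I ∘ Θ) → ∀ {v} → v ∈ ⟨ X ⟩ → ¬ v ≈ᴹ 0ᴹ → ¬ D x (code v)
    Meets Θ X = ∀ {x} → x ∈ Body (I ∘ Θ) → ∀ Z → Z ≼ X → ∃[ v ] v ∈ ⟨ Z ⟩ × ¬ v ≈ᴹ 0ᴹ × D x (code v)

    _⊕_ : List ℕ → E∞ → Pred Carrierᴹ _
    (l ⊕ Z) u = Any (λ n → u ≈ᴹ decode n) l ⊎ u ∈ Range (vec Z)

    -- Badness of the finite set with codes l, at the condition (Θ , X).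
    MeetsOver : List ℕ → (Node → Node) → E∞ → Set _
    MeetsOver l Θ X = ∀ {x} → x ∈ Body (I ∘ Θ) → ∀ Z → Z ≼ X →
                      ∃[ v ] Lin (l ⊕ Z) v × ¬ v ≈ᴹ 0ᴹ × D x (code v)

    ⊕-mono : ∀ l {Y Z} → Y ≼ Z → ∀ {v} → Lin (l ⊕ Y) v → Lin (l ⊕ Z) v
    ⊕-mono l {Y} {Z} Y≼Z = Lin-least λ
      { (inj₁ u∈)       → Lin-gen (inj₁ u∈)
      ; (inj₂ (n , u≈)) → Lin-resp (≈ᴹ-sym u≈) (Lin-mono inj₂ (⟨⟩⇒Lin Z (Y≼Z (vec∈⟨⟩ Y n)))) }

    ⊕-absorb : ∀ l Z {y} → y ∈ ⟨ Z ⟩ → ∀ {v} → Lin ((code y ∷ l) ⊕ Z) v → Lin (l ⊕ Z) v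
    ⊕-absorb l Z {y} y∈ = Lin-least λ
      { (inj₁ (here u≈))  → Lin-resp (≈ᴹ-sym (≈ᴹ-trans u≈ (decode-code y))) (Lin-mono inj₂ (⟨⟩⇒Lin Z y∈))
      ; (inj₁ (there u∈)) → Lin-gen (inj₁ u∈)
      ; (inj₂ u∈)         → Lin-gen (inj₂ u∈) }

    MeetsOver-robust : ∀ l {Θ₀} → IsEmb Θ₀ → IsRobust (λ Ψ → MeetsOver l (Θ₀ ∘ Ψ))
    MeetsOver-robust l {Θ₀} emb₀ = record
      { thin   = λ { {Θ} {Θ′} embΘ (Ψ , embΨ , eq) meets x∈ →
          meets (Body-thin (IsScheme-∘ scheme (IsEmb-∘ emb₀ embΘ)) embΨ
            λ n → let p , len , x∈p = x∈ n in p , len , subst (λ q → _ ∈ I (Θ₀ q)) (eq p) x∈p) }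
      ; below  = λ Y≼X meets x∈ Z Z≼Y → meets x∈ Z λ v∈ → Y≼X (Z≼Y v∈)
      ; untail = λ {Θ} {X} d meets x∈ Z Z≼X →
          let d′ , Z↓≼ = ≼-tail {X} {Z} Z≼X d
              v , v∈ , v≉0 , Dv = meets x∈ (Z ↓ d′) Z↓≼
          in v , ⊕-mono l {Z ↓ d′} {Z} (↓-≼ Z d′) v∈ , v≉0 , Dv
      }

    NeverOver : (Node → Node) → (Node → Node) → E∞ → List ℕ → Node → Set _
    NeverOver Θ₀ Ψ X l p = Never (λ Ψ → MeetsOver l (Θ₀ ∘ Ψ)) (Ψ ∘ (_++ p)) X

    module Decided {Θ₀ X₀ Ψ₁ X₁} (emb₀ : IsEmb Θ₀) (emb₁ : IsEmb Ψ₁)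
      (X₁∈ : X₁ ∈ H) (X₁≼ : X₁ ≼ X₀)
      (decided : ∀ l → ∃[ n ] (∀ p → n ≤ length p →
        MeetsOver l (Θ₀ ∘ Ψ₁ ∘ (_++ p)) X₁ ⊎ Never (λ Ψ → MeetsOver l (Θ₀ ∘ Ψ)) (Ψ₁ ∘ (_++ p)) X₁)) where

      Θ₁ : Node → Node
      Θ₁ = Θ₀ ∘ Ψ₁

      scheme₁ : IsScheme (I ∘ Θ₁)
      scheme₁ = IsScheme-∘ scheme (IsEmb-∘ emb₀ emb₁)


      NO : List ℕ → Node → Set _
      NO = NeverOver Θ₀ Ψ₁ X₁

      NO-extend : ∀ {l} r {p} → NO l p → NO l (r ++ p)
      NO-extend {l} r {p} = IsRobust.thin (Never-robust (MeetsOver-robust l emb₀)) {X = X₁}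
        (IsEmb-∘ emb₁ (IsEmb-++ p)) (_++ r , IsEmb-++ r , λ q → cong Ψ₁ (sym (Listₚ.++-assoc q r p)))

      Keeps : List ℕ → Node → ℕ → Set _
      Keeps l p v = ∃[ r ] NO (v ∷ l) (r ++ p)

      -- As l is not bad for Y, some Z below Y and a single parameter x are such that l and Z
      -- together span nothing in `D x`. This Z works: if v in its span made l bad at a node through
      -- x, then v, being in the span of Z, could be absorbed.
      keeps-dense : ∀ {l p} → NO l p → ∀ {Y} → Y ∈ H → Y ≼ X₁ →
                    ∃[ Z ] Z ≼ Y × (∀ {v} → v ∈ ⟨ Z ⟩ → Keeps l p (code v))
      keeps-dense {l} {p} neverOver {Y} Y∈ Y≼X₁
        with em {P = ∃[ Z ] Z ≼ Y × (∀ {v} → v ∈ ⟨ Z ⟩ → Keeps l p (code v))}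
      ... | yes found = found
      ... | no ¬found = ⊥-elim (neverOver IsEmb-id Y∈ Y≼X₁ λ {x} x∈ Z Z≼Y →
              dne λ none → ¬found (Z , Z≼Y , λ {v} v∈ → keeps x∈ Z Z≼Y none v∈))
        where
        keeps : ∀ {x} → x ∈ Body (λ q → I (Θ₁ (q ++ p))) → ∀ Z → Z ≼ Y →
                ¬ (∃[ v ] Lin (l ⊕ Z) v × ¬ v ≈ᴹ 0ᴹ × D x (code v)) →
                ∀ {v} → v ∈ ⟨ Z ⟩ → Keeps l p (code v)
        keeps {x} x∈ Z Z≼Y none {v} v∈ with decided (code v ∷ l)
        ... | n , dec with x∈ n
        -- The node through x is taken high enough for badness of `code v ∷ l` to be decided there.
        ... | r , len , x∈r with dec (r ++ p) (subst (n ≤_) (sym (Listₚ.length-++ r)) (ℕₚ.≤-trans (ℕₚ.≤-reflexive (sym len)) (ℕₚ.m≤m+n _ _)))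
        ... | inj₂ neverOver′ = r , neverOver′
        ... | inj₁ meets =
          let w , w∈ , w≉0 , Dw = meets
                (Body-restrict scheme₁ {r ++ p} (Body-thin scheme₁ (IsEmb-++ p) x∈) x∈r)
                Z (λ u∈ → Y≼X₁ (Z≼Y u∈))
          in ⊥-elim (none (w , ⊕-absorb l Z v∈ w∈ , w≉0 , Dw))

      -- A property of the block sequence alone, put in the form required by `fusion`; the bound
      -- inside makes it insensitive to finite changes.
      KeepsTail : List ℕ → Node → (Node → Node) → E∞ → Set _
      KeepsTail l p _ X = NO l p → ∃ (KeepsBeyond NO l p X)

      KeepsTail-robust : ∀ l p → IsRobust (KeepsTail l p)
      KeepsTail-robust l p = record
        { thin   = λ _ _ k → k
        ; below  = λ Y≼X k neverOver → let n , f = k neverOver in n , λ y∈ → f (Y≼X y∈)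
        ; untail = λ {_} {X} d k neverOver →
            let n , f    = k neverOver
                n′ , tail = ⟨⟩-tail X d
            in n ⊔ n′ , λ y∈ y≉0 lt → f (tail y∈ (<supp-weaken (ℕₚ.m≤n⊔m n n′) lt)) y≉0 (<supp-weaken (ℕₚ.m≤m⊔n n n′) lt)
        }

      KeepsTail-dense : ∀ l p → DenseUnder X₁ (KeepsTail l p)
      KeepsTail-dense l p {X = X} _ X∈ X≼ with em {P = NO l p}
      ... | no ¬n = id , X , IsEmb-id , X∈ , ≼-refl X , λ n → ⊥-elim (¬n n)
      ... | yes neverOver =
        -- Fullness turns the dense set of vectors that keep l never bad into the whole span of a
        -- member of H.
        let Z , Z∈ , Z≼X , Z⊆ = isFull (λ v → Squash (Keeps l p (code v))) X X∈ λ Y Y∈ Y≼X →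
              let Z , Z≼Y , keep = keeps-dense neverOver Y∈ (λ v∈ → X≼ (Y≼X v∈))
              in Z , Z≼Y , λ v∈ → squash (keep v∈)
        in id , Z , IsEmb-id , Z∈ , Z≼X , λ _ → 0 , λ y∈ _ _ → unsquash (Z⊆ y∈)

      keepsEverywhere : ∃[ X₂ ] X₂ ∈ H × X₂ ≼ X₁ × (∀ l p → NO l p → ∃ (KeepsBeyond NO l p X₂))
      keepsEverywhere =
        let _ , X₂ , _ , X₂∈ , X₂≼ , keeps = fusion
              (λ k → KeepsTail (proj₁ (enumPair k)) (toNode (proj₂ (enumPair k))))
              (λ k → KeepsTail-robust _ _) X₁∈ (λ k → KeepsTail-dense _ _)
        in X₂ , X₂∈ , (λ v∈ → X₂≼ v∈) , λ l p → transfer X₂ l p λ k →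
             -- The property does not mention the tree, so any node of level k serves.
             keeps k (replicate k false) (ℕₚ.≤-reflexive (sym (Listₚ.length-replicate k)))
        where
        transfer : ∀ X l p →
          (∀ k → KeepsTail (proj₁ (enumPair k)) (toNode (proj₂ (enumPair k))) id X) → KeepsTail l p id X
        transfer X l p keeps with toNode-surjective p
        ... | s , refl with enumPair-surjective l s
        ... | k , eq = subst (λ u → KeepsTail (proj₁ u) (toNode (proj₂ u)) id X) eq (keeps k)

      -- A vector v of `D x` in the span of W already lies in the span of a finite past. By openness
      -- v is in `D y` for all y in a small enough cell through x, so that past would be bad there.
      avoids : ∀ {W Φ} → IsEmb Φ → (∀ p → NO (hist W (suc (length p))) (Φ p)) → Avoids (Θ₁ ∘ Φ) W
      avoids {W} {Φ} Φ-emb Φ-never {x} x∈ {v} v∈ v≉0 (q , x∈q , b) =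
        let k , v∈past   = Lin-Past W (⟨⟩⇒Lin W v∈)
            -- Level `length q` puts the cell inside that of q, and level k makes the past long
            -- enough to span v.
            p , len , x∈p = x∈ (length q ⊔ k)
            k≤ = ℕₚ.m≤n⇒m≤1+n (ℕₚ.≤-trans (ℕₚ.m≤n⊔m (length q) k) (ℕₚ.≤-reflexive (sym len)))
            q≤ = ℕₚ.≤-trans (ℕₚ.m≤m⊔n (length q) k) (ℕₚ.≤-trans (ℕₚ.≤-reflexive (sym len))
               (IsEmb-length (IsEmb-∘ (IsEmb-∘ emb₀ emb₁) Φ-emb) p))
        in Φ-never p IsEmb-id X₁∈ (≼-refl X₁) λ {y} y∈ Z Z≼ →
             v , Lin-mono (λ u∈ → inj₁ (Past-mono W k≤ u∈)) v∈past , v≉0 ,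
             D-open (Θ₁ (Φ p)) b x∈q x∈p (atRoot y∈) q≤
        where
        atRoot : ∀ {p y} → y ∈ Body (λ r → I (Θ₁ (r ++ p))) → y ∈ I (Θ₁ p)
        atRoot y∈ with y∈ 0
        ... | [] , _ , y∈p = y∈p

    pigeonhole : ∀ {Θ X} → IsEmb Θ → X ∈ H →
      Σ[ Ψ ∈ (Node → Node) ] ∃[ Y ] IsEmb Ψ × Y ∈ H × Y ≼ X × (Avoids (Θ ∘ Ψ) Y ⊎ Meets (Θ ∘ Ψ) Y)
    pigeonhole {Θ} {X} emb X∈
      with em {P = Σ[ Ψ ∈ (Node → Node) ] ∃[ Y ] IsEmb Ψ × Y ∈ H × Y ≼ X × Meets (Θ ∘ Ψ) Y}
    ... | yes (Ψ , Y , embΨ , Y∈ , Y≼ , meets) = Ψ , Y , embΨ , Y∈ , (λ v∈ → Y≼ v∈) , inj₂ meets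
    ... | no none =
      let Ψ₁ , X₁ , emb₁ , X₁∈ , X₁≼ , decided = fusion
            (λ k Ψ X → MeetsOver (enumList k) (Θ ∘ Ψ) X ⊎ Never (λ Ψ → MeetsOver (enumList k) (Θ ∘ Ψ)) Ψ X)
            (λ k → Decided-robust (MeetsOver-robust (enumList k) emb)) X∈
            (λ k → Decided-dense (MeetsOver-robust (enumList k) emb) X)
      in finish Ψ₁ X₁ emb₁ X₁∈ (λ v∈ → X₁≼ v∈) decided
      where
      finish : ∀ Ψ₁ X₁ → IsEmb Ψ₁ → X₁ ∈ H → X₁ ≼ X →
        (∀ k p → k ≤ length p → MeetsOver (enumList k) (Θ ∘ Ψ₁ ∘ (_++ p)) X₁ ⊎ NeverOver Θ Ψ₁ X₁ (enumList k) p) →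
        Σ[ Ψ ∈ (Node → Node) ] ∃[ Y ] IsEmb Ψ × Y ∈ H × Y ≼ X × (Avoids (Θ ∘ Ψ) Y ⊎ Meets (Θ ∘ Ψ) Y)
      finish Ψ₁ X₁ emb₁ X₁∈ X₁≼ decided =
        let X₂ , X₂∈ , X₂≼ , keeps = keepsEverywhere
            W , Φ , W∈ , W≼ , Φ-emb , Φ-never = Play.play NO begin NO-extend X₂∈ keeps
        in Ψ₁ ∘ Φ , W , IsEmb-∘ emb₁ Φ-emb , W∈ , (λ v∈ → X₁≼ (X₂≼ (W≼ v∈))) , inj₁ (avoids {W} {Φ} Φ-emb Φ-never)
        where
        atCode : ∀ l → ∃[ n ] (∀ p → n ≤ length p → MeetsOver l (Θ ∘ Ψ₁ ∘ (_++ p)) X₁ ⊎ NeverOver Θ Ψ₁ X₁ l p)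
        atCode l with enumList-surjective l
        ... | k , refl = k , decided k
        open Decided {X₀ = X} emb emb₁ X₁∈ X₁≼ atCode
        begin : NO [] []
        -- Over the empty position badness is `Meets`, which has been excluded everywhere below (Θ ,
        -- X).
        begin embΨ Y∈ Y≼ meets =
          none (_ , _ , IsEmb-∘ (IsEmb-∘ emb₁ (IsEmb-++ [])) embΨ , Y∈ , (λ v∈ → X₁≼ (Y≼ v∈)) , λ x∈ Z Z≼ →
            let v , v∈ , v≉0 , Dv = meets x∈ Z Z≼
            in v , Lin⇒Span {S = Range (vec Z)} (Lin-mono (λ { (inj₂ u∈) → u∈ }) v∈) , v≉0 , Dv)

-- The dichotomy

initial : (ℕ → ℕ) → ℕ → List ℕ
initial z zero    = []
initial z (suc k) = z k ∷ initial z k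

module Dichotomy (em : ∀ {u} → ExcludedMiddle u) {c ℓ m ℓm}
              (F : CommutativeRing c ℓ) (isField : IsField F)
              (countable : Countable (CommutativeRing.setoid F))
              (E : Module F m ℓm) (e : ℕ → Module.Carrierᴹ E)
              (basis : LinearAlgebra.IsBasis F E e)
              {h} (H : Pred (BlockSequences.E∞ F E e) h)
              (isPPlus : BlockSequences.IsPPlusFamily F E e H)
              (isStrategic : BlockSequences.IsStrategic F E e H)
              {t i} {Pt : Set t} {I : Node → Pred Pt i} (scheme : IsScheme I) where

  open Classical em
  open Module E hiding (_≉ᴹ_)
  open BlockSequences F E e
  open Coordinates F E e basis using (coord-bound)
  open Blocks em F isField countable E e basis
  open Machines em F isField countable E e basis
  open Fusion em F isField countable E e basis H (proj₁ isPPlus) (proj₂ (proj₂ isPPlus))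
  open Pigeonhole em F isField countable E e basis H isPPlus isStrategic scheme

  -- In s x Y stands for (x , Y) ∈ f[Nₛ], where f : ℕ^ℕ → Pt × E∞ is a
  -- continuous map; finite sequences s are listed with the last entry first.
  module _ {a} (In : List ℕ → Pt → E∞ → Set a)
    (In-split : ∀ {s x Y} → In s x Y → ∃[ n ] In (n ∷ s) x Y)
    (In-limit : ∀ z x Y →
      (∀ n → ∃[ k ] ∃[ q ] ∃[ x′ ] ∃[ Y′ ] n ≤ k × n ≤ length q × x ∈ I q × x′ ∈ I q ×
             hist Y′ k ≡ hist Y k × In (initial z n) x′ Y′) → In [] x Y) where

    -- I starts to play g only after the position l, whose vectors need not lie in `⟨ X ⟩`; this
    -- lets X shrink while l stays fixed.
    Follows : List ℕ → List ℕ → (Node → Node) → E∞ → (List ℕ → ℕ) → Set _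
    Follows l s Θ X g = ∀ {x} → x ∈ Body (I ∘ Θ) → ∀ Y → hist Y (length l) ≡ l →
      (∀ k → length l ≤ k → vec Y k ∈ ⟨ X ⟩ × g (hist Y k) <supp vec Y k) → ¬ In s x Y

    IWins : List ℕ → List ℕ → (Node → Node) → E∞ → Set _
    IWins l s Θ X = ∃ (Follows l s Θ X)

    Body-⊑ : ∀ {J : Node → Pred Pt i} {Θ Θ′} → IsScheme J → IsEmb Θ → Θ′ ⊑ Θ →
             Body (J ∘ Θ′) ⊆ Body (J ∘ Θ)
    Body-⊑ {J} {Θ} S emb (Ψ , embΨ , eq) x∈ = Body-thin (IsScheme-∘ S emb) embΨ
      λ n → let p , len , x∈p = x∈ n in p , len , subst (λ q → _ ∈ J q) (eq p) x∈p

    IWins-robust : ∀ l s → IsRobust (IWins l s)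
    IWins-robust l s = record
      { thin   = λ embΘ le (g , wins) → g , λ x∈ → wins (Body-⊑ scheme embΘ le x∈)
      ; below  = λ Y≼X (g , wins) → g , λ x∈ Y eq plays → wins x∈ Y eq λ k k≥ →
          let v∈ , lt = plays k k≥ in Y≼X v∈ , lt
      ; untail = λ {_} {X} d (g , wins) →
          let n , tail = ⟨⟩-tail X d
          -- Playing at least n as well forces II into `X ↓ d`.
          in (λ l → g l ⊔ n) , λ x∈ Y eq plays → wins x∈ Y eq λ k k≥ →
               let v∈ , lt = plays k k≥
               in tail v∈ (<supp-weaken (ℕₚ.m≤n⊔m (g (hist Y k)) n) lt) ,
                  <supp-weaken (ℕₚ.m≤m⊔n (g (hist Y k)) n) lt
      }

    decide : ∀ {r} {R : List ℕ → List ℕ → (Node → Node) → E∞ → Set r} →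
      (∀ l s → IsRobust (R l s)) → ∀ {X₀} → X₀ ∈ H → (∀ l s → DenseUnder X₀ (R l s)) →
      Σ[ Ψ ∈ (Node → Node) ] ∃[ X ] IsEmb Ψ × X ∈ H × X ≼ X₀ ×
      (∀ l s → ∃[ n ] (∀ p → n ≤ length p → R l s (Ψ ∘ (_++ p)) X))
    decide {R = R} robust X₀∈ dense =
      let Ψ , X , embΨ , X∈ , X≼ , dec = fusion (λ k → R (proj₁ (enumPair k)) (proj₂ (enumPair k)))
            (λ k → robust _ _) X₀∈ (λ k → dense _ _)
      in Ψ , X , embΨ , X∈ , (λ v∈ → X≼ v∈) , λ l s →
           let k , eq = enumPair-surjective l s
           in k , λ p k≤ → subst (λ u → R (proj₁ u) (proj₂ u) (Ψ ∘ (_++ p)) X) eq (dec k p k≤)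

    module First {Θ₁ X₁} (emb₁ : IsEmb Θ₁) (X₁∈ : X₁ ∈ H)
      (decided₁ : ∀ l s → ∃[ n ] (∀ p → n ≤ length p →
        IWins l s (Θ₁ ∘ (_++ p)) X₁ ⊎ Never (IWins l s) (Θ₁ ∘ (_++ p)) X₁)) where

      INever : List ℕ → List ℕ → Node → Set _
      INever l s p = Never (IWins l s) (Θ₁ ∘ (_++ p)) X₁

      Safe : Pt → List ℕ → List ℕ → Set _
      Safe x l s = ∃[ p ] x ∈ I (Θ₁ p) × INever l s p

      scheme₁ : IsScheme (I ∘ Θ₁)
      scheme₁ = IsScheme-∘ scheme emb₁

      -- From the position l, player II can reach in G[X] a position l′ that is
      -- Safe x l′ (n ∷ s) for some n.  Each set D of answers is fixed before
      -- I moves, so that a strategy can be read off extensionally.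
      data Reach (X : E∞) (x : Pt) (s : List ℕ) (l : List ℕ) :
           Set (lsuc 0ℓ ⊔ℓ c ⊔ℓ ℓ ⊔ℓ m ⊔ℓ ℓm ⊔ℓ h ⊔ℓ t ⊔ℓ i ⊔ℓ a) where
        node : (D : ℕ → Set) →
               (∀ Z → Z ≼ X → ∃[ v ] v ∈ ⟨ Z ⟩ × ¬ v ≈ᴹ 0ᴹ × D (code v)) →
               (∀ v → D v → (∃[ n ] Safe x (v ∷ l) (n ∷ s)) ⊎ Reach X x s (v ∷ l)) →
               Reach X x s l

      -- II answers Z as if I had played its tail below X; the answer still lies in the span of Z.
      Reach-transfer : ∀ {X Y x s} → (∀ Z → Z ≼ Y → ∃[ d ] Z ↓ d ≼ X) → ∀ {l} → Reach X x s l → Reach Y x s l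
      Reach-transfer {X} {Y} {x} {s} f (node D meets continue) = node D
        (λ Z Z≼Y → let d , Z↓≼X = f Z Z≼Y
                       v , v∈ , v≉0 , Dv = meets (Z ↓ d) Z↓≼X
                   in v , ↓-≼ Z d v∈ , v≉0 , Dv)
        λ v Dv → onward (continue v Dv)
        where
        onward : ∀ {l} → (∃[ n ] Safe x l (n ∷ s)) ⊎ Reach X x s l → (∃[ n ] Safe x l (n ∷ s)) ⊎ Reach Y x s l
        onward (inj₁ safe)  = inj₁ safe
        onward (inj₂ reach) = inj₂ (Reach-transfer f reach)

      Reach-below : ∀ {X Y x s l} → Y ≼ X → Reach X x s l → Reach Y x s l
      Reach-below Y≼X = Reach-transfer λ Z Z≼Y → 0 , λ v∈ → Y≼X (Z≼Y (↓-≼ Z 0 v∈))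

      Reaching : List ℕ → List ℕ → (Node → Node) → E∞ → Set _
      Reaching l s Ψ X = ∀ {x} → x ∈ Body (I ∘ Θ₁ ∘ Ψ) → Reach X x s l

      Reaching-robust : ∀ l s → IsRobust (Reaching l s)
      Reaching-robust l s = record
        { thin   = λ embΘ le reaching x∈ → reaching (Body-⊑ scheme₁ embΘ le x∈)
        ; below  = λ Y≼X reaching x∈ → Reach-below Y≼X (reaching x∈)
        ; untail = λ {_} {X} d reaching x∈ → Reach-transfer {X ↓ d} {X} (λ Z Z≼X → ≼-tail {X} {Z} Z≼X d) (reaching x∈)
        }

      module Second {Ψ₂ X₂} (emb₂ : IsEmb Ψ₂) (X₂∈ : X₂ ∈ H) (X₂≼ : X₂ ≼ X₁)
        (decided₂ : ∀ l s → ∃[ n ] (∀ p → n ≤ length p →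
          Reaching l s (Ψ₂ ∘ (_++ p)) X₂ ⊎ Never (Reaching l s) (Ψ₂ ∘ (_++ p)) X₂)) where

        scheme₂ : IsScheme (I ∘ Θ₁ ∘ Ψ₂)
        scheme₂ = IsScheme-∘ scheme₁ emb₂

        -- D (Target l s) x is the set of answers at l after which a safe
        -- position for some n ∷ s is attained or can still be reached.
        Target : List ℕ → List ℕ → ℕ → Node → Set _
        Target l s v q =
          (∃[ p ] q ≡ Θ₁ p × ∃[ n ] INever (v ∷ l) (n ∷ s) p) ⊎
          (∃[ p ] q ≡ Θ₁ (Ψ₂ p) × Reaching (v ∷ l) s (Ψ₂ ∘ (_++ p)) X₂)

        AvoidsBeyond : List ℕ → List ℕ → (Node → Node) → E∞ → ℕ → Set _
        AvoidsBeyond l s Ψ X n = ∀ {x} → x ∈ Body (I ∘ Θ₁ ∘ Ψ₂ ∘ Ψ) →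
          ∀ {v} → v ∈ ⟨ X ⟩ → ¬ v ≈ᴹ 0ᴹ → n <supp v → ¬ D (Target l s) x (code v)

        Settled : List ℕ → List ℕ → (Node → Node) → E∞ → Set _
        Settled l s Ψ X = Reaching l s (Ψ₂ ∘ Ψ) X ⊎ ∃ (AvoidsBeyond l s Ψ X)

        Settled-robust : ∀ l s → IsRobust (Settled l s)
        Settled-robust l s = record
          { thin   = λ { embΘ le (inj₁ reaching) → inj₁ λ x∈ → reaching (Body-⊑ scheme₂ embΘ le x∈)
                       ; embΘ le (inj₂ (n , avoids)) → inj₂ (n , λ x∈ → avoids (Body-⊑ scheme₂ embΘ le x∈)) }
          ; below  = λ { Y≼X (inj₁ reaching) → inj₁ λ x∈ → Reach-below Y≼X (reaching x∈)
                       ; Y≼X (inj₂ (n , avoids)) → inj₂ (n , λ x∈ v∈ → avoids x∈ (Y≼X v∈)) }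
          ; untail = λ { {Θ} {X} d (inj₁ reaching) → inj₁ (IsRobust.untail (Reaching-robust l s) {Ψ₂ ∘ Θ} {X} d reaching)
                       ; {Θ} {X} d (inj₂ (n , avoids)) →
                           let n′ , tail = ⟨⟩-tail X d
                           in inj₂ (n ⊔ n′ , λ x∈ v∈ v≉0 lt → avoids x∈
                                (tail v∈ (<supp-weaken (ℕₚ.m≤n⊔m n n′) lt)) v≉0
                                (<supp-weaken (ℕₚ.m≤m⊔n n n′) lt)) }
          }

        -- The pigeonhole principle for `Target l s`: if the targets are met, they serve as the set
        -- of answers at the first node of `Reach`; otherwise they are avoided outright.
        Settled-dense : ∀ l s → DenseUnder X₂ (Settled l s)
        Settled-dense l s {Ψ} {X} embΨ X∈ X≼ with pigeonhole (Target l s) (IsEmb-∘ (IsEmb-∘ emb₁ emb₂) embΨ) X∈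
        ... | Ψ′ , Y , embΨ′ , Y∈ , Y≼ , inj₁ avoids =
          Ψ′ , Y , embΨ′ , Y∈ , (λ v∈ → Y≼ v∈) , inj₂ (0 , λ x∈ v∈ v≉0 _ → avoids x∈ v∈ v≉0)
        ... | Ψ′ , Y , embΨ′ , Y∈ , Y≼ , inj₂ meets =
          Ψ′ , Y , embΨ′ , Y∈ , (λ v∈ → Y≼ v∈) , inj₁ λ {x} x∈ →
            node (λ v → Squash (D (Target l s) x v))
              (λ Z Z≼Y → let v , v∈ , v≉0 , Dv = meets x∈ Z Z≼Y in v , v∈ , v≉0 , squash Dv)
              λ v Dv → onward {x} x∈ v (unsquash Dv)
          where
          onward : ∀ {x} → x ∈ Body (I ∘ Θ₁ ∘ Ψ₂ ∘ Ψ ∘ Ψ′) → ∀ v → D (Target l s) x v →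
                   (∃[ n ] Safe x (v ∷ l) (n ∷ s)) ⊎ Reach Y x s (v ∷ l)
          onward x∈ v (_ , x∈q , inj₁ (p , refl , n , never)) = inj₁ (n , p , x∈q , never)
          onward x∈ v (_ , x∈q , inj₂ (p , refl , reaching)) = inj₂ (Reach-below (λ v∈ → X≼ (Y≼ v∈))
            (reaching (Body-restrict scheme₂ {p} (Body-thin scheme₂ (IsEmb-∘ embΨ embΨ′) x∈) x∈q)))

        module Third {Ψ₃ X₃} (emb₃ : IsEmb Ψ₃) (X₃∈ : X₃ ∈ H) (X₃≼ : X₃ ≼ X₂)
          (settled : ∀ l s → ∃[ n ] (∀ p → n ≤ length p → Settled l s (Ψ₃ ∘ (_++ p)) X₃)) where

          Θ₃ : Node → Node
          Θ₃ = Θ₁ ∘ Ψ₂ ∘ Ψ₃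

          scheme₃ : IsScheme (I ∘ Θ₃)
          scheme₃ = IsScheme-∘ scheme₂ emb₃

          X₃≼X₁ : X₃ ≼ X₁
          X₃≼X₁ v∈ = X₂≼ (X₃≼ v∈)

          -- If II cannot reach the next safe position from l, then I avoids
          -- every f[Nₛₙ]: beyond the bounds of AvoidsBeyond no position l′ on
          -- the way is safe for any n ∷ s, so at l′ with
          -- length l′ = suc (length l + n) I starts to follow as well
          -- the strategies for (l′ , n ∷ s) at the finitely many nodes of a
          -- suitable level.
          module Defence (l s : List ℕ) (p₀ : Node) (n₀ : ℕ)
            (avoids₀ : AvoidsBeyond l s (Ψ₃ ∘ (_++ p₀)) X₃ n₀) where

            farEnough : ∀ l′ → ∃[ n ] (∀ p → length p ≡ proj₁ (settled l′ s) →
              Reaching l′ s (Ψ₂ ∘ Ψ₃ ∘ (_++ p)) X₃ ⊎ AvoidsBeyond l′ s (Ψ₃ ∘ (_++ p)) X₃ n)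
            farEnough l′ = levelBound _⊔_ (proj₁ (settled l′ s)) _
              (λ { (inj₁ r) → inj₁ r
                 ; {_} {x} {y} (inj₂ av) → inj₂ λ x∈ v∈ v≉0 lt → av x∈ v∈ v≉0 (<supp-weaken (ℕₚ.m≤m⊔n x y) lt) })
              (λ { (inj₁ r) → inj₁ r
                 ; {_} {x} {y} (inj₂ av) → inj₂ λ x∈ v∈ v≉0 lt → av x∈ v∈ v≉0 (<supp-weaken (ℕₚ.m≤n⊔m x y) lt) })
              λ p eq → bound (proj₂ (settled l′ s) p (ℕₚ.≤-reflexive (sym eq)))
              where
              bound : ∀ {p} → Settled l′ s (Ψ₃ ∘ (_++ p)) X₃ →
                ∃[ n ] (Reaching l′ s (Ψ₂ ∘ Ψ₃ ∘ (_++ p)) X₃ ⊎ AvoidsBeyond l′ s (Ψ₃ ∘ (_++ p)) X₃ n)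
              bound (inj₁ reaching)     = 0 , inj₁ reaching
              bound (inj₂ (n , avoids)) = n , inj₂ avoids

            digit : List ℕ → ℕ
            digit l′ = length l′ ∸ suc (length l)

            joint : ∀ l′ → ∃[ g ] (∀ p → length p ≡ proj₁ (decided₁ l′ (digit l′ ∷ s)) →
              Follows l′ (digit l′ ∷ s) (Θ₁ ∘ (_++ p)) X₁ g ⊎ INever l′ (digit l′ ∷ s) p)
            joint l′ = levelBound (λ g g′ k → g k ⊔ g′ k) (proj₁ (decided₁ l′ (digit l′ ∷ s))) _
              (λ { {_} {g} {g′} (inj₁ fo) → inj₁ λ x∈ Y eq plays → fo x∈ Y eq λ k k≥ →
                     proj₁ (plays k k≥) , <supp-weaken (ℕₚ.m≤m⊔n (g (hist Y k)) _) (proj₂ (plays k k≥))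
                 ; (inj₂ never) → inj₂ never })
              (λ { {_} {g} {g′} (inj₁ fo) → inj₁ λ x∈ Y eq plays → fo x∈ Y eq λ k k≥ →
                     proj₁ (plays k k≥) , <supp-weaken (ℕₚ.m≤n⊔m (g (hist Y k)) _) (proj₂ (plays k k≥))
                 ; (inj₂ never) → inj₂ never })
              λ p eq → strategy (proj₂ (decided₁ l′ (digit l′ ∷ s)) p (ℕₚ.≤-reflexive (sym eq)))
              where
              strategy : ∀ {p} → IWins l′ (digit l′ ∷ s) (Θ₁ ∘ (_++ p)) X₁ ⊎ INever l′ (digit l′ ∷ s) p →
                ∃[ g ] (Follows l′ (digit l′ ∷ s) (Θ₁ ∘ (_++ p)) X₁ g ⊎ INever l′ (digit l′ ∷ s) p)
              strategy (inj₁ (g , fo)) = g , inj₁ fo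
              strategy (inj₂ never)    = (λ _ → 0) , inj₂ never

            -- The largest answer, at the current position `l″`, of the strategies begun at the
            -- initial segments of `l′`.
            joinAll : List ℕ → List ℕ → ℕ
            joinAll []       l″ = proj₁ (joint []) l″
            joinAll (v ∷ l′) l″ = proj₁ (joint (v ∷ l′)) l″ ⊔ joinAll l′ l″

            joint≤joinAll : ∀ Y l″ j k → j ≤ k → proj₁ (joint (hist Y j)) l″ ≤ joinAll (hist Y k) l″
            joint≤joinAll Y l″ zero    zero    le = ℕₚ.≤-refl
            joint≤joinAll Y l″ j       (suc k) le = byCases (ℕₚ.m≤n⇒m<n∨m≡n le)
              where
              byCases : j < suc k ⊎ j ≡ suc k → proj₁ (joint (hist Y j)) l″ ≤ joinAll (hist Y (suc k)) l″
              byCases (inj₁ (s≤s j≤k)) = ℕₚ.≤-trans (joint≤joinAll Y l″ j k j≤k) (ℕₚ.m≤n⊔m _ _)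
              byCases (inj₂ refl)      = ℕₚ.m≤m⊔n _ _

            defence : List ℕ → ℕ
            defence l′ = n₀ ⊔ (proj₁ (farEnough l′) ⊔ joinAll l′ l′)

            n₀≤defence : ∀ l′ → n₀ ≤ defence l′
            n₀≤defence l′ = ℕₚ.m≤m⊔n _ _

            farEnough≤defence : ∀ l′ → proj₁ (farEnough l′) ≤ defence l′
            farEnough≤defence l′ = ℕₚ.≤-trans (ℕₚ.m≤m⊔n _ _) (ℕₚ.m≤n⊔m n₀ _)

            joinAll≤defence : ∀ l′ → joinAll l′ l′ ≤ defence l′
            joinAll≤defence l′ = ℕₚ.≤-trans (ℕₚ.m≤n⊔m _ _) (ℕₚ.m≤n⊔m n₀ _)

            module _ {x} (x∈p₀ : x ∈ Body (λ q → I (Θ₃ (q ++ p₀)))) (Y : E∞)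
                     (starts : hist Y (length l) ≡ l)
                     (plays : ∀ k → length l ≤ k → vec Y k ∈ ⟨ X₃ ⟩ × defence (hist Y k) <supp vec Y k) where

              x∈ : x ∈ Body (I ∘ Θ₃)
              x∈ = Body-thin scheme₃ (IsEmb-++ p₀) x∈p₀

              x∈₂ : x ∈ Body (I ∘ Θ₁ ∘ Ψ₂)
              x∈₂ = Body-thin scheme₂ emb₃ x∈

              x∈₁ : x ∈ Body (I ∘ Θ₁)
              x∈₁ = Body-thin scheme₁ emb₂ x∈₂

              -- By induction along the play. If II could reach a safe position from `l′`, this
              -- would hold at a node where `decided₂` applies, and the move leading to `l′` would
              -- have been a target. So `l′` is settled the other way, and I plays beyond its bound.
              off-target : ∀ d → ¬ D (Target (hist Y (d + length l)) s) x (code (vec Y (d + length l)))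
              off-target zero = subst (λ l′ → ¬ D (Target l′ s) x (code (vec Y (length l)))) (sym starts)
                (avoids₀ x∈p₀ (proj₁ (plays (length l) ℕₚ.≤-refl)) (E∞.nonzero Y (length l))
                  (<supp-weaken (n₀≤defence _) (proj₂ (plays (length l) ℕₚ.≤-refl))))
              off-target (suc d) =
                let p , len , x∈p = x∈ (proj₁ (settled l′ s))
                in conclude p x∈p (proj₂ (farEnough l′) p len)
                where
                k = suc d + length l
                l′ = hist Y k
                k≥ : length l ≤ k
                k≥ = ℕₚ.m≤n+m (length l) (suc d)
                conclude : ∀ p → x ∈ I (Θ₃ p) →
                  Reaching l′ s (Ψ₂ ∘ Ψ₃ ∘ (_++ p)) X₃ ⊎ AvoidsBeyond l′ s (Ψ₃ ∘ (_++ p)) X₃ (proj₁ (farEnough l′)) →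
                  ¬ D (Target l′ s) x (code (vec Y k))
                conclude p x∈p (inj₂ avoids) = avoids (Body-restrict scheme₃ {p} x∈ x∈p)
                  (proj₁ (plays k k≥)) (E∞.nonzero Y k)
                  (<supp-weaken (farEnough≤defence l′) (proj₂ (plays k k≥)))
                conclude p x∈p (inj₁ reaching) =
                  let q , len , x∈q = x∈₂ (proj₁ (decided₂ l′ s))
                  in ⊥-elim (refute q x∈q (proj₂ (decided₂ l′ s) q (ℕₚ.≤-reflexive (sym len))))
                  where
                  refute : ∀ q → x ∈ I (Θ₁ (Ψ₂ q)) → ¬ (Reaching l′ s (Ψ₂ ∘ (_++ q)) X₂ ⊎ Never (Reaching l′ s) (Ψ₂ ∘ (_++ q)) X₂)
                  refute q x∈q (inj₁ reaching′) = off-target d (Θ₁ (Ψ₂ q) , x∈q , inj₂ (q , refl , reaching′))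
                  refute q x∈q (inj₂ never) =
                    Never-local (Reaching-robust l′ s) scheme₁ emb₂ emb₃ {p = q} {p} {X₂} {X₃} x∈ x∈q x∈p never X₃∈ X₃≼ reaching

              -- A point of f[Nₛ] lies in f[Nₛₙ] for some n. At the position of length suc n +
              -- length l, `INever` would make the preceding move a target; so I has a strategy
              -- there for `n ∷ s`, which `defence` dominates from then on.
              defends : ¬ In s x Y
              defends inS =
                let n , inN = In-split inS
                    k  = suc n + length l
                    q , len , x∈q = x∈₁ (proj₁ (decided₁ (hist Y k) (digit (hist Y k) ∷ s)))
                in contradict n q x∈q (proj₂ (joint (hist Y k)) q len) inN
                where
                contradict : ∀ n q → let l′ = hist Y (suc n + length l) in x ∈ I (Θ₁ q) →
                  Follows l′ (digit l′ ∷ s) (Θ₁ ∘ (_++ q)) X₁ (proj₁ (joint l′)) ⊎ INever l′ (digit l′ ∷ s) q →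
                  ¬ In (n ∷ s) x Y
                contradict n q x∈q (inj₂ never) _ =
                  off-target n (Θ₁ q , x∈q , inj₁ (q , refl , _ , never))
                contradict n q x∈q (inj₁ follows) inN =
                  follows (Body-restrict scheme₁ {q} x∈₁ x∈q) Y (cong (hist Y) len)
                    (λ j j≥ →
                      let k≤j = subst (_≤ j) len j≥
                          v∈ , lt = plays j (ℕₚ.≤-trans (ℕₚ.m≤n+m (length l) (suc n)) k≤j)
                      in X₃≼X₁ v∈ , <supp-weaken (ℕₚ.≤-trans (joint≤joinAll Y (hist Y j) k j k≤j)
                                                   (joinAll≤defence (hist Y j))) lt)
                    (subst (λ d → In (d ∷ s) x Y) (sym digit≡) inN)
                  where
                  k = suc n + length l
                  len : length (hist Y k) ≡ k
                  len = hist-length Y k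
                  digit≡ : digit (hist Y k) ≡ n
                  digit≡ = trans (cong (_∸ suc (length l)) len)
                    (trans (cong (_∸ suc (length l)) (sym (ℕₚ.+-suc n (length l)))) (ℕₚ.m+n∸n≡m n (suc (length l))))

          -- If the position were settled in favour of I, `Defence` would give I a win at a
          -- condition compatible with one where I never wins.
          safe⇒reach : ∀ {x l s} → x ∈ Body (I ∘ Θ₃) → Safe x l s → Reach X₃ x s l
          safe⇒reach {x} {l} {s} x∈ (q , x∈q , never) =
            let p , len , x∈p = x∈ (proj₁ (settled l s))
            in byCases p x∈p (proj₂ (settled l s) p (ℕₚ.≤-reflexive (sym len)))
            where
            byCases : ∀ p → x ∈ I (Θ₃ p) → Settled l s (Ψ₃ ∘ (_++ p)) X₃ → Reach X₃ x s l
            byCases p x∈p (inj₁ reaching)     = reaching (Body-restrict scheme₃ {p} x∈ x∈p)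
            byCases p x∈p (inj₂ (n , avoids)) = ⊥-elim
              (Never-local (IWins-robust l s) scheme emb₁ (IsEmb-∘ emb₂ emb₃) {p = q} {p} {X₁} {X₃}
                x∈ x∈q x∈p never X₃∈ X₃≼X₁
                (Defence.defence l s p n avoids , Defence.defends l s p n avoids))

          module Offence {x} (x∈ : x ∈ Body (I ∘ Θ₃)) (safe₀ : Safe x [] []) where

            record State : Set (lsuc 0ℓ ⊔ℓ c ⊔ℓ ℓ ⊔ℓ m ⊔ℓ ℓm ⊔ℓ h ⊔ℓ t ⊔ℓ i ⊔ℓ a) where
              constructor state⟨_,_,_⟩
              field
                past   : List ℕ
                digits : List ℕ
                reach  : Reach X₃ x digits past

            Answers : ∀ {s l} → Reach X₃ x s l → ℕ → Set
            Answers (node D _ _) = D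

            lastBound : List ℕ → ℕ
            lastBound []      = 0
            lastBound (v ∷ _) = coord-bound (decode v)

            record Good (st : State) (v : ℕ) : Set (c ⊔ℓ ℓ ⊔ℓ ℓm) where
              open State st
              field
                canonical : Canonical v
                nonzero   : ¬ decode v ≈ᴹ 0ᴹ
                beyond    : lastBound past <supp decode v
                answers   : Answers reach v

            -- A newly safe position fixes one more digit, and II starts afresh towards the next
            -- one.
            advance : ∀ {s} l → (∃[ n ] Safe x l (n ∷ s)) ⊎ Reach X₃ x s l → State
            advance {s} l (inj₁ (n , safe)) = state⟨ l , n ∷ s , safe⇒reach x∈ safe ⟩
            advance {s} l (inj₂ reach)      = state⟨ l , s , reach ⟩

            advance-past : ∀ {s} l w → State.past (advance {s} l w) ≡ l
            advance-past l (inj₁ _) = refl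
            advance-past l (inj₂ _) = refl

            continueWith : ∀ {s l} (reach : Reach X₃ x s l) → ∀ v → Answers reach v →
                           (∃[ n ] Safe x (v ∷ l) (n ∷ s)) ⊎ Reach X₃ x s (v ∷ l)
            continueWith (node _ _ continue) = continue

            next : ∀ st v → Good st v → State
            next st v good = advance (v ∷ State.past st) (continueWith (State.reach st) v (Good.answers good))

            meet : ∀ st Z → Z ≼ X₃ → ∃[ v ] Good st v × decode v ∈ ⟨ Z ⟩
            meet state⟨ l , s , node D meets _ ⟩ Z Z≼X₃ =
              -- The move of I is replaced by a tail beyond the previous answer, so that the answers
              -- form a block sequence.
              let y , y∈ , y≉0 , Dy = meets (Z ↓ suc (lastBound l)) (λ v∈ → Z≼X₃ (↓-≼ Z (suc (lastBound l)) v∈))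
              in code y ,
                 record
                   { canonical = code-canonical y
                   ; nonzero   = λ z → y≉0 (≈ᴹ-trans (≈ᴹ-sym (decode-code y)) z)
                   ; beyond    = <supp-resp (≈ᴹ-sym (decode-code y)) (↓-<supp Z (lastBound l) y∈)
                   ; answers   = Dy
                   } ,
                 ⟨⟩-resp Z (≈ᴹ-sym (decode-code y)) (↓-≼ Z (suc (lastBound l)) y∈)

            machine : Machine X₃ _ _
            machine = record
              { State     = State
              ; start     = state⟨ [] , [] , safe⇒reach x∈ safe₀ ⟩
              ; Good      = Good
              ; next      = next
              ; meet      = meet
              ; canonical = Good.canonical
              ; nonzero   = Good.nonzero
              ; block     = λ {st} {v} {w} good good′ → ≪-bound (subst (λ l → lastBound l <supp decode w)
                  (advance-past (v ∷ State.past st) (continueWith (State.reach st) v (Good.answers good))) (Good.beyond good′))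
              }

            open Run machine public using (strategy; outcome)
            open Run machine using (state; played; good; state-zero; state-suc; code-outcome)

            module _ (moves : ℕ → Below X₃) where

              pastAt digitsAt : ℕ → List ℕ
              pastAt k   = State.past (state moves k)
              digitsAt k = State.digits (state moves k)

              pastAt-hist : ∀ k → pastAt k ≡ hist (outcome moves) k
              pastAt-hist zero    = cong State.past (state-zero moves)
              pastAt-hist (suc k) =
                trans (cong State.past (state-suc moves k))
                  (trans (advance-past (played moves k ∷ pastAt k)
                            (continueWith (State.reach (state moves k)) (played moves k) (Good.answers (good moves k))))
                    (cong₂ _∷_ (sym (code-outcome moves k)) (pastAt-hist k)))

              Progress : ℕ → List ℕ → Set _
              Progress j s = ∃[ k ] j < k × ∃[ n ] digitsAt k ≡ n ∷ s × Safe x (pastAt k) (digitsAt k)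

              mutual
                -- `Reach` is inductive, so each move passes to a smaller subtree and a safe
                -- position is attained after finitely many moves.
                progress : ∀ {l s} (reach : Reach X₃ x s l) k → state moves k ≡ state⟨ l , s , reach ⟩ → Progress k s
                progress {l} {s} (node D meets continue) k eq =
                  advanced k (continue v Dv) (trans (state-suc moves k) (proj₂ at))
                  where
                  v = played moves k
                  at : Σ[ Dv ∈ D v ] next (state moves k) v (good moves k) ≡ advance (v ∷ l) (continue v Dv)
                  at = atNode (state moves k) (good moves k) eq
                    where
                    -- The state is generalized so that its equation with the given `Reach` can be
                    -- matched.
                    atNode : ∀ st (g : Good st v) → st ≡ state⟨ l , s , node D meets continue ⟩ →
                             Σ[ Dv ∈ D v ] next st v g ≡ advance (v ∷ l) (continue v Dv)
                    atNode _ g refl = Good.answers g , refl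
                  Dv : D v
                  Dv = proj₁ at

                advanced : ∀ {l s} k (w : (∃[ n ] Safe x l (n ∷ s)) ⊎ Reach X₃ x s l) →
                           state moves (suc k) ≡ advance l w → Progress k s
                advanced {l} {s} k (inj₁ (n , safe)) eq =
                  suc k , ℕₚ.≤-refl , n , cong State.digits eq ,
                  subst (λ st → Safe x (State.past st) (State.digits st)) (sym eq) safe
                advanced k (inj₂ reach) eq =
                  let j , k<j , rest = progress reach (suc k) eq
                  in j , ℕₚ.<-trans (ℕₚ.n<1+n k) k<j , rest

              -- The times at which the play is safe with exactly n digits fixed; together the
              -- digits form the point z of Baire space.
              hit : ℕ → Σ[ k ∈ ℕ ] Safe x (pastAt k) (digitsAt k)
              hit-suc : ∀ n → Progress (proj₁ (hit n)) (digitsAt (proj₁ (hit n)))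
              hit zero    = 0 , subst (λ st → Safe x (State.past st) (State.digits st)) (sym (state-zero moves)) safe₀
              hit (suc n) = let k , _ , _ , _ , safe = hit-suc n in k , safe
              hit-suc n = progress (State.reach (state moves (proj₁ (hit n)))) (proj₁ (hit n)) refl

              z : ℕ → ℕ
              z n = proj₁ (proj₂ (proj₂ (hit-suc n)))

              initial-z : ∀ n → digitsAt (proj₁ (hit n)) ≡ initial z n
              initial-z zero    = cong State.digits (state-zero moves)
              initial-z (suc n) = trans (proj₁ (proj₂ (proj₂ (proj₂ (hit-suc n))))) (cong (z n ∷_) (initial-z n))

              hit-≥ : ∀ n → n ≤ proj₁ (hit n)
              hit-≥ zero    = z≤n
              hit-≥ (suc n) = ℕₚ.≤-trans (s≤s (hit-≥ n)) (proj₁ (proj₂ (hit-suc n)))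

              x∈₁ : x ∈ Body (I ∘ Θ₁)
              x∈₁ = Body-thin scheme₁ (IsEmb-∘ emb₂ emb₃) x∈

              -- If no such pair existed, the constant strategy 0 would win vacuously for I at the
              -- node q.
              safe⇒In : ∀ {l s} → Safe x l s → ∀ q → x ∈ I (Θ₁ q) →
                        ∃[ x′ ] ∃[ Y′ ] x′ ∈ I (Θ₁ q) × hist Y′ (length l) ≡ l × In s x′ Y′
              safe⇒In {l} {s} (p , x∈p , never) q x∈q =
                dne λ none → Never-local (IWins-robust l s) scheme emb₁ IsEmb-id {p = p} {q} {X₁} {X₁}
                  x∈₁ x∈p x∈q never X₁∈ (≼-refl X₁)
                  ((λ _ → 0) , λ {x′} x′∈ Y′ eq _ inS → none (x′ , Y′ , atRoot x′∈ , eq , inS))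
                where
                atRoot : ∀ {x′} → x′ ∈ Body (λ r → I (Θ₁ (r ++ q))) → x′ ∈ I (Θ₁ q)
                atRoot x′∈ with x′∈ 0
                ... | [] , _ , x′∈q = x′∈q

              -- Safety at the time `hit n` yields a point of f on the first n digits of z that
              -- shares with (x , outcome) a cell and an initial segment, both of size at least n.
              wins : In [] x (outcome moves)
              wins = In-limit z x (outcome moves) λ n →
                let k , safe = hit n
                    q , len , x∈q = x∈₁ n
                    x′ , Y′ , x′∈q , eq , inS = safe⇒In safe q x∈q
                    len-past = trans (cong length (pastAt-hist k)) (hist-length (outcome moves) k)
                in k , Θ₁ q , x′ , Y′ , hit-≥ n ,
                   ℕₚ.≤-trans (ℕₚ.≤-reflexive (sym len)) (IsEmb-length emb₁ q) , x∈q , x′∈q ,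
                   trans (cong (hist Y′) (sym len-past)) (trans eq (pastAt-hist k)) ,
                   subst (λ s → In s x′ Y′) (initial-z n) inS

    Outcome : (Node → Node) → E∞ → Set _
    Outcome Θ X = IWins [] [] Θ X ⊎
      (∀ {x} → x ∈ Body (I ∘ Θ) → Σ[ α ∈ StrategyII X ] (∀ Y → In [] x (StrategyII.outcome α Y)))

    dichotomy : Σ[ Θ ∈ (Node → Node) ] ∃[ X ] IsEmb Θ × X ∈ H × Outcome Θ X
    dichotomy with em {P = Σ[ Θ ∈ (Node → Node) ] ∃[ X ] IsEmb Θ × X ∈ H × IWins [] [] Θ X}
    ... | yes (Θ , X , emb , X∈ , wins) = Θ , X , emb , X∈ , inj₁ wins
    ... | no none =
      let X₀ , X₀∈ = proj₁ (proj₁ isPPlus)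
          Θ₁ , X₁ , emb₁ , X₁∈ , _ , decided₁ =
            decide (λ l s → Decided-robust (IWins-robust l s)) X₀∈ (λ l s → Decided-dense (IWins-robust l s) X₀)
      in first Θ₁ X₁ emb₁ X₁∈ decided₁
      where
      first : ∀ Θ₁ X₁ (emb₁ : IsEmb Θ₁) (X₁∈ : X₁ ∈ H)
        (decided₁ : ∀ l s → ∃[ n ] (∀ p → n ≤ length p →
          IWins l s (Θ₁ ∘ (_++ p)) X₁ ⊎ Never (IWins l s) (Θ₁ ∘ (_++ p)) X₁)) →
        Σ[ Θ ∈ (Node → Node) ] ∃[ X ] IsEmb Θ × X ∈ H × Outcome Θ X
      first Θ₁ X₁ emb₁ X₁∈ decided₁ =
        let Ψ₂ , X₂ , emb₂ , X₂∈ , X₂≼ , decided₂ =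
              decide (λ l s → Decided-robust (Reaching-robust l s)) X₁∈ (λ l s → Decided-dense (Reaching-robust l s) X₁)
        in second Ψ₂ X₂ emb₂ X₂∈ (λ v∈ → X₂≼ v∈) decided₂
        where
        open First emb₁ X₁∈ decided₁
        second : ∀ Ψ₂ X₂ (emb₂ : IsEmb Ψ₂) (X₂∈ : X₂ ∈ H) (X₂≼ : X₂ ≼ X₁)
          (decided₂ : ∀ l s → ∃[ n ] (∀ p → n ≤ length p →
            Reaching l s (Ψ₂ ∘ (_++ p)) X₂ ⊎ Never (Reaching l s) (Ψ₂ ∘ (_++ p)) X₂)) →
          Σ[ Θ ∈ (Node → Node) ] ∃[ X ] IsEmb Θ × X ∈ H × Outcome Θ X
        second Ψ₂ X₂ emb₂ X₂∈ X₂≼ decided₂ =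
          let Ψ₃ , X₃ , emb₃ , X₃∈ , X₃≼ , settled = decide Settled-robust X₂∈ Settled-dense
          in Θ₁ ∘ Ψ₂ ∘ Ψ₃ , X₃ , IsEmb-∘ emb₁ (IsEmb-∘ emb₂ emb₃) , X₃∈ ,
             inj₂ λ x∈ → Third.Offence.strategy {Ψ₃} {X₃} emb₃ X₃∈ (λ v∈ → X₃≼ v∈) settled x∈ (safe₀ emb₂ emb₃ x∈) ,
                         Third.Offence.wins {Ψ₃} {X₃} emb₃ X₃∈ (λ v∈ → X₃≼ v∈) settled x∈ (safe₀ emb₂ emb₃ x∈)
          where
          open Second emb₂ X₂∈ X₂≼ decided₂
          -- I wins from the empty position at no condition, so at a decided node through x only
          -- `INever` is left.
          safe₀ : ∀ {Ψ₂ Ψ₃ x} → IsEmb Ψ₂ → IsEmb Ψ₃ → x ∈ Body (I ∘ Θ₁ ∘ Ψ₂ ∘ Ψ₃) → Safe x [] []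
          safe₀ emb₂ emb₃ x∈ =
            let p , len , x∈p = Body-thin scheme₁ (IsEmb-∘ emb₂ emb₃) x∈ (proj₁ (decided₁ [] []))
            in p , x∈p , never p (proj₂ (decided₁ [] []) p (ℕₚ.≤-reflexive (sym len)))
            where
            never : ∀ p → IWins [] [] (Θ₁ ∘ (_++ p)) X₁ ⊎ INever [] [] p → INever [] [] p
            never p (inj₁ wins)  = ⊥-elim (none (_ , _ , IsEmb-∘ emb₁ (IsEmb-++ p) , X₁∈ , wins))
            never p (inj₂ never) = never

-- Perfect sets of reals

third : ℚ
third = + 1 ℚ./ 3

width : ℕ → ℚ
width zero    = 1ℚ
width (suc n) = width n ℚ.* third

width-split : ∀ n → width (suc n) ℚ.+ width (suc n) ℚ.+ width (suc n) ≡ width n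
width-split n = begin
  w ℚ.* third ℚ.+ w ℚ.* third ℚ.+ w ℚ.* third ≡⟨ cong (ℚ._+ w ℚ.* third) (ℚₚ.*-distribˡ-+ w third third) ⟨
  w ℚ.* (third ℚ.+ third) ℚ.+ w ℚ.* third   ≡⟨ ℚₚ.*-distribˡ-+ w (third ℚ.+ third) third ⟨
  w ℚ.* 1ℚ                            ≡⟨ ℚₚ.*-identityʳ w ⟩
  w                                 ∎
  where
  open ≡-Reasoning
  w = width n

width-positive : ∀ n → 0ℚ ℚ.< width n
width-positive zero    = ℚₚ.positive⁻¹ 1ℚ
width-positive (suc n) = subst (ℚ._< width n ℚ.* third) (ℚₚ.*-zeroˡ third) (ℚₚ.*-monoˡ-<-pos third (width-positive n))

-- The right side is 1/(n + 1), as `mkℚᵘ` stores the denominator minus one; each division by 3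
-- outpaces the step to the next such fraction.
width-≤ : ∀ n → toℚᵘ (width n) ℚᵘ.≤ mkℚᵘ (+ 1) n
width-≤ zero    = ℚᵘₚ.≤-refl
width-≤ (suc n) = begin
  toℚᵘ (width n ℚ.* third)           ≃⟨ ℚₚ.toℚᵘ-homo-* (width n) third ⟩
  toℚᵘ (width n) ℚᵘ.* mkℚᵘ (+ 1) 2 ≤⟨ ℚᵘₚ.*-monoˡ-≤-nonNeg (mkℚᵘ (+ 1) 2) (width-≤ n) ⟩
  mkℚᵘ (+ 1) n ℚᵘ.* mkℚᵘ (+ 1) 2   ≤⟨ ℚᵘ.*≤* (ℤ.+≤+ cross) ⟩
  mkℚᵘ (+ 1) (suc n)               ∎
  where
  open ℚᵘₚ.≤-Reasoning
  cross : suc (suc n) ℕ.+ 0 ≤ suc n ℕ.* 3 ℕ.+ 0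
  cross = ℕₚ.+-monoˡ-≤ 0 (s≤s (ℕₚ.≤-trans (s≤s (ℕₚ.m≤m*n n 3)) (ℕₚ.n≤1+n _)))

width-small : ∀ {ε} → 0ℚ ℚ.< ε → ∃[ n ] width n ℚ.< ε
width-small {mkℚ (+ zero) d _}  (ℚ.*<* (ℤ.+<+ ()))
width-small {mkℚ -[1+ _ ] d _}  (ℚ.*<* ())
-- Here ε is (p + 1)/(d + 1), which exceeds the bound 1/(d + 2) at index d + 1.
width-small {mkℚ +[1+ p ] d co} _ = suc d , ℚₚ.toℚᵘ-cancel-<
  (ℚᵘₚ.≤-<-trans (width-≤ (suc d)) (ℚᵘ.*<* (ℤ.+<+ cross)))
  where
  cross : 1 ℕ.* suc d < suc p ℕ.* suc (suc d)
  cross = ℕₚ.<-≤-trans (subst (_< suc (suc d)) (sym (ℕₚ.*-identityˡ (suc d))) (ℕₚ.n<1+n (suc d)))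
                       (ℕₚ.m≤m+n (suc (suc d)) (p ℕ.* suc (suc d)))

<-+ˡ : ∀ p {q} → 0ℚ ℚ.< q → p ℚ.< p ℚ.+ q
<-+ˡ p {q} 0<q = subst (ℚ._< p ℚ.+ q) (ℚₚ.+-identityʳ p) (ℚₚ.+-monoʳ-< p 0<q)

width-decreasing : ∀ n → width (suc n) ℚ.≤ width n
width-decreasing n = subst (width (suc n) ℚ.≤_) (width-split n)
  (ℚₚ.≤-trans (ℚₚ.<⇒≤ (<-+ˡ (width (suc n)) (width-positive (suc n))))
              (ℚₚ.<⇒≤ (<-+ˡ _ (width-positive (suc n)))))

width-antitone : ∀ {m n} → m ≤ n → width n ℚ.≤ width m
width-antitone {m} {zero}  z≤n = ℚₚ.≤-refl
width-antitone {m} {suc n} le with ℕₚ.m≤n⇒m<n∨m≡n le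
... | inj₁ (s≤s le′) = ℚₚ.≤-trans (width-decreasing n) (width-antitone le′)
... | inj₂ refl      = ℚₚ.≤-refl

width-fits : ∀ {x y} → x ℚ.< y → ∃[ n ] (∀ {k} → n ≤ k → x ℚ.+ width k ℚ.< y)
width-fits {x} {y} x<y =
  let n , small = width-small (subst (ℚ._< y ℚ.+ ℚ.- x) (ℚₚ.+-inverseʳ x) (ℚₚ.+-monoˡ-< (ℚ.- x) x<y))
  in n , λ {k} le → subst (x ℚ.+ width k ℚ.<_) cancel (ℚₚ.+-monoʳ-< x (ℚₚ.≤-<-trans (width-antitone le) small))
  where
  open ≡-Reasoning
  cancel : x ℚ.+ (y ℚ.+ ℚ.- x) ≡ y
  cancel = begin
    x ℚ.+ (y ℚ.+ ℚ.- x)   ≡⟨ ℚₚ.+-comm x _ ⟩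
    y ℚ.+ ℚ.- x ℚ.+ x     ≡⟨ ℚₚ.+-assoc y (ℚ.- x) x ⟩
    y ℚ.+ (ℚ.- x ℚ.+ x)   ≡⟨ cong (ℚ._+_ y) (ℚₚ.+-inverseˡ x) ⟩
    y ℚ.+ 0ℚ          ≡⟨ ℚₚ.+-identityʳ y ⟩
    y               ∎

-- The intervals of the ternary Cantor set.
lo hi : Node → ℚ
lo []          = 0ℚ
lo (false ∷ p) = lo p
lo (true ∷ p)  = lo p ℚ.+ (width (suc (length p)) ℚ.+ width (suc (length p)))
hi p = lo p ℚ.+ width (length p)

lo<hi : ∀ p → lo p ℚ.< hi p
lo<hi p = <-+ˡ (lo p) (width-positive (length p))

hi-split : ∀ p → let v = width (suc (length p)) in lo p ℚ.+ (v ℚ.+ v) ℚ.+ v ≡ hi p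
hi-split p = trans (ℚₚ.+-assoc (lo p) _ _) (cong (ℚ._+_ (lo p)) (width-split (length p)))

lo-∷ : ∀ b p → lo p ℚ.≤ lo (b ∷ p)
lo-∷ false p = ℚₚ.≤-refl
lo-∷ true  p = ℚₚ.<⇒≤ (<-+ˡ (lo p) (ℚₚ.<-trans (width-positive (suc (length p))) (<-+ˡ _ (width-positive (suc (length p))))))

hi-∷ : ∀ b p → hi (b ∷ p) ℚ.≤ hi p
hi-∷ false p = ℚₚ.+-monoʳ-≤ (lo p) (width-decreasing (length p))
hi-∷ true  p = ℚₚ.≤-reflexive (hi-split p)

gap : ∀ p → hi (false ∷ p) ℚ.< lo (true ∷ p)
gap p = ℚₚ.+-monoʳ-< (lo p) (<-+ˡ _ (width-positive (suc (length p))))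

lo-++ : ∀ r p → lo p ℚ.≤ lo (r ++ p)
lo-++ []      p = ℚₚ.≤-refl
lo-++ (b ∷ r) p = ℚₚ.≤-trans (lo-++ r p) (lo-∷ b (r ++ p))

hi-++ : ∀ r p → hi (r ++ p) ℚ.≤ hi p
hi-++ []      p = ℚₚ.≤-refl
hi-++ (b ∷ r) p = ℚₚ.≤-trans (hi-∷ b (r ++ p)) (hi-++ r p)

module _ (t : ℝ) where
  open ℝ t

  L-≤ : ∀ {x y} → x ℚ.≤ y → L y → L x
  L-≤ {x} {y} x≤y Ly = let z , y<z , Lz = Equivalence.to (L-rounded y) Ly
                       in Equivalence.from (L-rounded x) (z , ℚₚ.≤-<-trans x≤y y<z , Lz)

  U-≤ : ∀ {x y} → x ℚ.≤ y → U x → U y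
  U-≤ {x} {y} x≤y Ux = let z , z<x , Uz = Equivalence.to (U-rounded x) Ux
                       in Equivalence.from (U-rounded y) (z , ℚₚ.<-≤-trans z<x x≤y , Uz)

  ¬U⇒L : ∀ {x y} → x ℚ.< y → ¬ U y → L x
  ¬U⇒L x<y ¬Uy with located x<y
  ... | inj₁ Lx = Lx
  ... | inj₂ Uy = ⊥-elim (¬Uy Uy)

  ¬L⇒U : ∀ {x y} → x ℚ.< y → ¬ L x → U y
  ¬L⇒U x<y ¬Lx with located x<y
  ... | inj₁ Lx = ⊥-elim (¬Lx Lx)
  ... | inj₂ Uy = Uy

-- The closed interval from `lo p` to `hi p`; for cuts, weak inequalities are negated strict ones.
record Cell (p : Node) (t : ℝ) : Set where
  constructor _,_
  field
    lo≤ : ¬ ℝ.U t (lo p)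
    ≤hi : ¬ ℝ.L t (hi p)

Cell-scheme : IsScheme Cell
Cell-scheme = record
  { shrink   = λ {b} {p} {t} (¬U , ¬L) → (λ U → ¬U (U-≤ t (lo-∷ b p) U)) , λ L → ¬L (L-≤ t (hi-∷ b p) L)
  ; disjoint = λ {b} {b′} → apart b b′
  }
  where
  apart : ∀ b b′ {p t} → t ∈ Cell (b ∷ p) → t ∈ Cell (b′ ∷ p) → b ≡ b′
  apart false false _ _ = refl
  apart true  true  _ _ = refl
  apart false true  {p} {t} (_ , ¬L) (¬U , _) = ⊥-elim (¬U (¬L⇒U t (gap p) ¬L))
  apart true  false {p} {t} (¬U , _) (_ , ¬L) = ⊥-elim (¬U (¬L⇒U t (gap p) ¬L))

_∈ʳ_ : ℝ → ℚ × ℚ → Set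
_∈ʳ_ = Space._∈ᵇ_ ℝˢ

Cell-resp : ∀ p {s t} → Space._≈_ ℝˢ s t → s ∈ Cell p → t ∈ Cell p
Cell-resp p ((_ , L⊇) , (_ , U⊇)) (¬U , ¬L) = (λ U → ¬U (U⊇ U)) , λ L → ¬L (L⊇ L)

-- Roundedness leaves rational margins between t and the ends of U; a cell through t narrower than
-- both margins cannot leave U.
Cell-small : ∀ {t} U → t ∈ʳ U → ∃[ n ] (∀ q → n ≤ length q → t ∈ Cell q → ∀ {s} → s ∈ Cell q → s ∈ʳ U)
Cell-small {t} (x , y) (Lx , Uy) =
  let x′ , x<x′ , Lx′ = Equivalence.to (ℝ.L-rounded t x) Lx
      y′ , y′<y , Uy′ = Equivalence.to (ℝ.U-rounded t y) Uy
      m , fitsˡ = width-fits x<x′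
      n , fitsʳ = width-fits y′<y
  in m ℕ.⊔ n , λ q le (¬U , ¬L) {s} (¬U′ , ¬L′) →
       ¬U⇒L s (ℚₚ.≰⇒> λ lo≤x → ¬L (L-≤ t (ℚₚ.<⇒≤ (ℚₚ.≤-<-trans (ℚₚ.+-monoˡ-≤ (width (length q)) lo≤x)
                 (fitsˡ (ℕₚ.≤-trans (ℕₚ.m≤m⊔n m n) le)))) Lx′)) ¬U′ ,
       ¬L⇒U s (ℚₚ.≤-<-trans (ℚₚ.+-monoˡ-≤ (width (length q)) (ℚₚ.≮⇒≥ λ y′<lo → ¬U (U-≤ t (ℚₚ.<⇒≤ y′<lo) Uy′)))
                 (fitsʳ (ℕₚ.≤-trans (ℕₚ.m≤n⊔m m n) le))) ¬L′

leftmost : ℕ → Node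
leftmost n = replicate n false

module _ {Θ : Node → Node} (emb : IsEmb Θ) where

  private
    path : ℕ → Node
    path n = Θ (leftmost n)

    path-++ : ∀ d n → ∃[ r ] path (d ℕ.+ n) ≡ r ++ path n
    path-++ zero    n = [] , refl
    path-++ (suc d) n =
      let r , eq = path-++ d n
          s , eq′ = emb false (leftmost (d ℕ.+ n))
      in s ++ false ∷ r , trans eq′ (trans (cong (λ p → s ++ false ∷ p) eq) (sym (Listₚ.++-assoc s (false ∷ r) (path n))))

    path-≤ : ∀ {m n} → m ≤ n → ∃[ r ] path n ≡ r ++ path m
    path-≤ {m} {n} le = subst (λ k → ∃[ r ] path k ≡ r ++ path m) (ℕₚ.m∸n+n≡m le) (path-++ (n ℕ.∸ m) m)

    lo≤hi : ∀ m n → lo (path m) ℚ.≤ hi (path n)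
    lo≤hi m n =
      let r , eq = path-≤ (ℕₚ.m≤m⊔n m n)
          s , eq′ = path-≤ (ℕₚ.m≤n⊔m m n)
      in ℚₚ.≤-trans (subst (λ q → lo (path m) ℚ.≤ lo q) (sym eq) (lo-++ r (path m)))
           (ℚₚ.≤-trans (ℚₚ.<⇒≤ (lo<hi (path (m ℕ.⊔ n))))
             (subst (λ q → hi q ℚ.≤ hi (path n)) (sym eq′) (hi-++ s (path n))))

  -- The common point of the nested intervals along the all-false branch, as the cut given by their
  -- end points.
  leftmostPoint : ℝ
  leftmostPoint = record
    { L           = λ x → ∃[ n ] x ℚ.< lo (path n)
    ; U           = λ x → ∃[ n ] hi (path n) ℚ.< x
    ; L-inhabited = lo (path 0) ℚ.+ ℚ.- 1ℚ , 0 ,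
        subst (lo (path 0) ℚ.+ ℚ.- 1ℚ ℚ.<_) (ℚₚ.+-identityʳ (lo (path 0))) (ℚₚ.+-monoʳ-< (lo (path 0)) (ℚₚ.negative⁻¹ (ℚ.- 1ℚ)))
    ; U-inhabited = hi (path 0) ℚ.+ 1ℚ , 0 , <-+ˡ (hi (path 0)) (ℚₚ.positive⁻¹ 1ℚ)
    ; L-rounded   = λ x → mk⇔
        (λ (n , lt) → let y , x<y , y< = ℚₚ.<-dense lt in y , x<y , n , y<)
        (λ (y , x<y , n , y<) → n , ℚₚ.<-trans x<y y<)
    ; U-rounded   = λ x → mk⇔
        (λ (n , lt) → let y , <y , y<x = ℚₚ.<-dense lt in y , y<x , n , <y)
        (λ (y , y<x , n , <y) → n , ℚₚ.<-trans <y y<x)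
    ; disjoint    = λ x ((m , x<) , (n , <x)) → ℚₚ.<-irrefl refl (ℚₚ.<-≤-trans (ℚₚ.<-trans <x x<) (lo≤hi m n))
    ; located     = located
    }
    where
    located : ∀ {x y} → x ℚ.< y → (∃[ n ] x ℚ.< lo (path n)) ⊎ (∃[ n ] hi (path n) ℚ.< y)
    located {x} {y} x<y with width-fits x<y
    ... | n , fits with x ℚₚ.<? lo (path n)
    ... | yes x<lo = inj₁ (n , x<lo)
    ... | no  x≮lo = inj₂ (n , ℚₚ.≤-<-trans (ℚₚ.+-monoˡ-≤ (width (length (path n))) (ℚₚ.≮⇒≥ x≮lo))
          (fits (subst (_≤ length (path n)) (Listₚ.length-replicate n) (IsEmb-length emb (leftmost n)))))

  leftmostPoint∈Body : leftmostPoint ∈ Body (Cell ∘ Θ)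
  leftmostPoint∈Body n = leftmost n , Listₚ.length-replicate n ,
    (λ (m , lt) → ℚₚ.<-irrefl refl (ℚₚ.<-≤-trans lt (lo≤hi n m))) ,
    (λ (m , lt) → ℚₚ.<-irrefl refl (ℚₚ.<-≤-trans lt (lo≤hi m n)))

module RealTopology (em : ∀ {u} → ExcludedMiddle u) where
  open Classical em

  -- The Hausdorff property: a rational z with t < z < s would separate s and t by disjoint
  -- intervals.
  ≈-by-neighbourhoods : ∀ {s t} → (∀ U V → s ∈ʳ U → t ∈ʳ V → ∃[ r ] r ∈ʳ U × r ∈ʳ V) → Space._≈_ ℝˢ s t
  ≈-by-neighbourhoods {s} {t} meet =
    ((λ {x} → L⊆ x s t meet) , λ {x} → L⊆ x t s meet′) , ((λ {x} → U⊆ x s t meet) , λ {x} → U⊆ x t s meet′)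
    where
    Meets : ℝ → ℝ → Set₁
    Meets s t = ∀ U V → s ∈ʳ U → t ∈ʳ V → ∃[ r ] r ∈ʳ U × r ∈ʳ V
    meet′ : Meets t s
    meet′ U V t∈ s∈ = let r , r∈V , r∈U = meet V U s∈ t∈ in r , r∈U , r∈V
    separated : ∀ s t → Meets s t → ∀ z → ℝ.L s z → ¬ ℝ.U t z
    separated s t meet z Lz Uz =
      let y , Uy = ℝ.U-inhabited s
          x , Lx = ℝ.L-inhabited t
          r , (Lr , _) , (_ , Ur) = meet (z , y) (x , z) (Lz , Uy) (Lx , Uz)
      in ℝ.disjoint r z (Lr , Ur)
    L⊆ : ∀ x s t → Meets s t → ℝ.L s x → ℝ.L t x
    L⊆ x s t meet Lx =
      let x′ , x<x′ , Lx′ = Equivalence.to (ℝ.L-rounded s x) Lx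
      in ¬U⇒L t x<x′ (separated s t meet x′ Lx′)
    U⊆ : ∀ x s t → Meets s t → ℝ.U s x → ℝ.U t x
    U⊆ x s t meet Ux =
      let x′ , x′<x , Ux′ = Equivalence.to (ℝ.U-rounded s x) Ux
      in ¬L⇒U t x′<x λ Lx′ → separated t s (λ U V t∈ s∈ → let r , r∈V , r∈U = meet V U s∈ t∈ in r , r∈U , r∈V) x′ Lx′ Ux′

  Cell-closed : ∀ p {t} → ¬ t ∈ Cell p → ∃[ U ] t ∈ʳ U × (∀ s → s ∈ʳ U → ¬ s ∈ Cell p)
  Cell-closed p {t} t∉ with em {P = ℝ.U t (lo p)} | em {P = ℝ.L t (hi p)}
  ... | yes U | _     = let x , L = ℝ.L-inhabited t in (x , lo p) , (L , U) , λ _ (_ , U′) (¬U , _) → ¬U U′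
  ... | no _  | yes L = let y , U = ℝ.U-inhabited t in (hi p , y) , (L , U) , λ _ (L′ , _) (_ , ¬L) → ¬L L′
  ... | no ¬U | no ¬L = ⊥-elim (t∉ (¬U , ¬L))

  Neighbourhood : ℝ → Set
  Neighbourhood t = ∃[ U ] t ∈ʳ U

  _∩ⁿ_ : ∀ {t} → Neighbourhood t → Neighbourhood t → Neighbourhood t
  _∩ⁿ_ {t} ((x , y) , (Lx , Uy)) ((x′ , y′) , (Lx′ , Uy′)) = (x ℚ.⊔ x′ , y ℚ.⊓ y′) , (L⊔ , U⊓)
    where
    L⊔ : ℝ.L t (x ℚ.⊔ x′)
    L⊔ with ℚₚ.⊔-sel x x′
    ... | inj₁ eq = subst (ℝ.L t) (sym eq) Lx
    ... | inj₂ eq = subst (ℝ.L t) (sym eq) Lx′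
    U⊓ : ℝ.U t (y ℚ.⊓ y′)
    U⊓ with ℚₚ.⊓-sel y y′
    ... | inj₁ eq = subst (ℝ.U t) (sym eq) Uy
    ... | inj₂ eq = subst (ℝ.U t) (sym eq) Uy′

  ∩ⁿ-left : ∀ {t} (N N′ : Neighbourhood t) s → s ∈ʳ proj₁ (_∩ⁿ_ {t} N N′) → s ∈ʳ proj₁ N
  ∩ⁿ-left ((x , y) , _) ((x′ , y′) , _) s (L , U) = L-≤ s (ℚₚ.p≤p⊔q x x′) L , U-≤ s (ℚₚ.p⊓q≤p y y′) U

  ∩ⁿ-right : ∀ {t} (N N′ : Neighbourhood t) s → s ∈ʳ proj₁ (_∩ⁿ_ {t} N N′) → s ∈ʳ proj₁ N′
  ∩ⁿ-right ((x , y) , _) ((x′ , y′) , _) s (L , U) = L-≤ s (ℚₚ.p≤q⊔p x x′) L , U-≤ s (ℚₚ.p⊓q≤q y y′) U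

  module _ {Θ : Node → Node} (emb : IsEmb Θ) where

    private
      scheme : IsScheme (Cell ∘ Θ)
      scheme = IsScheme-∘ Cell-scheme emb

    -- A point in none of the finitely many closed cells of a level has a neighbourhood that misses
    -- all of them.
    Body-closed : Space.Closed ℝˢ (Body (Cell ∘ Θ))
    Body-closed t adherent n = dne λ none →
      let (U , t∈U) , misses = levelBound (_∩ⁿ_ {t}) n (λ p N → ∀ s → s ∈ʳ proj₁ N → ¬ s ∈ Cell (Θ p))
            (λ {_} {N} {N′} f s s∈ → f s (∩ⁿ-left {t} N N′ s s∈)) (λ {_} {N} {N′} f s s∈ → f s (∩ⁿ-right {t} N N′ s s∈))
            λ p len → let U , t∈U , misses = Cell-closed (Θ p) {t} λ t∈ → none (p , len , t∈)
                      in (U , t∈U) , misses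
          s , s∈U , s∈ = adherent U t∈U
          p , len , s∈p = s∈ n
      in misses p len s s∈U s∈p

    -- Once the parent cell at level n fits into U, the sibling of the child through t supplies a
    -- different point of the body inside U.
    Body-noIsolatedPoints : Space.NoIsolatedPoints ℝˢ (Body (Cell ∘ Θ))
    Body-noIsolatedPoints t t∈ U t∈U = sibling (t∈ (suc n))
      where
      n = proj₁ (Cell-small {t} U t∈U)
      small = proj₂ (Cell-small {t} U t∈U)
      sibling : ∃[ p ] length p ≡ suc n × t ∈ Cell (Θ p) →
                ∃[ s ] s ∈ʳ U × s ∈ Body (Cell ∘ Θ) × ¬ Space._≈_ ℝˢ s t
      sibling (b ∷ p , len , t∈bp) =
        s , small (Θ p) (ℕₚ.≤-trans (ℕₚ.≤-reflexive (sym (ℕₚ.suc-injective len))) (IsEmb-length emb p))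
              (IsScheme.shrink scheme {b} t∈bp) (IsScheme.shrink scheme {not b} s∈p) ,
        Body-thin scheme (IsEmb-++ (not b ∷ p)) s∈ ,
        λ s≈t → not-≢ b (IsScheme.disjoint scheme {not b} {b} {p} (Cell-resp (Θ (not b ∷ p)) s≈t s∈p) t∈bp)
        where
        emb′ = IsEmb-∘ emb (IsEmb-++ (not b ∷ p))
        s = leftmostPoint emb′
        s∈ : s ∈ Body (λ q → Cell (Θ (q ++ not b ∷ p)))
        s∈ = leftmostPoint∈Body emb′
        s∈p : s ∈ Cell (Θ (not b ∷ p))
        s∈p with s∈ 0
        ... | [] , _ , x = x
        not-≢ : ∀ b → ¬ not b ≡ b
        not-≢ true  ()
        not-≢ false ()

    Body-perfect : Space.Perfect ℝˢ (Body (Cell ∘ Θ))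
    Body-perfect = Body-closed , Body-noIsolatedPoints

-- Continuous images and the theorem for analytic sets

initial-length : ∀ z k → length (initial z k) ≡ k
initial-length z zero    = refl
initial-length z (suc k) = cong suc (initial-length z k)

initial-≡ : ∀ z z′ {n j} → initial z n ≡ initial z′ n → j < n → z j ≡ z′ j
initial-≡ z z′ {suc n} {j} eq (s≤s j≤n) with ℕₚ.m≤n⇒m<n∨m≡n j≤n
... | inj₁ j<n  = initial-≡ z z′ (Listₚ.∷-injectiveʳ eq) j<n
... | inj₂ refl = Listₚ.∷-injectiveˡ eq

module Parametrized (em : ∀ {u} → ExcludedMiddle u) {c ℓ m ℓm}
              (F : CommutativeRing c ℓ) (isField : IsField F)
              (countable : Countable (CommutativeRing.setoid F))
              (E : Module F m ℓm) (e : ℕ → Module.Carrierᴹ E)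
              (basis : LinearAlgebra.IsBasis F E e) where

  open Module E hiding (_≉ᴹ_)
  open BlockSequences F E e
  open Blocks em F isField countable E e basis
  open Machines em F isField countable E e basis
  open RealTopology em

  -- The accumulator reverses the order of play, as in `hist`.
  codes : ∀ {k} → List ℕ → Vec Carrierᴹ k → List ℕ
  codes acc Vec.[]      = acc
  codes acc (v Vec.∷ u) = codes (code v ∷ acc) u

  codes-cong : ∀ {k} acc {u w : Vec Carrierᴹ k} → Pointwise _≈ᴹ_ u w → codes acc u ≡ codes acc w
  codes-cong acc []                              = refl
  codes-cong acc {v Vec.∷ u} {v′ Vec.∷ w} (v≈ ∷ u≈) =
    trans (cong (λ n → codes (n ∷ acc) u) (code-cong v≈)) (codes-cong (code v′ ∷ acc) u≈)

  onto : (ℕ → Carrierᴹ) → List ℕ → ℕ → List ℕ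
  onto y acc zero    = acc
  onto y acc (suc k) = code (y k) ∷ onto y acc k

  onto-shift : ∀ y acc k → onto (y ∘ suc) (code (y 0) ∷ acc) k ≡ onto y acc (suc k)
  onto-shift y acc zero    = refl
  onto-shift y acc (suc k) = cong (code (y (suc k)) ∷_) (onto-shift y acc k)

  codes-tabulate : ∀ y acc k → codes acc (tabulate {n = k} (y ∘ toℕ)) ≡ onto y acc k
  codes-tabulate y acc zero    = refl
  codes-tabulate y acc (suc k) = trans (codes-tabulate (y ∘ suc) (code (y 0) ∷ acc) k) (onto-shift y acc k)

  onto-hist : ∀ Y k → onto (vec Y) [] k ≡ hist Y k
  onto-hist Y zero    = refl
  onto-hist Y (suc k) = cong (code (vec Y k) ∷_) (onto-hist Y k)

  toStrategyI : (List ℕ → ℕ) → StrategyI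
  toStrategyI g = record
    { move = λ u → g (codes [] u)
    ; cong = λ u≈w → cong g (codes-cong [] u≈w)
    }

  toStrategyI-move : ∀ g Y k → StrategyI.move (toStrategyI g) (vec Y ↾ k) ≡ g (hist Y k)
  toStrategyI-move g Y k = cong g (trans (codes-tabulate (vec Y) [] k) (onto-hist Y k))

  hist-≈ : ∀ Y Y′ {k j} → hist Y k ≡ hist Y′ k → j < k → vec Y j ≈ᴹ vec Y′ j
  hist-≈ Y Y′ {suc k} {j} eq (s≤s j≤k) with ℕₚ.m≤n⇒m<n∨m≡n j≤k
  ... | inj₁ j<k  = hist-≈ Y Y′ (Listₚ.∷-injectiveʳ eq) j<k
  ... | inj₂ refl = code-injective (Listₚ.∷-injectiveˡ eq)

  private
    Product = ℝˢ ×ˢ E∞ˢ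

  module _ (f : (ℕ → ℕ) → ℝ × E∞) (continuous : Continuous Baire Product f) where

    Image : List ℕ → ℝ → E∞ → Set _
    Image s t Y = ∃[ z ] initial z (length s) ≡ s × Space._≈_ Product (f z) (t , Y)

    Image-split : ∀ {s t Y} → Image s t Y → ∃[ n ] Image (n ∷ s) t Y
    Image-split {s} (z , eq , fz≈) = z (length s) , z , cong (z (length s) ∷_) eq , fz≈

    -- The approximating pairs are values of f at points converging to z, so they converge to `f z`
    -- by continuity; they also converge to (t , Y), and limits are unique.
    Image-limit : ∀ z t Y →
      (∀ n → ∃[ k ] ∃[ q ] ∃[ t′ ] ∃[ Y′ ] n ≤ k × n ≤ length q × t ∈ Cell q × t′ ∈ Cell q ×
             hist Y′ k ≡ hist Y k × Image (initial z n) t′ Y′) → Image [] t Y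
    Image-limit z t Y approx = z , refl , ≈-by-neighbourhoods {s} {t} meet , agree
      where
      s = proj₁ (f z)
      W = proj₂ (f z)

      near : ∀ U j → s ∈ʳ U → ∀ n → ∃[ k ] ∃[ q ] ∃[ t′ ] ∃[ Y′ ] n ≤ k × n ≤ length q × t ∈ Cell q × t′ ∈ Cell q ×
             hist Y′ k ≡ hist Y k × t′ ∈ʳ U × (∀ i → i < j → vec Y′ i ≈ᴹ vec W i)
      near U j s∈U n =
        let (z₀ , n₀) , z∈ , f∈ = continuous z (U , (vec W , j)) (s∈U , λ _ _ → ≈ᴹ-refl)
            -- n₀ digits are what continuity at z asks for, while n controls the closeness to (t ,
            -- Y).
            k , q , t′ , Y′ , n≤k , n≤q , t∈q , t′∈q , hist≡ , z′ , initial≡ , (((L⊆ , _) , (U⊆ , _)) , W≈) = approx (n ⊔ n₀)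
            (Ls , Us) , close = f∈ z′ λ i i<n₀ → trans
              (initial-≡ z′ z (trans (cong (initial z′) (sym (initial-length z (n ⊔ n₀)))) initial≡)
                (ℕₚ.<-≤-trans i<n₀ (ℕₚ.m≤n⊔m n n₀)))
              (z∈ i i<n₀)
        in k , q , t′ , Y′ , ℕₚ.≤-trans (ℕₚ.m≤m⊔n n n₀) n≤k , ℕₚ.≤-trans (ℕₚ.m≤m⊔n n n₀) n≤q , t∈q , t′∈q , hist≡ ,
           (L⊆ Ls , U⊆ Us) , λ i i<j → ≈ᴹ-trans (≈ᴹ-sym (W≈ i)) (close i i<j)

      meet : ∀ U V → s ∈ʳ U → t ∈ʳ V → ∃[ r ] r ∈ʳ U × r ∈ʳ V
      meet U V s∈U t∈V =
        let n , small = Cell-small {t} V t∈V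
            _ , q , t′ , _ , _ , n≤q , t∈q , t′∈q , _ , t′∈U , _ = near U 0 s∈U n
        in t′ , t′∈U , small q n≤q t∈q t′∈q

      agree : ∀ j → vec W j ≈ᴹ vec Y j
      agree j =
        let x , Lx = ℝ.L-inhabited s
            y , Uy = ℝ.U-inhabited s
            _ , _ , _ , Y′ , j<k , _ , _ , _ , hist≡ , _ , close = near (x , y) (suc j) (Lx , Uy) (suc j)
        in ≈ᴹ-trans (≈ᴹ-sym (close j ℕₚ.≤-refl)) (hist-≈ Y′ Y hist≡ j<k)

theorem1p8 : (∀ {u} → ExcludedMiddle u) →
    ∀ {c ℓ m ℓm h a : Level}
    (F : CommutativeRing c ℓ) → IsField F → Countable (CommutativeRing.setoid F) →
    (E : Module F m ℓm) (e : ℕ → Module.Carrierᴹ E) → LinearAlgebra.IsBasis F E e →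
    let open BlockSequences F E e in
    (H : Pred E∞ h) → IsPPlusFamily H → IsStrategic H →
    (A : Pred (ℝ × E∞) a) → Analytic (ℝˢ ×ˢ E∞ˢ) A →
    Σ[ P ∈ Pred ℝ 0ℓ ] Satisfiable P × Space.Perfect ℝˢ P ×
    (∃[ X ] X ∈ H ×
    ( (Σ[ σ ∈ StrategyI ] (∀ t Y → t ∈ P → Y ∈ OutcomeF X σ → ¬ ((t , Y) ∈ A)))
    ⊎ (∀ t → t ∈ P → Σ[ α ∈ StrategyII X ] (∀ Y → (t , StrategyII.outcome α Y) ∈ A))))
theorem1p8 em F isField countable E e basis H isPPlus isStrategic A (inj₁ empty) =
  -- For empty `A` the Cantor set, any member of H and the constant strategy 0 give (i).
  Body Cell , (leftmostPoint IsEmb-id , leftmostPoint∈Body IsEmb-id) , Body-perfect IsEmb-id ,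
  proj₁ (proj₁ (proj₁ isPPlus)) , proj₂ (proj₁ (proj₁ isPPlus)) ,
  inj₁ (toStrategyI (λ _ → 0) , λ t Y _ _ → empty (t , Y))
  where
  open Parametrized em F isField countable E e basis
  open RealTopology em
theorem1p8 em F isField countable E e basis H isPPlus isStrategic A (inj₂ (f , continuous , A⊆ , A⊇)) =
  conclude (dichotomy (Image f continuous) (λ {s} {t} {Y} → Image-split f continuous {s} {t} {Y}) (Image-limit f continuous))
  where
  open BlockSequences F E e
  open Parametrized em F isField countable E e basis
  open RealTopology em
  open Dichotomy em F isField countable E e basis H isPPlus isStrategic Cell-scheme
  conclude : Σ[ Θ ∈ (Node → Node) ] ∃[ X ] IsEmb Θ × X ∈ H × Outcome (Image f continuous)
               (λ {s} {t} {Y} → Image-split f continuous {s} {t} {Y}) (Image-limit f continuous) Θ X →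
    Σ[ P ∈ Pred ℝ 0ℓ ] Satisfiable P × Space.Perfect ℝˢ P ×
    (∃[ X ] X ∈ H ×
    ( (Σ[ σ ∈ StrategyI ] (∀ t Y → t ∈ P → Y ∈ OutcomeF X σ → ¬ ((t , Y) ∈ A)))
    ⊎ (∀ t → t ∈ P → Σ[ α ∈ StrategyII X ] (∀ Y → (t , StrategyII.outcome α Y) ∈ A))))
  conclude (Θ , X , emb , X∈ , outcome) =
    Body (Cell ∘ Θ) , (leftmostPoint emb , leftmostPoint∈Body emb) , Body-perfect emb , X , X∈ , byCases outcome
    where
    byCases : Outcome (Image f continuous) (λ {s} {t} {Y} → Image-split f continuous {s} {t} {Y}) (Image-limit f continuous) Θ X →
      (Σ[ σ ∈ StrategyI ] (∀ t Y → t ∈ Body (Cell ∘ Θ) → Y ∈ OutcomeF X σ → ¬ ((t , Y) ∈ A)))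
      ⊎ (∀ t → t ∈ Body (Cell ∘ Θ) → Σ[ α ∈ StrategyII X ] (∀ Y → (t , StrategyII.outcome α Y) ∈ A))
    byCases (inj₁ (g , wins)) = inj₁ (toStrategyI g , λ t Y t∈ Y∈ tY∈A →
      let z , fz≈ = A⊆ tY∈A
      in wins t∈ Y refl (λ k _ → proj₁ (Y∈ k) , subst (λ n → n <supp vec Y k) (toStrategyI-move g Y k) (proj₂ (Y∈ k)))
           (z , refl , fz≈))
    byCases (inj₂ strategies) = inj₂ λ t t∈ →
      let α , wins = strategies t∈
      in α , λ Y → let z , _ , fz≈ = wins Y in A⊇ (z , fz≈)
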